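{- Let $\mathrm{ex}_3(n,BC_4)$ denote the maximum number of edges in a $3$-uniform hypergraph on $n$ vertices that contains no Berge cycle of length $4$. Then, as $n \to \infty$, \[ (1-o(1))\frac{n^{3/2}}{3\sqrt{3}} \le \mathrm{ex}_3(n,BC_4) \le (1+o(1))\frac{n^{3/2}}{\sqrt{10}}. \]
   Context: A hypergraph is $3$-uniform if all of its edges are $3$-element subsets of the vertex set. A Berge cycle of length $\ell$ in a hypergraph is a set of $\ell$ distinct vertices $\{v_1,\dots,v_\ell\}$ together with $\ell$ distinct edges $\{e_1,\dots,e_\ell\}$ such that $\{v_i,v_{i+1}\}\subseteq e_i$ for all $i$, with indices taken modulo $\ell$. -}

module Defs where

open import Data.Nat using (ℕ)
open import Data.Fin using (Fin; _<_)
open import Data.List using (List; length)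
open import Data.List.Membership.Propositional using (_∈_)
open import Data.List.Relation.Unary.Unique.Propositional using (Unique)
open import Data.Sum using (_⊎_)
open import Relation.Nullary using (¬_)
open import Data.Product using (_×_; Σ-syntax)
open import Relation.Binary.PropositionalEquality using (_≡_; _≢_)

-- A 3-element subset {a,b,c} of the vertex set Fin n, in canonical
-- (strictly increasing) form a < b < c.
record Triple (n : ℕ) : Set where
  constructor triple
  field
    a b c : Fin n
    a<b : a < b
    b<c : b < c

open Triple public

_∈₃_ : ∀ {n} → Fin n → Triple n → Set
v ∈₃ e = (v ≡ a e) ⊎ (v ≡ b e) ⊎ (v ≡ c e)

record Hypergraph3 (n : ℕ) : Set where
  constructor hypergraph
  field
    edges : List (Triple n)
    nodup : Unique edges

open Hypergraph3 public

∣E∣ : ∀ {n} → Hypergraph3 n → ℕ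
∣E∣ H = length (edges H)

record BergeC4 {n : ℕ} (H : Hypergraph3 n) : Set where
  field
    v₁ v₂ v₃ v₄ : Fin n
    e₁ e₂ e₃ e₄ : Triple n
    e₁∈ : e₁ ∈ edges H
    e₂∈ : e₂ ∈ edges H
    e₃∈ : e₃ ∈ edges H
    e₄∈ : e₄ ∈ edges H
    v₁≢v₂ : v₁ ≢ v₂
    v₁≢v₃ : v₁ ≢ v₃
    v₁≢v₄ : v₁ ≢ v₄
    v₂≢v₃ : v₂ ≢ v₃
    v₂≢v₄ : v₂ ≢ v₄
    v₃≢v₄ : v₃ ≢ v₄
    e₁≢e₂ : e₁ ≢ e₂
    e₁≢e₃ : e₁ ≢ e₃
    e₁≢e₄ : e₁ ≢ e₄
    e₂≢e₃ : e₂ ≢ e₃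
    e₂≢e₄ : e₂ ≢ e₄
    e₃≢e₄ : e₃ ≢ e₄
    v₁∈e₁ : v₁ ∈₃ e₁
    v₂∈e₁ : v₂ ∈₃ e₁
    v₂∈e₂ : v₂ ∈₃ e₂
    v₃∈e₂ : v₃ ∈₃ e₂
    v₃∈e₃ : v₃ ∈₃ e₃
    v₄∈e₃ : v₄ ∈₃ e₃
    v₄∈e₄ : v₄ ∈₃ e₄
    v₁∈e₄ : v₁ ∈₃ e₄

BC4-free : ∀ {n} → Hypergraph3 n → Set
BC4-free H = ¬ BergeC4 H

open import Data.Nat using (_≤_)
IsEx3BC4 : ℕ → ℕ → Set
IsEx3BC4 n m =
  (Σ[ H ∈ Hypergraph3 n ] (BC4-free H × ∣E∣ H ≡ m))
  × (∀ (H : Hypergraph3 n) → BC4-free H → ∣E∣ H ≤ m)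

module Submission where

-- Upper bound.  In every edge one vertex, its leaf, is designated so that the pairs {leaf, other vertex}
-- of different edges are different; they form a graph whose 4-cycles are, up to few exceptions, pairs of
-- edges with the same two non-leaves.  If z is the leaf of p(z) edges and a non-leaf of T(z), then counting
-- 2-paths gives ∑ ((2p + T)² − T²/2) ≤ n² + 12m, the left side is at least ∑ (5p + 2T)²/8, and
-- ∑ (5p + 2T) = 9m, so 81m² ≤ 8n³ + 96nm by Cauchy–Schwarz.
--
-- Lower bound.  Points and lines y = ax + b of the affine plane over 𝔽_q form a C₄-free bipartite graph;
-- doubling every line gives q³ triples on 3q² vertices without a Berge C₄.  It remains to find primes q in
-- (x, x + x/Q] for every Q and large x.  This is Erdős's consequence of Selberg's symmetry formula: if the
-- interval has no prime, then for most d the interval (x/d, x/d + x/(dQ)] carries twice the expected weight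
-- of primes, the maximum possible.  Applying this to such d and then to a prime m near x/d moves a little to
-- the right of d, so the double density spreads over a long interval, against Mertens' theorem.

open import Data.Product using (_×_; _,_; proj₁; proj₂; Σ-syntax; ∃-syntax)
open import Data.Sum using (_⊎_; inj₁; inj₂)
open import Data.Empty using (⊥; ⊥-elim)
open import Function using (_∘_)
open import Relation.Nullary using (¬_; Dec; yes; no)
open import Relation.Nullary.Decidable using (_→-dec_; _×-dec_; _⊎-dec_; ¬?)
open import Relation.Binary.PropositionalEquality using (_≡_; _≢_; refl; sym; trans; cong; cong₂; subst; subst₂; module ≡-Reasoning)

-- The lower constant needs primes p with p/√(n/3) tending to 1; a prime in (x, 2x] would lose a
-- constant factor, hence the intervals of every relative length 1/Q. No real logarithm occurs. For
-- each x a finite system on 1, ..., X is built in integer units of 1/M from harmonic sums: its `ℓ`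
-- is exactly additive, as divisor sums require, and within 2/n of H n - g. Errors carry a free
-- parameter t: against main terms of order x M (H x) they are x M (H x)/t plus a constant times M²
-- x, and the latter disappears once H x is a large multiple of M. Selberg's formula allows at most
-- double density, so mass that is nearly double on an interval is nearly double on all its long
-- subintervals; this is what lets one move a little at a time. Each move gives the Mertens sum G at
-- least 3/2 of the growth that Mertens permits. Designated vertices are needed because two edges
-- may share two vertices, so that the pairs inside edges form a multigraph. As 81/8 > 10, the term
-- 96nm is absorbed, and 10m² ≤ n³ holds for all n ≥ 92160.

module Preliminaries where

  open import Data.Nat as ℕ using (ℕ; zero; suc; z≤n; s≤s; NonZero)
  open import Data.Nat.Properties using (*-assoc; *-cancelˡ-≡; *-comm; *-distribˡ-+; *-identityʳ; *-identityˡ; *-mono-<; *-mono-≤; *-monoʳ-≤;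
    *-monoˡ-≤; *-suc; +-cancelʳ-≡; +-cancelʳ-≤; +-cancelˡ-≡; +-cancelˡ-≤; +-identityʳ; +-mono-≤; +-monoʳ-<;
    +-monoʳ-≤; +-monoˡ-<; +-monoˡ-≤; +-suc; <-cmp; <-irrefl; <-irrelevant; <-trans; <-≤-trans; <⇒≤; <⇒≱;
    ^-*-assoc; ^-distribˡ-+-*; ^-monoʳ-≤; ^-monoˡ-≤; _!≢0; allUpTo?; anyUpTo?; m+[n∸m]≡n; m+n∸n≡m; m<m+n;
    m<n+m; m∸n+n≡m; m∸n≤m; m≤m*n; m≤m+n; m≤n*m; m≤n+m; m≤n⇒m≤1+n; n<1+n; n≢0⇒n>0; n≤1+n; ∸-monoˡ-≤;
    ≤-<-trans; ≤-antisym; ≤-pred; ≤-refl; ≤-reflexive; ≤-total; ≤-trans; ≤⇒≯; ≤∧≢⇒<; ≮⇒≥; ≰⇒>)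
  import Data.Nat.DivMod as DM
  open import Data.Nat.Induction using (<-rec)
  open import Data.Nat.ListAction using (product)
  open import Data.Nat.Coprimality as Cop using (coprime-divisor; prime⇒coprime)
  open import Data.Nat.Divisibility as Dv using (_∣_; _∣?_; divides; ∣-refl; ∣-trans; m∣m*n)
  open import Data.Nat.Primality using (Prime; prime?; euclidsLemma; prime⇒irreducible; prime⇒nonZero; prime⇒nonTrivial; ¬prime⇒composite)
  open import Data.Nat.Primality.Factorisation using (PrimeFactorisation; factorise; factors)
  open import Data.Nat.Tactic.RingSolver using () renaming (solve-∀ to solveℕ)
  open import Data.Integer as ℤ using (ℤ; +_; -_; _+_; _*_; _-_; _≤_; _<_; +≤+; +<+)
  import Data.Integer.Properties as ℤP
  open import Data.Integer.Tactic.RingSolver using (solve; solve-∀)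
  open import Data.List using (List; _∷_; [])
  open import Data.List.Relation.Unary.All as All using (All)

  -- Polynomial inequalities are certified in this form: the difference of the two sides is a sum of
  -- products of nonnegative quantities, the hypotheses entering through `nn`, and the ring solver
  -- checks the identity.
  by : ∀ {u v d} → + 0 ≤ d → v - u ≡ d → u ≤ v
  by {u} {v} p e = ℤP.0≤i-j⇒j≤i (subst (+ 0 ≤_) (sym e) p)

  nn : ∀ {u v} → u ≤ v → + 0 ≤ v - u
  nn = ℤP.i≤j⇒0≤j-i

  infixl 6 _⊕_
  infixl 7 _⊗_
  _⊕_ : ∀ {a b} → + 0 ≤ a → + 0 ≤ b → + 0 ≤ a + b
  _⊕_ = ℤP.+-mono-≤

  _⊗_ : ∀ {a b} → + 0 ≤ a → + 0 ≤ b → + 0 ≤ a * b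
  _⊗_ {a} {b} p q = subst (_≤ a * b) (ℤP.*-zeroʳ a) (ℤP.*-monoˡ-≤-nonNeg a {{ℤ.nonNegative p}} q)

  pos : ∀ n → + 0 ≤ + n
  pos n = +≤+ z≤n

  cancel-≤ : ∀ {a b} c → + 0 < c → c * a ≤ c * b → a ≤ b
  cancel-≤ {a} {b} c p q = ℤP.*-cancelˡ-≤-pos a b c {{ℤ.positive p}} q

  +-ab : ∀ a b → + (a ℕ.+ b) ≡ + a + + b
  +-ab = ℤP.pos-+

  *-ab : ∀ a b → + (a ℕ.* b) ≡ + a * + b
  *-ab = ℤP.pos-*

  toℤ : ∀ {a b} → a ℕ.≤ b → + a ≤ + b
  toℤ = +≤+

  fromℤ : ∀ {a b} → + a ≤ + b → a ℕ.≤ b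
  fromℤ = ℤP.drop‿+≤+

  ≤-case : ∀ a b → (a ≤ b) ⊎ (b < a)
  ≤-case a b with a ℤP.≤? b
  ... | yes p = inj₁ p
  ... | no ¬p = inj₂ (ℤP.≰⇒> ¬p)

  <-irr : ∀ {a b} → a < b → b ≤ a → ⊥
  <-irr p q = ℤP.<-irrefl refl (ℤP.<-≤-trans p q)

  square≥0 : ∀ b → + 0 ≤ b * b
  square≥0 b with ≤-case (+ 0) b
  ... | inj₁ p = p ⊗ p
  ... | inj₂ p = subst (+ 0 ≤_) (lem b) (nn (ℤP.<⇒≤ p) ⊗ nn (ℤP.<⇒≤ p))
    where
    lem : ∀ b → (+ 0 - b) * (+ 0 - b) ≡ b * b
    lem = solve-∀

  -- Finite sums over 1, ..., n and over intervals (a, b]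

  S : ℕ → (ℕ → ℤ) → ℤ
  S zero f = + 0
  S (suc n) f = S n f + f (suc n)

  S-cong : ∀ n {f g : ℕ → ℤ} → (∀ i → 1 ℕ.≤ i → i ℕ.≤ n → f i ≡ g i) → S n f ≡ S n g
  S-cong zero h = refl
  S-cong (suc n) h = cong₂ _+_ (S-cong n λ i p q → h i p (m≤n⇒m≤1+n q)) (h (suc n) (s≤s z≤n) ≤-refl)

  S-ext : ∀ n {f g : ℕ → ℤ} → (∀ i → f i ≡ g i) → S n f ≡ S n g
  S-ext n h = S-cong n λ i _ _ → h i

  S-mono : ∀ n {f g : ℕ → ℤ} → (∀ i → 1 ℕ.≤ i → i ℕ.≤ n → f i ≤ g i) → S n f ≤ S n g
  S-mono zero h = ℤP.≤-refl
  S-mono (suc n) h = ℤP.+-mono-≤ (S-mono n λ i p q → h i p (m≤n⇒m≤1+n q)) (h (suc n) (s≤s z≤n) ≤-refl)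

  S-0 : ∀ n → S n (λ _ → + 0) ≡ + 0
  S-0 zero = refl
  S-0 (suc n) = trans (ℤP.+-identityʳ _) (S-0 n)

  S-nonneg : ∀ n {f : ℕ → ℤ} → (∀ i → 1 ℕ.≤ i → i ℕ.≤ n → + 0 ≤ f i) → + 0 ≤ S n f
  S-nonneg n {f} h = subst (_≤ S n f) (S-0 n) (S-mono n h)

  S-+ : ∀ n (f g : ℕ → ℤ) → S n (λ i → f i + g i) ≡ S n f + S n g
  S-+ zero f g = refl
  S-+ (suc n) f g = trans (cong (_+ (f (suc n) + g (suc n))) (S-+ n f g)) (lem (S n f) (S n g) (f (suc n)) (g (suc n)))
    where
    lem : ∀ a b c d → (a + b) + (c + d) ≡ (a + c) + (b + d)
    lem = solve-∀

  S-* : ∀ n c (f : ℕ → ℤ) → S n (λ i → c * f i) ≡ c * S n f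
  S-* zero c f = sym (ℤP.*-zeroʳ c)
  S-* (suc n) c f = trans (cong (_+ c * f (suc n)) (S-* n c f)) (sym (ℤP.*-distribˡ-+ c (S n f) (f (suc n))))

  S-- : ∀ n (f g : ℕ → ℤ) → S n (λ i → f i - g i) ≡ S n f - S n g
  S-- zero f g = refl
  S-- (suc n) f g = trans (cong (_+ (f (suc n) - g (suc n))) (S-- n f g)) (lem (S n f) (S n g) (f (suc n)) (g (suc n)))
    where
    lem : ∀ a b c d → (a - b) + (c - d) ≡ (a + c) - (b + d)
    lem = solve-∀

  S-swap : ∀ n m (f : ℕ → ℕ → ℤ) → S n (λ i → S m (λ j → f i j)) ≡ S m (λ j → S n (λ i → f i j))
  S-swap zero m f = sym (S-0 m)
  S-swap (suc n) m f = trans (cong (_+ S m (f (suc n))) (S-swap n m f)) (sym (S-+ m (λ j → S n (λ i → f i j)) (f (suc n))))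

  S-const : ∀ n c → S n (λ _ → c) ≡ + n * c
  S-const zero c = sym (ℤP.*-zeroˡ c)
  S-const (suc n) c = trans (cong (_+ c) (S-const n c)) (trans (lem (+ n) c) (cong (_* c) (sym (+-ab 1 n))))
    where
    lem : ∀ a b → a * b + b ≡ (+ 1 + a) * b
    lem = solve-∀

  S-split : ∀ m k (f : ℕ → ℤ) → S (m ℕ.+ k) f ≡ S m f + S k (λ i → f (m ℕ.+ i))
  S-split m zero f rewrite +-identityʳ m = sym (ℤP.+-identityʳ _)
  S-split m (suc k) f rewrite +-suc m k = trans (cong (_+ f (suc (m ℕ.+ k))) (S-split m k f)) (ℤP.+-assoc (S m f) _ _)

  S-diff : ∀ {a b} → a ℕ.≤ b → (f : ℕ → ℤ) → S b f - S a f ≡ S (b ℕ.∸ a) (λ i → f (a ℕ.+ i))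
  S-diff {a} {b} a≤b f = trans (cong (_- S a f) (trans (cong (λ z → S z f) (sym (m+[n∸m]≡n a≤b))) (S-split a (b ℕ.∸ a) f))) (lem (S a f) _)
    where
    lem : ∀ x y → (x + y) - x ≡ y
    lem = solve-∀

  Sd-mono : ∀ {a b} {f g : ℕ → ℤ} → a ℕ.≤ b → (∀ i → a ℕ.< i → i ℕ.≤ b → f i ≤ g i) → S b f - S a f ≤ S b g - S a g
  Sd-mono {a} {b} {f} {g} a≤b h = subst₂ _≤_ (sym (S-diff a≤b f)) (sym (S-diff a≤b g))
    (S-mono (b ℕ.∸ a) λ i p q → h (a ℕ.+ i) (m<m+n a p) (subst (a ℕ.+ i ℕ.≤_) (m+[n∸m]≡n a≤b) (+-monoʳ-≤ a q)))

  Sd-const : ∀ {a b} c → a ℕ.≤ b → S b (λ _ → c) - S a (λ _ → c) ≡ (+ b - + a) * c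
  Sd-const {a} {b} c a≤b = trans (cong₂ _-_ (S-const b c) (S-const a c)) (lem (+ a) (+ b) c)
    where
    lem : ∀ a b c → b * c - a * c ≡ (b - a) * c
    lem = solve-∀

  Sd-≥ : ∀ {a b} {f : ℕ → ℤ} c → a ℕ.≤ b → (∀ i → a ℕ.< i → i ℕ.≤ b → c ≤ f i) → (+ b - + a) * c ≤ S b f - S a f
  Sd-≥ {a} {b} {f} c a≤b h = subst (_≤ S b f - S a f) (Sd-const c a≤b) (Sd-mono a≤b h)

  Sd-≤ : ∀ {a b} {f : ℕ → ℤ} c → a ℕ.≤ b → (∀ i → a ℕ.< i → i ℕ.≤ b → f i ≤ c) → S b f - S a f ≤ (+ b - + a) * c
  Sd-≤ {a} {b} {f} c a≤b h = subst (S b f - S a f ≤_) (Sd-const c a≤b) (Sd-mono a≤b h)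

  S-mono-n : ∀ {a b} {f : ℕ → ℤ} → a ℕ.≤ b → (∀ i → 1 ℕ.≤ i → i ℕ.≤ b → + 0 ≤ f i) → S a f ≤ S b f
  S-mono-n {a} {b} {f} a≤b h = ℤP.0≤i-j⇒j≤i (subst (_≤ S b f - S a f) (ℤP.*-zeroʳ (+ b - + a)) (Sd-≥ (+ 0) a≤b λ i p q → h i (≤-trans (s≤s z≤n) p) q))

  -- Pigeonhole: it finds blocks of small deficit and, through `Sd-find`, good numbers.
  S-find : ∀ n {f g : ℕ → ℤ} → S n f < S n g → ∃[ i ] (1 ℕ.≤ i × i ℕ.≤ n × f i < g i)
  S-find zero p = ⊥-elim (ℤP.<-irrefl refl p)
  S-find (suc n) {f} {g} p with ≤-case (g (suc n)) (f (suc n))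
  ... | inj₂ q = suc n , s≤s z≤n , ≤-refl , q
  ... | inj₁ q with ≤-case (S n g) (S n f)
  ...   | inj₁ r = ⊥-elim (<-irr p (ℤP.+-mono-≤ r q))
  ...   | inj₂ r with S-find n r
  ...     | i , a , b , c = i , a , m≤n⇒m≤1+n b , c

  Sd-find : ∀ {a b} {f g : ℕ → ℤ} → a ℕ.≤ b → S b f - S a f < S b g - S a g → ∃[ i ] (a ℕ.< i × i ℕ.≤ b × f i < g i)
  Sd-find {a} {b} {f} {g} a≤b p with S-find (b ℕ.∸ a) (subst₂ _<_ (S-diff a≤b f) (S-diff a≤b g) p)
  ... | i , u , v , w = a ℕ.+ i , m<m+n a u , subst (a ℕ.+ i ℕ.≤_) (m+[n∸m]≡n a≤b) (+-monoʳ-≤ a v) , w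

  ι : ∀ {p} {P : Set p} → Dec P → ℤ
  ι (yes _) = + 1
  ι (no _) = + 0

  ι-yes : ∀ {p} {P : Set p} (d : Dec P) → P → ι d ≡ + 1
  ι-yes (yes _) _ = refl
  ι-yes (no n) x = ⊥-elim (n x)

  ι-no : ∀ {p} {P : Set p} (d : Dec P) → ¬ P → ι d ≡ + 0
  ι-no (yes x) n = ⊥-elim (n x)
  ι-no (no _) _ = refl

  ι-nonneg : ∀ {p} {P : Set p} (d : Dec P) → + 0 ≤ ι d
  ι-nonneg (yes _) = pos 1
  ι-nonneg (no _) = pos 0

  ι≤1 : ∀ {p} {P : Set p} (d : Dec P) → ι d ≤ + 1
  ι≤1 (yes _) = ℤP.≤-refl
  ι≤1 (no _) = pos 1

  ι-mono : ∀ {p q} {P : Set p} {Q : Set q} (d : Dec P) (e : Dec Q) → (P → Q) → ι d ≤ ι e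
  ι-mono (no _) e f = ι-nonneg e
  ι-mono (yes x) (yes _) f = ℤP.≤-refl
  ι-mono (yes x) (no n) f = ⊥-elim (n (f x))

  ι-cong : ∀ {p q} {P : Set p} {Q : Set q} (d : Dec P) (e : Dec Q) → (P → Q) → (Q → P) → ι d ≡ ι e
  ι-cong d e f g = ℤP.≤-antisym (ι-mono d e f) (ι-mono e d g)

  ι1* : ∀ {p} {P : Set p} (d : Dec P) z → P → ι d * z ≡ z
  ι1* d z x = trans (cong (_* z) (ι-yes d x)) (ℤP.*-identityˡ z)

  ι0* : ∀ {p} {P : Set p} (d : Dec P) z → ¬ P → ι d * z ≡ + 0
  ι0* d z x = trans (cong (_* z) (ι-no d x)) (ℤP.*-zeroˡ z)

  S-zero : ∀ n {f : ℕ → ℤ} → (∀ i → 1 ℕ.≤ i → i ℕ.≤ n → f i ≡ + 0) → S n f ≡ + 0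
  S-zero n h = trans (S-cong n h) (S-0 n)

  S-δ : ∀ N m (g : ℕ → ℤ) → 1 ℕ.≤ m → m ℕ.≤ N → S N (λ n → ι (n ℕ.≟ m) * g n) ≡ g m
  S-δ zero m g p q = ⊥-elim (<-irrefl refl (≤-trans p q))
  S-δ (suc N) m g p q with suc N ℕ.≟ m
  ... | yes refl = trans (cong₂ _+_ (S-zero N λ i a b → ι0* (i ℕ.≟ suc N) (g i) λ e → <-irrefl e (s≤s b)) (ℤP.*-identityˡ (g (suc N)))) (ℤP.+-identityˡ _)
  ... | no ne = trans (cong₂ _+_ (S-δ N m g p (≤-pred (≤∧≢⇒< q (ne ∘ sym)))) (ℤP.*-zeroˡ (g (suc N)))) (ℤP.+-identityʳ _)

  S-trunc : ∀ {m N} (g : ℕ → ℤ) → m ℕ.≤ N → S N (λ n → ι (n ℕ.≤? m) * g n) ≡ S m g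
  S-trunc {m} {N} g m≤N = ℤP.i-j≡0⇒i≡j _ _ (trans (cong (λ z → S N h - z) eq) (trans (S-diff m≤N h) (S-zero (N ℕ.∸ m) λ i a b → ι0* (m ℕ.+ i ℕ.≤? m) _ (<⇒≱ (m<m+n m a)))))
    where
    h : ℕ → ℤ
    h n = ι (n ℕ.≤? m) * g n
    eq : S m g ≡ S m h
    eq = S-cong m λ i a b → sym (ι1* (i ℕ.≤? m) (g i) b)

  -- Floor division and sums over pairs with bounded product

  infixl 7 _÷_
  -- Total, so that sums over the divisor need no instance arguments; `÷→` and `÷←` characterise it
  -- for k ≥ 1.
  _÷_ : ℕ → ℕ → ℕ
  x ÷ zero = 0
  x ÷ suc k = x ℕ./ suc k

  ÷→ : ∀ {x k n} → 1 ℕ.≤ k → n ℕ.≤ x ÷ k → k ℕ.* n ℕ.≤ x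
  ÷→ {x} {suc k} {n} _ p = ≤-trans (*-monoʳ-≤ (suc k) p) (subst (ℕ._≤ x) (*-comm (x ℕ./ suc k) (suc k)) (DM.m/n*n≤m x (suc k)))

  ÷← : ∀ {x k n} → 1 ℕ.≤ k → k ℕ.* n ℕ.≤ x → n ℕ.≤ x ÷ k
  ÷← {x} {suc k} {n} _ p = subst (ℕ._≤ x ℕ./ suc k) (DM.m*n/n≡m n (suc k)) (DM./-monoˡ-≤ (suc k) (subst (ℕ._≤ x) (*-comm (suc k) n) p))

  ÷< : ∀ {x k} → 1 ℕ.≤ k → x ℕ.< k ℕ.* suc (x ÷ k)
  ÷< {x} {k} p = ≰⇒> λ q → <-irrefl refl (÷← p q)

  ÷≤ : ∀ x k → x ÷ k ℕ.≤ x
  ÷≤ x zero = z≤n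
  ÷≤ x (suc k) = DM.m/n≤m x (suc k)

  ≤-ext : ∀ {a b} → (∀ n → n ℕ.≤ a → n ℕ.≤ b) → (∀ n → n ℕ.≤ b → n ℕ.≤ a) → a ≡ b
  ≤-ext f g = ≤-antisym (f _ ≤-refl) (g _ ≤-refl)

  ÷÷ : ∀ x {k j} → 1 ℕ.≤ k → 1 ℕ.≤ j → x ÷ k ÷ j ≡ x ÷ (k ℕ.* j)
  ÷÷ x {k} {j} p q = ≤-ext
    (λ n h → ÷← (*-mono-≤ p q) (subst (ℕ._≤ x) (sym (*-assoc k j n)) (÷→ p (÷→ q h))))
    (λ n h → ÷← q (÷← p (subst (ℕ._≤ x) (*-assoc k j n) (÷→ (*-mono-≤ p q) h))))

  ÷-monoˡ : ∀ {x y} k → x ℕ.≤ y → x ÷ k ℕ.≤ y ÷ k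
  ÷-monoˡ zero p = z≤n
  ÷-monoˡ (suc k) p = DM./-monoˡ-≤ (suc k) p

  ÷-monoʳ : ∀ x {k j} → 1 ℕ.≤ k → k ℕ.≤ j → x ÷ j ℕ.≤ x ÷ k
  ÷-monoʳ x {k} {j} p q = ÷← p (≤-trans (*-monoˡ-≤ (x ÷ j) q) (÷→ (≤-trans p q) ≤-refl))

  ÷1 : ∀ x → x ÷ 1 ≡ x
  ÷1 = DM.n/1≡n

  ÷-big : ∀ {x k} → x ℕ.< k → x ÷ k ≡ 0
  ÷-big {x} {suc k} p = DM.m<n⇒m/n≡0 p

  hyp : ∀ y (G : ℕ → ℕ → ℤ) → S y (λ k → S (y ÷ k) (G k)) ≡ S y (λ k → S y (λ n → ι (k ℕ.* n ℕ.≤? y) * G k n))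
  hyp y G = S-cong y λ k 1≤k _ → trans (sym (S-trunc (G k) (÷≤ y k))) (S-ext y λ n → cong (_* G k n) (ι-cong (n ℕ.≤? y ÷ k) (k ℕ.* n ℕ.≤? y) (÷→ 1≤k) (÷← 1≤k)))

  -- Both sides run over the pairs with k n ≤ y, a condition symmetric in k and n.
  hyp-swap : ∀ y (G : ℕ → ℕ → ℤ) → S y (λ k → S (y ÷ k) (λ n → G k n)) ≡ S y (λ n → S (y ÷ n) (λ k → G k n))
  hyp-swap y G = trans (hyp y G) (trans (S-swap y y _) (trans (S-ext y λ n → S-ext y λ k → cong (_* G k n) (ι-cong (k ℕ.* n ℕ.≤? y) (n ℕ.* k ℕ.≤? y) (subst (ℕ._≤ y) (*-comm k n)) (subst (ℕ._≤ y) (*-comm n k)))) (sym (hyp y (λ n k → G k n)))))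

  -- Divisibility as a sum over the cofactor k, so that `dsum` can exchange the summations over n
  -- and k.
  dvd-δ : ∀ {x d n} z → 1 ℕ.≤ d → 1 ℕ.≤ n → n ℕ.≤ x → ι (d ∣? n) * z ≡ S x (λ k → ι (n ℕ.≟ d ℕ.* k) * z)
  dvd-δ {x} {d} {n} z 1≤d 1≤n n≤x with d ∣? n
  ... | no d∤n = trans (ℤP.*-zeroˡ z) (sym (S-zero x λ k _ _ → ι0* (n ℕ.≟ d ℕ.* k) z λ e → d∤n (divides k (trans e (*-comm d k)))))
  ... | yes (divides q e) = trans (ℤP.*-identityˡ z) (sym (trans (S-ext x λ k → cong (_* z) (ι-cong (n ℕ.≟ d ℕ.* k) (k ℕ.≟ q) (f k) (g k))) (S-δ x q (λ _ → z) 1≤q q≤x)))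
    where
    instance
      nzd : NonZero d
      nzd = ℕ.>-nonZero 1≤d
    f : ∀ k → n ≡ d ℕ.* k → k ≡ q
    f k e' = *-cancelˡ-≡ k q d (trans (sym e') (trans e (*-comm q d)))
    g : ∀ k → k ≡ q → n ≡ d ℕ.* k
    g k refl = trans e (*-comm q d)
    1≤q : 1 ℕ.≤ q
    1≤q = n≢0⇒n>0 λ { refl → <-irrefl (sym e) 1≤n }
    q≤x : q ℕ.≤ x
    q≤x = ≤-trans (≤-trans (m≤m*n q d) (≤-reflexive (sym e))) n≤x

  dsum : ∀ x d (g : ℕ → ℤ) → 1 ℕ.≤ d → S x (λ n → ι (d ∣? n) * g n) ≡ S (x ÷ d) (λ k → g (d ℕ.* k))
  dsum x d g 1≤d = begin
    S x (λ n → ι (d ∣? n) * g n)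
      ≡⟨ S-cong x (λ n a b → dvd-δ (g n) 1≤d a b) ⟩
    S x (λ n → S x (λ k → ι (n ℕ.≟ d ℕ.* k) * g n))
      ≡⟨ S-swap x x _ ⟩
    S x (λ k → S x (λ n → ι (n ℕ.≟ d ℕ.* k) * g n))
      ≡⟨ S-cong x step ⟩
    S x (λ k → ι (k ℕ.≤? x ÷ d) * g (d ℕ.* k))
      ≡⟨ S-trunc (λ k → g (d ℕ.* k)) (÷≤ x d) ⟩
    S (x ÷ d) (λ k → g (d ℕ.* k)) ∎
    where
    open ≡-Reasoning
    step : ∀ k → 1 ℕ.≤ k → k ℕ.≤ x → S x (λ n → ι (n ℕ.≟ d ℕ.* k) * g n) ≡ ι (k ℕ.≤? x ÷ d) * g (d ℕ.* k)
    step k 1≤k _ with k ℕ.≤? x ÷ d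
    ... | yes p = trans (S-δ x (d ℕ.* k) g (*-mono-≤ 1≤d 1≤k) (÷→ 1≤d p)) (sym (ℤP.*-identityˡ _))
    ... | no ¬p = trans (S-zero x λ n _ n≤x → ι0* (n ℕ.≟ d ℕ.* k) (g n) λ { refl → ¬p (÷← 1≤d n≤x) }) (sym (ℤP.*-zeroˡ (g (d ℕ.* k))))

  -- The von Mangoldt function and its summatory logarithm

  prime≥2 : ∀ {p} → Prime p → 2 ℕ.≤ p
  prime≥2 {p} pp = ℕ.nonTrivial⇒n>1 p {{prime⇒nonTrivial pp}}

  prime≥1 : ∀ {p} → Prime p → 1 ℕ.≤ p
  prime≥1 pp = ≤-trans (s≤s z≤n) (prime≥2 pp)

  prime∣prime : ∀ {p q} → Prime p → Prime q → q ∣ p → q ≡ p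
  prime∣prime pp qq d with prime⇒irreducible pp d
  ... | inj₂ e = e
  ... | inj₁ refl = ⊥-elim (<-irrefl refl (prime≥2 qq))

  product≥1 : ∀ {ps} → All Prime ps → 1 ℕ.≤ product ps
  product≥1 All.[] = ≤-refl
  product≥1 (px All.∷ pxs) = *-mono-≤ (prime≥1 px) (product≥1 pxs)

  prime-ind : (P : ℕ → Set) → P 1 → (∀ p m → Prime p → 1 ℕ.≤ m → P m → P (p ℕ.* m)) → ∀ n → 1 ℕ.≤ n → P n
  prime-ind P p1 step n 1≤n = subst P (sym (PrimeFactorisation.isFactorisation f)) (go (factors f) (PrimeFactorisation.factorsPrime f))
    where
    f = factorise n {{ℕ.>-nonZero 1≤n}}
    go : ∀ ps → All Prime ps → P (product ps)
    go [] All.[] = p1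
    go (p ∷ ps) (px All.∷ pxs) = step p (product ps) px (product≥1 pxs) (go ps pxs)

  pow≥1 : ∀ {q} j → 1 ℕ.≤ q → 1 ℕ.≤ q ℕ.^ j
  pow≥1 zero p = ≤-refl
  pow≥1 {q} (suc j) p = *-mono-≤ p (pow≥1 j p)

  n<pow : ∀ {q} n → 2 ℕ.≤ q → n ℕ.< q ℕ.^ n
  n<pow zero p = s≤s z≤n
  n<pow {q} (suc n) p = ≤-trans (+-mono-≤ (≤-trans (s≤s z≤n) (n<pow n p)) (n<pow n p))
    (≤-trans (≤-reflexive (cong (q ℕ.^ n ℕ.+_) (sym (+-identityʳ _)))) (*-monoˡ-≤ (q ℕ.^ n) p))

  pow-coprime : ∀ {p q} j m → Prime p → Prime q → q ≢ p → q ℕ.^ j ∣ p ℕ.* m → q ℕ.^ j ∣ m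
  pow-coprime zero m pp qq ne d = Dv.1∣ m
  pow-coprime {p} {q} (suc j) m pp qq ne d with euclidsLemma p m qq (∣-trans (m∣m*n (q ℕ.^ j)) d)
  ... | inj₁ q∣p = ⊥-elim (ne (prime∣prime pp qq q∣p))
  ... | inj₂ (divides m' refl) = subst (q ℕ.* q ℕ.^ j ∣_) (*-comm q m') (Dv.*-monoʳ-∣ q (pow-coprime j m' pp qq ne
          (Dv.*-cancelˡ-∣ q {{prime⇒nonZero qq}} (subst (q ℕ.* q ℕ.^ j ∣_) eq d))))
    where
    eq : p ℕ.* (m' ℕ.* q) ≡ q ℕ.* (p ℕ.* m')
    eq = trans (sym (*-assoc p m' q)) (*-comm _ q)

  S-shift : ∀ N (h : ℕ → ℤ) → S N (λ j → h (j ℕ.∸ 1)) ≡ h 0 + S N h - h N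
  S-shift zero h = lem (h 0)
    where
    lem : ∀ a → + 0 ≡ a + + 0 - a
    lem = solve-∀
  S-shift (suc N) h = trans (cong (_+ h N) (S-shift N h)) (lem (h 0) (S N h) (h N) (h (suc N)))
    where
    lem : ∀ a b c d → a + b - c + c ≡ a + (b + d) - d
    lem = solve-∀

  approx-lo : ∀ lm Lm Lp Lpm → lm ≤ Lm → Lp + Lm ≤ Lpm → lm + Lp ≤ Lpm
  approx-lo lm Lm Lp Lpm x y = by (nn x ⊕ nn y) (solve (lm ∷ Lm ∷ Lp ∷ Lpm ∷ []))

  approx-hi : ∀ δ lm Lm Lp Lpm m pm → + 0 ≤ δ → Lm ≤ lm + m * δ → Lpm ≤ Lp + Lm + δ → m + + 1 ≤ pm → Lpm ≤ lm + Lp + pm * δ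
  approx-hi δ lm Lm Lp Lpm m pm δ≥0 x y z = by (nn x ⊕ nn y ⊕ nn z ⊗ δ≥0) (solve (lm ∷ Lm ∷ Lp ∷ Lpm ∷ m ∷ pm ∷ δ ∷ []))

  module VonMangoldt (X : ℕ) (L : ℕ → ℤ) where

    pr : ℕ → ℤ
    pr q = ι (prime? q) * L q

    -- Summing over all pairs (q, j) with j ≥ 1 avoids a test for prime powers and lets summations
    -- be exchanged. Exponents up to X suffice because q^X > X.
    Λ : ℕ → ℤ
    Λ n = S X (λ q → S X (λ j → pr q * ι (n ℕ.≟ q ℕ.^ j)))

    -- The additive function that agrees with `L` at the primes up to X; by unique factorisation it
    -- is exactly additive even if `L` is so only approximately.
    ℓ : ℕ → ℤ
    ℓ n = S X (λ d → ι (d ∣? n) * Λ d)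

    -- The q-adic valuation, for q prime and 1 ≤ n ≤ X.
    V : ℕ → ℕ → ℤ
    V q n = S X (λ j → ι (q ℕ.^ j ∣? n))

    -- The hypothesis on g accounts for the pairs with q^j > X, which occur on the right but match
    -- no n ≤ X.
    Λ-sum : ∀ (g : ℕ → ℤ) → (∀ q j → 1 ℕ.≤ q → X ℕ.< q ℕ.^ j → g (q ℕ.^ j) ≡ + 0) →
      S X (λ n → g n * Λ n) ≡ S X (λ q → S X (λ j → pr q * g (q ℕ.^ j)))
    Λ-sum g g0 = begin
      S X (λ n → g n * Λ n)
        ≡⟨ S-ext X (λ n → trans (sym (S-* X (g n) _)) (S-ext X λ q → sym (S-* X (g n) _))) ⟩
      S X (λ n → S X (λ q → S X (λ j → g n * (pr q * ι (n ℕ.≟ q ℕ.^ j)))))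
        ≡⟨ S-swap X X _ ⟩
      S X (λ q → S X (λ n → S X (λ j → g n * (pr q * ι (n ℕ.≟ q ℕ.^ j)))))
        ≡⟨ S-ext X (λ q → S-swap X X _) ⟩
      S X (λ q → S X (λ j → S X (λ n → g n * (pr q * ι (n ℕ.≟ q ℕ.^ j)))))
        ≡⟨ S-cong X (λ q 1≤q _ → S-ext X λ j → trans (S-ext X λ n → lem (g n) (pr q) _) (trans (S-* X (pr q) _) (cong (pr q *_) (inner q j 1≤q)))) ⟩
      S X (λ q → S X (λ j → pr q * g (q ℕ.^ j))) ∎
      where
      open ≡-Reasoning
      lem : ∀ a b c → a * (b * c) ≡ b * (c * a)
      lem = solve-∀
      inner : ∀ q j → 1 ℕ.≤ q → S X (λ n → ι (n ℕ.≟ q ℕ.^ j) * g n) ≡ g (q ℕ.^ j)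
      inner q j 1≤q with q ℕ.^ j ℕ.≤? X
      ... | yes p = S-δ X (q ℕ.^ j) g (pow≥1 j 1≤q) p
      ... | no ¬p = trans (S-zero X λ n _ n≤X → ι0* (n ℕ.≟ q ℕ.^ j) (g n) λ { refl → ¬p n≤X }) (sym (g0 q j 1≤q (≰⇒> ¬p)))

    ℓ≡ : ∀ n → 1 ℕ.≤ n → n ℕ.≤ X → ℓ n ≡ S X (λ q → pr q * V q n)
    ℓ≡ n 1≤n n≤X = trans (Λ-sum (λ d → ι (d ∣? n)) λ q j _ X< → ι-no (q ℕ.^ j ∣? n) λ d → <⇒≱ X< (≤-trans (Dv.∣⇒≤ {{ℕ.>-nonZero 1≤n}} d) n≤X))
      (S-ext X λ q → S-* X (pr q) _)

    V-≢ : ∀ p q m → Prime p → Prime q → q ≢ p → V q (p ℕ.* m) ≡ V q m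
    V-≢ p q m pp qq ne = S-ext X λ j → ι-cong (q ℕ.^ j ∣? p ℕ.* m) (q ℕ.^ j ∣? m) (pow-coprime j m pp qq ne) (Dv.∣n⇒∣m*n p)

    -- Cancelling p lowers each exponent by one: j = 0 enters and contributes 1, while j = X drops
    -- out with value 0, since p^X > X ≥ m.
    V-≡ : ∀ p m → Prime p → 1 ℕ.≤ m → m ℕ.≤ X → V p (p ℕ.* m) ≡ V p m + + 1
    V-≡ p m pp 1≤m m≤X = begin
      V p (p ℕ.* m)
        ≡⟨ S-cong X (λ { (suc j) _ _ → ι-cong (p ℕ.^ suc j ∣? p ℕ.* m) (p ℕ.^ j ∣? m) (Dv.*-cancelˡ-∣ p {{prime⇒nonZero pp}}) (Dv.*-monoʳ-∣ p) }) ⟩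
      S X (λ j → ι (p ℕ.^ (j ℕ.∸ 1) ∣? m))
        ≡⟨ S-shift X (λ j → ι (p ℕ.^ j ∣? m)) ⟩
      ι (1 ∣? m) + V p m - ι (p ℕ.^ X ∣? m)
        ≡⟨ cong₂ (λ a b → a + V p m - b) (ι-yes (1 ∣? m) (Dv.1∣ m)) (ι-no (p ℕ.^ X ∣? m) λ d → <⇒≱ (n<pow X (prime≥2 pp)) (≤-trans (Dv.∣⇒≤ {{ℕ.>-nonZero 1≤m}} d) m≤X)) ⟩
      + 1 + V p m - + 0
        ≡⟨ lem (V p m) ⟩
      V p m + + 1 ∎
      where
      open ≡-Reasoning
      lem : ∀ a → + 1 + a - + 0 ≡ a + + 1
      lem = solve-∀

    pr-prime : ∀ {p} → Prime p → pr p ≡ L p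
    pr-prime {p} pp = ι1* (prime? p) (L p) pp

    ℓ-prime* : ∀ p m → Prime p → 1 ℕ.≤ m → p ℕ.* m ℕ.≤ X → ℓ (p ℕ.* m) ≡ ℓ m + L p
    ℓ-prime* p m pp 1≤m pm≤X = begin
      ℓ (p ℕ.* m)
        ≡⟨ ℓ≡ (p ℕ.* m) (*-mono-≤ (prime≥1 pp) 1≤m) pm≤X ⟩
      S X (λ q → pr q * V q (p ℕ.* m))
        ≡⟨ S-ext X step ⟩
      S X (λ q → pr q * V q m + ι (q ℕ.≟ p) * pr q)
        ≡⟨ S-+ X _ _ ⟩
      S X (λ q → pr q * V q m) + S X (λ q → ι (q ℕ.≟ p) * pr q)
        ≡⟨ cong₂ _+_ (sym (ℓ≡ m 1≤m m≤X)) (trans (S-δ X p pr (prime≥1 pp) p≤X) (pr-prime pp)) ⟩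
      ℓ m + L p ∎
      where
      open ≡-Reasoning
      m≤X : m ℕ.≤ X
      m≤X = ≤-trans (m≤n*m m p {{prime⇒nonZero pp}}) pm≤X
      p≤X : p ℕ.≤ X
      p≤X = ≤-trans (m≤m*n p m {{ℕ.>-nonZero 1≤m}}) pm≤X
      lem0 : ∀ a b c → + 0 * a * b ≡ + 0 * a * c + + 0 * (+ 0 * a)
      lem0 = solve-∀
      lem1 : ∀ a b → a * b ≡ a * b + + 0 * a
      lem1 = solve-∀
      lem2 : ∀ a b → a * (b + + 1) ≡ a * b + + 1 * a
      lem2 = solve-∀
      step : ∀ q → pr q * V q (p ℕ.* m) ≡ pr q * V q m + ι (q ℕ.≟ p) * pr q
      step q with q ℕ.≟ p
      ... | yes refl = trans (cong (pr q *_) (V-≡ q m pp 1≤m m≤X)) (lem2 (pr q) (V q m))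
      ... | no ne with prime? q
      ...   | yes qq = trans (cong (+ 1 * L q *_) (V-≢ p q m pp qq ne)) (lem1 (+ 1 * L q) (V q m))
      ...   | no _ = lem0 (L q) (V q (p ℕ.* m)) (V q m)

    ℓ-1 : 1 ℕ.≤ X → ℓ 1 ≡ + 0
    ℓ-1 1≤X = trans (ℓ≡ 1 ≤-refl 1≤X) (S-zero X λ q _ _ → z q)
      where
      z : ∀ q → pr q * V q 1 ≡ + 0
      z q with prime? q
      ... | no _ = ℤP.*-zeroˡ (V q 1)
      ... | yes qq = trans (cong (+ 1 * L q *_) (S-zero X λ { (suc j) _ _ → ι-no (q ℕ.^ suc j ∣? 1) λ d → <-irrefl refl (≤-trans (prime≥2 qq) (≤-reflexive (Dv.∣1⇒≡1 (∣-trans (m∣m*n (q ℕ.^ j)) d)))) })) (ℤP.*-zeroʳ (+ 1 * L q))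

    ℓ-* : ∀ a b → 1 ℕ.≤ a → 1 ℕ.≤ b → a ℕ.* b ℕ.≤ X → ℓ (a ℕ.* b) ≡ ℓ a + ℓ b
    ℓ-* a b 1≤a 1≤b = prime-ind (λ a → a ℕ.* b ℕ.≤ X → ℓ (a ℕ.* b) ≡ ℓ a + ℓ b) base step a 1≤a
      where
      base : 1 ℕ.* b ℕ.≤ X → ℓ (1 ℕ.* b) ≡ ℓ 1 + ℓ b
      base h = trans (cong ℓ (*-identityˡ b)) (sym (trans (cong (_+ ℓ b) (ℓ-1 (≤-trans 1≤b (subst (ℕ._≤ X) (*-identityˡ b) h)))) (ℤP.+-identityˡ _)))
      lem : ∀ a b c → a + b + c ≡ a + c + b
      lem = solve-∀
      step : ∀ p m → Prime p → 1 ℕ.≤ m → (m ℕ.* b ℕ.≤ X → ℓ (m ℕ.* b) ≡ ℓ m + ℓ b) → p ℕ.* m ℕ.* b ℕ.≤ X → ℓ (p ℕ.* m ℕ.* b) ≡ ℓ (p ℕ.* m) + ℓ b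
      step p m pp 1≤m ih h = trans (trans (cong ℓ (*-assoc p m b)) (ℓ-prime* p (m ℕ.* b) pp (*-mono-≤ 1≤m 1≤b) h')) (trans (cong (_+ L p) (ih (≤-trans (m≤n*m (m ℕ.* b) p {{prime⇒nonZero pp}}) h'))) (trans (lem (ℓ m) (ℓ b) (L p)) (cong (_+ ℓ b) (sym (ℓ-prime* p m pp 1≤m (≤-trans (m≤m*n (p ℕ.* m) b {{ℕ.>-nonZero 1≤b}}) h))))))
        where
        h' : p ℕ.* (m ℕ.* b) ℕ.≤ X
        h' = subst (ℕ._≤ X) (*-assoc p m b) h

    -- Each prime factor costs at most δ, and n bounds their number. This crude count is affordable
    -- because δ will be M/X².
    ℓ-approx : ∀ δ → + 0 ≤ δ → L 1 ≡ + 0 → (∀ a b → 1 ℕ.≤ a → 1 ℕ.≤ b → a ℕ.* b ℕ.≤ X → (L a + L b ≤ L (a ℕ.* b)) × (L (a ℕ.* b) ≤ L a + L b + δ)) →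
      ∀ n → 1 ℕ.≤ n → n ℕ.≤ X → (ℓ n ≤ L n) × (L n ≤ ℓ n + + n * δ)
    ℓ-approx δ δ≥0 L1 hL = prime-ind (λ n → n ℕ.≤ X → (ℓ n ≤ L n) × (L n ≤ ℓ n + + n * δ)) base step
      where
      base : 1 ℕ.≤ X → (ℓ 1 ≤ L 1) × (L 1 ≤ ℓ 1 + + 1 * δ)
      base h = subst₂ (λ a b → (a ≤ b) × (b ≤ a + + 1 * δ)) (sym (ℓ-1 h)) (sym L1) (ℤP.≤-refl , (pos 0 ⊕ pos 1 ⊗ δ≥0))
      step : ∀ p m → Prime p → 1 ℕ.≤ m → (m ℕ.≤ X → (ℓ m ≤ L m) × (L m ≤ ℓ m + + m * δ)) → p ℕ.* m ℕ.≤ X → (ℓ (p ℕ.* m) ≤ L (p ℕ.* m)) × (L (p ℕ.* m) ≤ ℓ (p ℕ.* m) + + (p ℕ.* m) * δ)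
      step p m pp 1≤m ih h = subst (λ z → (z ≤ L (p ℕ.* m)) × (L (p ℕ.* m) ≤ z + + (p ℕ.* m) * δ)) (sym (ℓ-prime* p m pp 1≤m h))
          ( approx-lo (ℓ m) (L m) (L p) (L (p ℕ.* m)) (proj₁ ihm) (proj₁ hLpm)
          , approx-hi δ (ℓ m) (L m) (L p) (L (p ℕ.* m)) (+ m) (+ (p ℕ.* m)) δ≥0 (proj₂ ihm) (proj₂ hLpm) (subst (_≤ + (p ℕ.* m)) (+-ab m 1) (toℤ m+1≤)))
        where
        ihm = ih (≤-trans (m≤n*m m p {{prime⇒nonZero pp}}) h)
        hLpm = hL p m (prime≥1 pp) 1≤m h
        m+1≤ : m ℕ.+ 1 ℕ.≤ p ℕ.* m
        m+1≤ = ≤-trans (+-monoʳ-≤ m 1≤m) (≤-trans (≤-reflexive (cong (m ℕ.+_) (sym (+-identityʳ m)))) (*-monoˡ-≤ m (prime≥2 pp)))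

    pr≥0 : (∀ q → 1 ℕ.≤ q → q ℕ.≤ X → + 0 ≤ L q) → ∀ q → 1 ℕ.≤ q → q ℕ.≤ X → + 0 ≤ pr q
    pr≥0 h q a b = ι-nonneg (prime? q) ⊗ h q a b

    Λ≥0 : (∀ q → 1 ℕ.≤ q → q ℕ.≤ X → + 0 ≤ L q) → ∀ n → + 0 ≤ Λ n
    Λ≥0 h n = S-nonneg X λ q a b → S-nonneg X λ j _ _ → pr≥0 h q a b ⊗ ι-nonneg (n ℕ.≟ q ℕ.^ j)

  module PrimePowers (X : ℕ) (L : ℕ → ℤ) (L≥0 : ∀ q → 1 ℕ.≤ q → q ℕ.≤ X → + 0 ≤ L q) where
    open VonMangoldt X L

    ℓ-pow : ∀ q j → Prime q → q ℕ.^ j ℕ.≤ X → ℓ (q ℕ.^ j) ≡ + j * L q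
    ℓ-pow q zero qq h = trans (ℓ-1 h) (sym (ℤP.*-zeroˡ (L q)))
    ℓ-pow q (suc j) qq h = trans (ℓ-prime* q (q ℕ.^ j) qq (pow≥1 j (prime≥1 qq)) h)
      (trans (cong (_+ L q) (ℓ-pow q j qq (≤-trans (m≤n*m _ q {{prime⇒nonZero qq}}) h))) (trans (lem (+ j) (L q)) (cong (_* L q) (sym (+-ab 1 j)))))
      where
      lem : ∀ a b → a * b + b ≡ (+ 1 + a) * b
      lem = solve-∀

    pow-mono : ∀ {q} i j → 1 ℕ.≤ q → i ℕ.≤ j → q ℕ.^ i ℕ.≤ q ℕ.^ j
    pow-mono {q} i j p h = ^-monoʳ-≤ q {{ℕ.>-nonZero p}} h

    -- Up to vanishing terms the sum is j L q = ℓ (q^j), where q^j is the largest power in range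
    -- that is at most b.
    prime-power-column : ∀ q b B → Prime q → b ℕ.≤ X → + 0 ≤ B → (∀ n → 1 ℕ.≤ n → n ℕ.≤ b → ℓ n ≤ B) →
      ∀ J → S J (λ j → L q * ι (q ℕ.^ j ℕ.≤? b)) ≤ B
    prime-power-column q b B qq b≤X B≥0 hB zero = B≥0
    prime-power-column q b B qq b≤X B≥0 hB (suc J) with q ℕ.^ suc J ℕ.≤? b
    ... | no _ = subst (_≤ B) (sym (trans (cong (_+_ (S J _)) (ℤP.*-zeroʳ (L q))) (ℤP.+-identityʳ _))) (prime-power-column q b B qq b≤X B≥0 hB J)
    ... | yes p = subst (_≤ B) (sym eq) (hB (q ℕ.^ suc J) (pow≥1 (suc J) (prime≥1 qq)) p)
      where
      eq : S J (λ j → L q * ι (q ℕ.^ j ℕ.≤? b)) + L q * + 1 ≡ ℓ (q ℕ.^ suc J)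
      eq = trans (cong₂ _+_ (S-cong J λ j _ j≤ → cong (L q *_) (ι-yes (q ℕ.^ j ℕ.≤? b) (≤-trans (pow-mono j (suc J) (prime≥1 qq) (m≤n⇒m≤1+n j≤)) p))) refl)
        (trans (S-const (suc J) (L q * + 1)) (trans (cong (+ suc J *_) (ℤP.*-identityʳ (L q))) (sym (ℓ-pow q (suc J) qq (≤-trans p b≤X)))))

    -- Without primes in (a, b] only exponents of at least 2 contribute. Their bases are at most √b,
    -- and each base contributes at most B by `prime-power-column`.
    prime-powers-sparse : ∀ a b s B → a ℕ.≤ b → b ℕ.≤ X → b ℕ.< suc s ℕ.* suc s → s ℕ.≤ X → + 0 ≤ B → (∀ n → 1 ℕ.≤ n → n ℕ.≤ b → ℓ n ≤ B) →
      (∀ n → a ℕ.< n → n ℕ.≤ b → ¬ Prime n) → S b Λ - S a Λ ≤ + s * B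
    prime-powers-sparse a b s B a≤b b≤X b<ss s≤X B≥0 hB np = subst₂ _≤_ (sym lhs) (trans (S-trunc (λ _ → B) s≤X) (S-const s B)) (S-mono X col)
      where
      w : ℕ → ℤ
      w n = ι (n ℕ.≤? b) - ι (n ℕ.≤? a)
      dist : ∀ x y z → x * z - y * z ≡ (x - y) * z
      dist = solve-∀
      lhs : S b Λ - S a Λ ≡ S X (λ q → S X (λ j → pr q * w (q ℕ.^ j)))
      lhs = trans (cong₂ _-_ (sym (S-trunc Λ b≤X)) (sym (S-trunc Λ (≤-trans a≤b b≤X)))) (trans (sym (S-- X _ _)) (trans (S-ext X λ n → dist (ι (n ℕ.≤? b)) (ι (n ℕ.≤? a)) (Λ n)) (Λ-sum w λ q j _ X< → cong₂ _-_ (ι-no (q ℕ.^ j ℕ.≤? b) λ h → <⇒≱ X< (≤-trans h b≤X)) (ι-no (q ℕ.^ j ℕ.≤? a) λ h → <⇒≱ X< (≤-trans h (≤-trans a≤b b≤X))))))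
      w≤ : ∀ n → w n ≤ ι (n ℕ.≤? b)
      w≤ n = by (ι-nonneg (n ℕ.≤? a)) (cc (ι (n ℕ.≤? b)) (ι (n ℕ.≤? a)))
        where
        cc : ∀ x y → x - (x - y) ≡ y
        cc = solve-∀
      w0 : ∀ n → Prime n → w n ≤ + 0
      w0 n pn with n ℕ.≤? b | n ℕ.≤? a
      ... | no _ | yes _ = ℤ.-≤+
      ... | no _ | no _ = ℤP.≤-refl
      ... | yes _ | yes _ = ℤP.≤-refl
      ... | yes p | no ¬p = ⊥-elim (np n (≰⇒> ¬p) p pn)
      col : ∀ q → 1 ℕ.≤ q → q ℕ.≤ X → S X (λ j → pr q * w (q ℕ.^ j)) ≤ ι (q ℕ.≤? s) * B
      col q 1≤q q≤X with prime? q
      ... | no _ = subst (_≤ ι (q ℕ.≤? s) * B) (sym (S-zero X λ j _ _ → zz (L q) (w (q ℕ.^ j)))) (ι-nonneg (q ℕ.≤? s) ⊗ B≥0)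
        where
        zz : ∀ x y → + 0 * x * y ≡ + 0
        zz = solve-∀
      ... | yes qq with q ℕ.≤? s
      ...   | yes _ = ℤP.≤-trans (S-mono X λ j _ _ → subst (_≤ L q * ι (q ℕ.^ j ℕ.≤? b)) (cong (_* w (q ℕ.^ j)) (sym (ℤP.*-identityˡ (L q)))) (ℤP.*-monoˡ-≤-nonNeg (L q) {{ℤ.nonNegative (L≥0 q 1≤q q≤X)}} (w≤ (q ℕ.^ j)))) (subst (S X (λ j → L q * ι (q ℕ.^ j ℕ.≤? b)) ≤_) (sym (ℤP.*-identityˡ B)) (prime-power-column q b B qq b≤X B≥0 hB X))
      ...   | no q≰s = subst₂ _≤_ refl (trans (S-0 X) (sym (ℤP.*-zeroˡ B))) (S-mono X neg)
        where
        w0' : ∀ j → 1 ℕ.≤ j → w (q ℕ.^ j) ≤ + 0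
        w0' 1 _ = w0 (q ℕ.^ 1) (subst Prime (sym (*-identityʳ q)) qq)
        w0' (suc (suc j)) _ = ℤP.≤-trans (w≤ (q ℕ.^ suc (suc j))) (ℤP.≤-reflexive (ι-no (q ℕ.^ suc (suc j) ℕ.≤? b) λ h → <⇒≱ b<ss (≤-trans (*-mono-≤ (≰⇒> q≰s) (≰⇒> q≰s)) (≤-trans (*-monoʳ-≤ q (≤-trans (≤-reflexive (sym (*-identityʳ q))) (*-monoʳ-≤ q (pow≥1 j 1≤q)))) h))))
        neg : ∀ j → 1 ℕ.≤ j → j ℕ.≤ X → + 1 * L q * w (q ℕ.^ j) ≤ + 0
        neg j 1≤j _ = subst₂ _≤_ (cong (_* w (q ℕ.^ j)) (sym (ℤP.*-identityˡ (L q)))) (ℤP.*-zeroʳ (L q)) (ℤP.*-monoˡ-≤-nonNeg (L q) {{ℤ.nonNegative (L≥0 q 1≤q q≤X)}} (w0' j 1≤j))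

  -- A logarithm for the integers up to X, in units of 1/M: rc k stands for 1/k, g for Euler's constant
  -- and ℓ, the summatory function of Λ over divisors, for log.
  record LogSystem (X : ℕ) : Set where
    field
      M : ℤ
      0<M : + 0 < M
      rc : ℕ → ℤ
      rc-spec : ∀ k → 1 ℕ.≤ k → k ℕ.≤ X → + k * rc k ≡ M
      g : ℤ
      g≥0 : + 0 ≤ g
      g≤M : g ≤ M
      Λ : ℕ → ℤ
      Λ≥0 : ∀ n → + 0 ≤ Λ n

    H : ℕ → ℤ
    H n = S n rc

    ℓ : ℕ → ℤ
    ℓ n = S X (λ d → ι (d ∣? n) * Λ d)

    field
      ℓ-* : ∀ a b → 1 ℕ.≤ a → 1 ℕ.≤ b → a ℕ.* b ℕ.≤ X → ℓ (a ℕ.* b) ≡ ℓ a + ℓ b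
      ℓ-hi : ∀ n → 1 ℕ.≤ n → n ℕ.≤ X → ℓ n ≤ H n - g
      ℓ-lo : ∀ n → 1 ℕ.≤ n → n ℕ.≤ X → H n - g ≤ ℓ n + + 2 * rc n
      sparse : ∀ a b s B → a ℕ.≤ b → b ℕ.≤ X → b ℕ.< suc s ℕ.* suc s → s ℕ.≤ X → + 0 ≤ B → (∀ n → 1 ℕ.≤ n → n ℕ.≤ b → ℓ n ≤ B) →
        (∀ n → a ℕ.< n → n ℕ.≤ b → ¬ Prime n) → S b Λ - S a Λ ≤ + s * B

  -- A logarithm from differences of harmonic sums

  S-telescope : ∀ n (F : ℕ → ℤ) → S n (λ j → F j - F (j ℕ.∸ 1)) ≡ F n - F 0
  S-telescope zero F = sym (ℤP.+-inverseʳ (F 0))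
  S-telescope (suc n) F = trans (cong (_+ (F (suc n) - F n)) (S-telescope n F)) (lem (F n) (F 0) (F (suc n)))
    where
    lem : ∀ a b c → (a - b) + (c - a) ≡ c - b
    lem = solve-∀

  Sd-telescope : ∀ a b (F : ℕ → ℤ) → S b (λ j → F j - F (j ℕ.∸ 1)) - S a (λ j → F j - F (j ℕ.∸ 1)) ≡ F b - F a
  Sd-telescope a b F = trans (cong₂ _-_ (S-telescope b F) (S-telescope a F)) (lem (F a) (F b) (F 0))
    where
    lem : ∀ a b c → (b - c) - (a - c) ≡ b - a
    lem = solve-∀

  Sd-shift : ∀ a b (h : ℕ → ℤ) → S b (λ j → h (j ℕ.∸ 1)) - S a (λ j → h (j ℕ.∸ 1)) ≡ S b h - S a h + h a - h b
  Sd-shift a b h = trans (cong₂ _-_ (S-shift b h) (S-shift a h)) (lem (h 0) (S b h) (h b) (S a h) (h a))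
    where
    lem : ∀ z x p y q → (z + x - p) - (z + y - q) ≡ x - y + q - p
    lem = solve-∀

  ∣! : ∀ k n → 1 ℕ.≤ k → k ℕ.≤ n → k ∣ n ℕ.!
  ∣! (suc k) n _ h = ∣-trans (m∣m*n (k ℕ.!)) (Dv.m≤n⇒m!∣n! h)

  L-mul-upper : ∀ la lb lab r q hb hk → lb ≡ hb - hk → lab - la ≤ hb - hk + r - q → + 0 ≤ q → lab ≤ la + lb + r
  L-mul-upper la _ lab r q hb hk refl h q≥0 = by (nn h ⊕ q≥0) (solve (la ∷ lab ∷ r ∷ q ∷ hb ∷ hk ∷ []))

  module Construct (X : ℕ) (1≤X : 1 ℕ.≤ X) where

    -- `Z` is the largest argument `K` n of `H` with n ≤ X, and M = Z! makes M/k an integer for 1 ≤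
    -- k ≤ Z. The choice `K` = X² pushes the additivity defect M/K of `L` below M/n² for every n ≤
    -- X.
    K Z : ℕ
    K = X ℕ.* X
    Z = X ℕ.* K

    1≤K : 1 ℕ.≤ K
    1≤K = *-mono-≤ 1≤X 1≤X

    K≤Z : K ℕ.≤ Z
    K≤Z = m≤n*m K X {{ℕ.>-nonZero 1≤X}}

    X≤Z : X ℕ.≤ Z
    X≤Z = m≤m*n X K {{ℕ.>-nonZero 1≤K}}

    M : ℤ
    M = + (Z ℕ.!)

    rc : ℕ → ℤ
    rc k = + ((Z ℕ.!) ÷ k)

    H : ℕ → ℤ
    H n = S n rc

    rc≥0 : ∀ k → + 0 ≤ rc k
    rc≥0 k = pos _

    rc-spec : ∀ k → 1 ℕ.≤ k → k ℕ.≤ Z → + k * rc k ≡ M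
    rc-spec (suc k) p q = trans (sym (*-ab (suc k) _)) (cong +_ (trans (*-comm (suc k) _) (DM.m/n*n≡m (∣! (suc k) Z p q))))

    rc-anti : ∀ a b → 1 ℕ.≤ a → a ℕ.≤ b → rc b ≤ rc a
    rc-anti a b p q = toℤ (÷-monoʳ (Z ℕ.!) p q)

    rc-mul : ∀ a b → 1 ℕ.≤ a → 1 ℕ.≤ b → a ℕ.* b ℕ.≤ Z → + a * rc (a ℕ.* b) ≡ rc b
    rc-mul a (suc b) p q h = ℤP.*-cancelˡ-≡ (+ suc b) _ _ (trans (lem (+ a) (+ suc b) (rc (a ℕ.* suc b)))
      (trans (cong (_* rc (a ℕ.* suc b)) (sym (*-ab a (suc b)))) (trans (rc-spec (a ℕ.* suc b) (*-mono-≤ p q) h) (sym (rc-spec (suc b) q (≤-trans (m≤n*m (suc b) a {{ℕ.>-nonZero p}}) h))))))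
      where
      lem : ∀ a b r → b * (a * r) ≡ (a * b) * r
      lem = solve-∀

    block-width : ∀ m j → + (m ℕ.* suc j) - + (m ℕ.* j) ≡ + m
    block-width m j = trans (cong (_- + (m ℕ.* j)) (trans (cong +_ (*-suc m j)) (+-ab m (m ℕ.* j)))) (lem (+ m) (+ (m ℕ.* j)))
      where
      lem : ∀ a b → (a + b) - b ≡ a
      lem = solve-∀

    block-lo : ∀ m j → 1 ℕ.≤ m → m ℕ.* suc j ℕ.≤ Z → rc (suc j) ≤ H (m ℕ.* suc j) - H (m ℕ.* j)
    block-lo m j p h = subst (_≤ H (m ℕ.* suc j) - H (m ℕ.* j)) (trans (cong (_* rc (m ℕ.* suc j)) (block-width m j)) (rc-mul m (suc j) p (s≤s z≤n) h))
      (Sd-≥ (rc (m ℕ.* suc j)) (*-monoʳ-≤ m (n≤1+n j)) λ i a b → rc-anti i _ (≤-trans (s≤s z≤n) a) b)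

    block-hi : ∀ m j → 1 ℕ.≤ m → 1 ℕ.≤ j → m ℕ.* suc j ℕ.≤ Z → H (m ℕ.* suc j) - H (m ℕ.* j) ≤ rc j
    block-hi m j p q h = subst (H (m ℕ.* suc j) - H (m ℕ.* j) ≤_) (trans (cong (_* rc (m ℕ.* j)) (block-width m j)) (rc-mul m j p q (≤-trans m≤ h)))
      (Sd-≤ (rc (m ℕ.* j)) m≤ λ i a b → rc-anti _ i (*-mono-≤ p q) (<⇒≤ a))
      where
      m≤ = *-monoʳ-≤ m (n≤1+n j)

    -- A discrete form of the scale invariance of ∫ dt/t: (m a, m b] splits into blocks of m terms,
    -- and the block from m j to m (j + 1) sums to a value between M/(j + 1) and M/j.
    scale-lo : ∀ m a b → 1 ℕ.≤ m → a ℕ.≤ b → m ℕ.* b ℕ.≤ Z → H b - H a ≤ H (m ℕ.* b) - H (m ℕ.* a)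
    scale-lo m a b p a≤b h = subst (H b - H a ≤_) (Sd-telescope a b (λ j → H (m ℕ.* j)))
      (Sd-mono a≤b λ { (suc j) _ j≤b → block-lo m j p (≤-trans (*-monoʳ-≤ m j≤b) h) })

    scale-hi : ∀ m a b → 1 ℕ.≤ m → 1 ℕ.≤ a → a ℕ.≤ b → m ℕ.* b ℕ.≤ Z → H (m ℕ.* b) - H (m ℕ.* a) ≤ H b - H a + rc a - rc b
    scale-hi m a b p 1≤a a≤b h = subst₂ _≤_ (Sd-telescope a b (λ j → H (m ℕ.* j))) (Sd-shift a b rc)
      (Sd-mono a≤b λ { (suc j) a< j≤b → block-hi m j p (≤-trans 1≤a (≤-pred a<)) (≤-trans (*-monoʳ-≤ m j≤b) h) })

    -- The sum of M/i over (K, K n], about M log n. Starting at `K` instead of 1 makes the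
    -- additivity defect at most M/K.
    L : ℕ → ℤ
    L n = H (K ℕ.* n) - H (K ℕ.* 1)

    L-1 : L 1 ≡ + 0
    L-1 = ℤP.+-inverseʳ (H (K ℕ.* 1))

    L≥0 : ∀ q → 1 ℕ.≤ q → + 0 ≤ L q
    L≥0 q p = nn (S-mono-n (*-monoʳ-≤ K p) λ i _ _ → rc≥0 i)

    -- `L (a * b) - L a` is the sum of M/i over (K a, K a b], the a-fold dilation of the interval
    -- (K, K b] that defines `L b`.
    L-mul : ∀ a b → 1 ℕ.≤ a → 1 ℕ.≤ b → a ℕ.* b ℕ.≤ X → (L a + L b ≤ L (a ℕ.* b)) × (L (a ℕ.* b) ≤ L a + L b + rc K)
    L-mul a b p q h = approx-add (L a) (L b) (H (K ℕ.* (a ℕ.* b))) (H (K ℕ.* a)) (H (K ℕ.* 1)) eqL lo' , hi'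
      where
      h' : a ℕ.* (K ℕ.* b) ℕ.≤ Z
      h' = subst (ℕ._≤ Z) (swp a b) (*-monoˡ-≤ K h)
        where
        swp : ∀ a b → a ℕ.* b ℕ.* K ≡ a ℕ.* (K ℕ.* b)
        swp a b = trans (*-assoc a b K) (cong (a ℕ.*_) (*-comm b K))
      e1 : a ℕ.* (K ℕ.* b) ≡ K ℕ.* (a ℕ.* b)
      e1 = trans (sym (*-assoc a K b)) (trans (cong (ℕ._* b) (*-comm a K)) (*-assoc K a b))
      e2 : a ℕ.* (K ℕ.* 1) ≡ K ℕ.* a
      e2 = trans (cong (a ℕ.*_) (*-identityʳ K)) (*-comm a K)
      K≤ : K ℕ.* 1 ℕ.≤ K ℕ.* b
      K≤ = *-monoʳ-≤ K q
      lo' : L b ≤ H (K ℕ.* (a ℕ.* b)) - H (K ℕ.* a)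
      lo' = subst₂ (λ x y → L b ≤ H x - H y) e1 e2 (scale-lo a (K ℕ.* 1) (K ℕ.* b) p K≤ h')
      eqL : L a ≡ H (K ℕ.* a) - H (K ℕ.* 1)
      eqL = refl
      approx-add : ∀ la lb x y z → la ≡ y - z → lb ≤ x - y → la + lb ≤ x - z
      approx-add la lb x y z e r = subst (λ la → la + lb ≤ x - z) (sym e) (add-lo lb x y z r)
        where
        add-lo : ∀ lb x y z → lb ≤ x - y → (y - z) + lb ≤ x - z
        add-lo lb x y z r = by (nn r) (solve (lb ∷ x ∷ y ∷ z ∷ []))
      hi' : L (a ℕ.* b) ≤ L a + L b + rc K
      hi' = L-mul-upper (L a) (L b) (L (a ℕ.* b)) (rc K) (rc (K ℕ.* b)) (H (K ℕ.* b)) (H (K ℕ.* 1)) refl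
        (subst₂ _≤_ (trans (cong₂ (λ x y → H x - H y) e1 e2) (sym (can (H (K ℕ.* (a ℕ.* b))) (H (K ℕ.* a)) (H (K ℕ.* 1))))) (cong (λ z → H (K ℕ.* b) - H (K ℕ.* 1) + rc z - rc (K ℕ.* b)) (*-identityʳ K))
          (scale-hi a (K ℕ.* 1) (K ℕ.* b) p (*-mono-≤ 1≤K (s≤s z≤n)) K≤ h')) (rc≥0 (K ℕ.* b))
        where
        can : ∀ x y z → (x - z) - (y - z) ≡ x - y
        can = solve-∀

    open VonMangoldt X L using (ℓ; Λ; Λ≥0; ℓ-*; ℓ-approx)

    -- `H n - L n` does not increase with n, so its value at the end point X is a lower bound for it
    -- at all n ≤ X. It stands for Euler's constant.
    g : ℤ
    g = H X - L X

    L-hi : ∀ n → 1 ℕ.≤ n → n ℕ.≤ X → L n ≤ H n - g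
    L-hi n p q = rearr (H X) (H n) (H (K ℕ.* X)) (H (K ℕ.* n)) (H (K ℕ.* 1)) (scale-lo K n X 1≤K q (≤-reflexive (*-comm K X)))
      where
      rearr : ∀ hx hn kx kn k1 → hx - hn ≤ kx - kn → kn - k1 ≤ hn - (hx - (kx - k1))
      rearr hx hn kx kn k1 r = by (nn r) (solve (hx ∷ hn ∷ kx ∷ kn ∷ k1 ∷ []))

    L-lo : ∀ n → 1 ℕ.≤ n → n ℕ.≤ X → H n - g ≤ L n + rc n
    L-lo n p q = rearr (H X) (H n) (H (K ℕ.* X)) (H (K ℕ.* n)) (H (K ℕ.* 1)) (rc n) (rc X) (rc≥0 X) (scale-hi K n X 1≤K p q (≤-reflexive (*-comm K X)))
      where
      rearr : ∀ hx hn kx kn k1 rn rx → + 0 ≤ rx → kx - kn ≤ hx - hn + rn - rx → hn - (hx - (kx - k1)) ≤ kn - k1 + rn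
      rearr hx hn kx kn k1 rn rx a r = by (nn r ⊕ a) (solve (hx ∷ hn ∷ kx ∷ kn ∷ k1 ∷ rn ∷ rx ∷ []))

    H1 : H 1 ≡ M
    H1 = trans (ℤP.+-identityˡ _) (trans (sym (ℤP.*-identityˡ (rc 1))) (rc-spec 1 ≤-refl (≤-trans 1≤X X≤Z)))

    rc1 : rc 1 ≡ M
    rc1 = trans (sym (ℤP.*-identityˡ (rc 1))) (rc-spec 1 ≤-refl (≤-trans 1≤X X≤Z))

    g≤M : g ≤ M
    g≤M = fin H1 L-1 (L-hi 1 ≤-refl 1≤X)
      where
      fin : ∀ {h l} → h ≡ M → l ≡ + 0 → l ≤ h - g → g ≤ M
      fin refl refl r = ℤP.0≤i-j⇒j≤i r

    g≥0 : + 0 ≤ g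
    g≥0 = fin H1 L-1 rc1 (L-lo 1 ≤-refl 1≤X)
      where
      al : ∀ m g → m - g ≤ + 0 + m → + 0 ≤ g
      al m g r = by (nn r) (solve (m ∷ g ∷ []))
      fin : ∀ {h l r} → h ≡ M → l ≡ + 0 → r ≡ M → h - g ≤ l + r → + 0 ≤ g
      fin refl refl refl r = al M g r

    -- Turns the error n M/X² of `ℓ-approx` into M/n, one of the two `rc n` in `ℓ-lo`; the other
    -- comes from `L-lo`.
    square-rc : ∀ n → 1 ℕ.≤ n → n ℕ.≤ X → + n * rc K ≤ rc n
    square-rc n@(suc _) p q = cancel-≤ (+ n) (+<+ (s≤s z≤n)) (subst₂ _≤_ (trans (cong (_* rc K) (*-ab n n)) (ℤP.*-assoc (+ n) (+ n) (rc K))) (trans (rc-spec K 1≤K K≤Z) (sym (rc-spec n p (≤-trans q X≤Z)))) (ℤP.*-monoʳ-≤-nonNeg (rc K) (toℤ (*-mono-≤ q q))))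

    logSystem : LogSystem X
    logSystem = record
      { M = M ; 0<M = +<+ (n≢0⇒n>0 (ℕ.≢-nonZero⁻¹ (Z ℕ.!) {{Z !≢0}})) ; rc = rc
      ; rc-spec = λ k p q → rc-spec k p (≤-trans q X≤Z)
      ; g = g ; g≥0 = g≥0 ; g≤M = g≤M ; Λ = Λ ; Λ≥0 = Λ≥0 λ q a _ → L≥0 q a
      ; ℓ-* = ℓ-*
      ; ℓ-hi = λ n p q → ℤP.≤-trans (proj₁ (appr n p q)) (L-hi n p q)
      ; ℓ-lo = λ n p q → lo2 (L n) (ℓ n) (H n - g) (rc n) (+ n * rc K) (proj₂ (appr n p q)) (L-lo n p q) (square-rc n p q)
      ; sparse = PrimePowers.prime-powers-sparse X L λ q a _ → L≥0 q a
      }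
      where
      appr = ℓ-approx (rc K) (rc≥0 K) L-1 L-mul
      lo2 : ∀ L l h r k → L ≤ l + k → h ≤ L + r → k ≤ r → h ≤ l + + 2 * r
      lo2 L l h r k a b c = by (nn a ⊕ nn b ⊕ nn c) (solve (L ∷ l ∷ h ∷ r ∷ k ∷ []))

  -- Two-sided bounds, partial summation and the hyperbola method

  Abs : ℤ → ℤ → Set
  Abs a b = (- b ≤ a) × (a ≤ b)

  Abs-≤ : ∀ {a b c} → Abs a b → b ≤ c → Abs a c
  Abs-≤ (p , q) r = ℤP.≤-trans (ℤP.neg-mono-≤ r) p , ℤP.≤-trans q r

  -- After doubling, each difference is a sum of two products of nonnegative factors, which spares a
  -- case distinction on signs.
  Abs-* : ∀ {a b c d} → Abs a b → Abs c d → Abs (a * c) (b * d)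
  Abs-* {a} {b} {c} {d} (p , q) (r , s) =
      cancel-≤ (+ 2) (+<+ (s≤s z≤n)) (by (nn q ⊗ nn s ⊕ nn p ⊗ nn r) (lem₁ a b c d))
    , cancel-≤ (+ 2) (+<+ (s≤s z≤n)) (by (nn q ⊗ nn r ⊕ nn p ⊗ nn s) (lem₂ a b c d))
    where
    lem₁ : ∀ a b c d → + 2 * (a * c) - + 2 * (- (b * d)) ≡ (b - a) * (d - c) + (a - (- b)) * (c - (- d))
    lem₁ = solve-∀
    lem₂ : ∀ a b c d → + 2 * (b * d) - + 2 * (a * c) ≡ (b - a) * (c - (- d)) + (a - (- b)) * (d - c)
    lem₂ = solve-∀

  Abs-+ : ∀ {a b c d} → Abs a b → Abs c d → Abs (a + c) (b + d)
  Abs-+ {a} {b} {c} {d} (p , q) (r , s) = by (nn p ⊕ nn r) (lem a b c d) , ℤP.+-mono-≤ q s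
    where
    lem : ∀ a b c d → a + c - (- (b + d)) ≡ (a - (- b)) + (c - (- d))
    lem = solve-∀

  Abs-neg : ∀ {a b} → Abs a b → Abs (- a) b
  Abs-neg {a} {b} (p , q) = ℤP.neg-mono-≤ q , subst (- a ≤_) (ℤP.neg-involutive b) (ℤP.neg-mono-≤ p)

  Abs-- : ∀ {a b c d} → Abs a b → Abs c d → Abs (a - c) (b + d)
  Abs-- p q = Abs-+ p (Abs-neg q)

  Abs-S : ∀ n {f h : ℕ → ℤ} → (∀ i → 1 ℕ.≤ i → i ℕ.≤ n → Abs (f i) (h i)) → Abs (S n f) (S n h)
  Abs-S zero k = ℤP.≤-refl , ℤP.≤-refl
  Abs-S (suc n) k = Abs-+ (Abs-S n λ i p q → k i p (m≤n⇒m≤1+n q)) (k (suc n) (s≤s z≤n) ≤-refl)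

  Abs-nn : ∀ {a} → + 0 ≤ a → Abs a a
  Abs-nn p = ℤP.≤-trans (ℤP.neg-mono-≤ p) p , ℤP.≤-refl

  -- Partial summation. It will pair the slowly varying weight `wt` with `f`, whose partial sums are
  -- of order √y.
  abel : ∀ y (w f : ℕ → ℤ) → S (suc y) (λ n → w n * f n) ≡ w (suc y) * S (suc y) f - S y (λ n → (w (suc n) - w n) * S n f)
  abel zero w f = lem (w 1) (f 1)
    where
    lem : ∀ a b → + 0 + a * b ≡ a * (+ 0 + b) - + 0
    lem = solve-∀
  abel (suc y) w f = trans (cong (_+ w (suc (suc y)) * f (suc (suc y))) (abel y w f))
    (lem (w (suc y)) (w (suc (suc y))) (S (suc y) f) (f (suc (suc y))) (S y (λ n → (w (suc n) - w n) * S n f)))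
    where
    lem : ∀ a b s f r → a * s - r + b * f ≡ b * (s + f) - (r + (b - a) * s)
    lem = solve-∀

  isqrt : ∀ y → ∃[ s ] (s ℕ.* s ℕ.≤ y × y ℕ.< suc s ℕ.* suc s)
  isqrt zero = 0 , z≤n , s≤s z≤n
  isqrt (suc y) with isqrt y
  ... | s , p , q with suc s ℕ.* suc s ℕ.≤? suc y
  ...   | yes r = suc s , r , ≤-trans (s≤s q) (*-mono-< (n<1+n (suc s)) (n<1+n (suc s)))
  ...   | no r = s , m≤n⇒m≤1+n p , ≰⇒> r

  sqrt≥1 : ∀ y s → 1 ℕ.≤ y → y ℕ.< suc s ℕ.* suc s → 1 ℕ.≤ s
  sqrt≥1 y zero p q = ⊥-elim (<⇒≱ q p)
  sqrt≥1 y (suc s) p q = s≤s z≤n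

  S-1 : ∀ n → S n (λ _ → + 1) ≡ + n
  S-1 n = trans (S-const n (+ 1)) (ℤP.*-identityʳ (+ n))

  dirichlet-hyperbola : ∀ y s → s ℕ.* s ℕ.≤ y → y ℕ.< suc s ℕ.* suc s →
    S y (λ a → + (y ÷ a)) ≡ + 2 * S s (λ a → + (y ÷ a)) - + s * + s
  dirichlet-hyperbola y s lo hi = begin
    S y (λ a → + (y ÷ a))
      ≡⟨ count ⟩
    S y (λ a → S y (λ b → I a b))
      ≡⟨ S-cong y (λ a p _ → S-cong y λ b q _ → split a b p q) ⟩
    S y (λ a → S y (λ b → (A a * I a b + A b * I b a) - A a * A b))
      ≡⟨ S-ext y (λ a → trans (S-- y _ _) (cong (_- S y (λ b → A a * A b)) (S-+ y _ _))) ⟩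
    S y (λ a → (S y (λ b → A a * I a b) + S y (λ b → A b * I b a)) - S y (λ b → A a * A b))
      ≡⟨ trans (S-- y _ _) (cong (_- S y (λ a → S y (λ b → A a * A b))) (S-+ y _ _)) ⟩
    (S y (λ a → S y (λ b → A a * I a b)) + S y (λ a → S y (λ b → A b * I b a))) - S y (λ a → S y (λ b → A a * A b))
      ≡⟨ cong₂ _-_ (cong₂ _+_ part (trans (S-swap y y _) part)) prod ⟩
    (T + T) - + s * + s
      ≡⟨ lem T (+ s) ⟩
    + 2 * T - + s * + s ∎
    where
    open ≡-Reasoning
    I : ℕ → ℕ → ℤ
    I a b = ι (a ℕ.* b ℕ.≤? y)
    A : ℕ → ℤ
    A a = ι (a ℕ.≤? s)
    T = S s (λ a → + (y ÷ a))
    lem : ∀ t s → (t + t) - s * s ≡ + 2 * t - s * s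
    lem = solve-∀
    s≤y : s ℕ.≤ y
    s≤y = ≤-trans (sq s) lo
      where
      sq : ∀ s → s ℕ.≤ s ℕ.* s
      sq zero = z≤n
      sq (suc s) = m≤m*n (suc s) (suc s)
    count1 : ∀ a → 1 ℕ.≤ a → + (y ÷ a) ≡ S y (λ b → I a b)
    count1 a p = trans (sym (S-1 (y ÷ a))) (trans (sym (S-trunc (λ _ → + 1) (÷≤ y a))) (S-ext y λ b → trans (ℤP.*-identityʳ _) (ι-cong (b ℕ.≤? y ÷ a) (a ℕ.* b ℕ.≤? y) (÷→ p) (÷← p))))
    count : S y (λ a → + (y ÷ a)) ≡ S y (λ a → S y (λ b → I a b))
    count = S-cong y λ a p _ → count1 a p
    -- Inclusion-exclusion: a b ≤ y < (s + 1)² forces a ≤ s or b ≤ s, and both together give a b ≤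
    -- s² ≤ y.
    split : ∀ a b → 1 ℕ.≤ a → 1 ℕ.≤ b → I a b ≡ (A a * I a b + A b * I b a) - A a * A b
    split a b p q rewrite *-comm b a with a ℕ.≤? s | b ℕ.≤? s | a ℕ.* b ℕ.≤? y
    ... | yes _ | yes _ | yes _ = refl
    ... | yes u | yes v | no ¬w = ⊥-elim (¬w (≤-trans (*-mono-≤ u v) lo))
    ... | yes _ | no _ | yes _ = refl
    ... | yes _ | no _ | no _ = refl
    ... | no _ | yes _ | yes _ = refl
    ... | no _ | yes _ | no _ = refl
    ... | no u | no v | yes w = ⊥-elim (<⇒≱ hi (≤-trans (*-mono-≤ (≰⇒> u) (≰⇒> v)) w))
    ... | no _ | no _ | no _ = refl
    part : S y (λ a → S y (λ b → A a * I a b)) ≡ T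
    part = trans (S-cong y λ a p _ → trans (S-* y (A a) (I a)) (cong (A a *_) (sym (count1 a p)))) (S-trunc (λ a → + (y ÷ a)) s≤y)
    prod : S y (λ a → S y (λ b → A a * A b)) ≡ + s * + s
    prod = trans (S-ext y λ a → trans (S-* y (A a) A) (cong (A a *_) (trans (S-ext y λ b → sym (ℤP.*-identityʳ (A b))) (trans (S-trunc (λ _ → + 1) s≤y) (S-1 s))))) (trans (S-trunc (λ _ → + s) s≤y) (S-const s (+ s)))

  -- Constant for which t|E y| ≤ M²(y + C t) below.
  errA errC : ℕ → ℕ
  errA t = (320 ℕ.* t) ℕ.* (320 ℕ.* t) ℕ.+ 840 ℕ.* t
  errC t = errA t ℕ.* errA t

  -- With `δ-lo` this expresses log y ≈ 2 log s, s = ⌊√y⌋, through harmonic sums; the exact middle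
  -- step is ℓ (s²) = 2 ℓ s.
  δ-hi : ∀ Hy Hs Hss l g rs rss → Hy ≤ Hss + + 2 * rs → Hss ≤ + 2 * l + g + + 2 * rss → l + g ≤ Hs → rss ≤ rs → Hy - + 2 * Hs + g ≤ + 4 * rs
  δ-hi Hy Hs Hss l g rs rss a b c d = by (nn a ⊕ nn b ⊕ pos 2 ⊗ nn c ⊕ pos 2 ⊗ nn d) (solve (Hy ∷ Hs ∷ Hss ∷ l ∷ g ∷ rs ∷ rss ∷ []))

  δ-lo : ∀ Hy Hs Hss l g rs → Hss ≤ Hy → + 2 * l + g ≤ Hss → Hs ≤ l + g + + 2 * rs → - (+ 4 * rs) ≤ Hy - + 2 * Hs + g
  δ-lo Hy Hs Hss l g rs a b c = by (nn a ⊕ nn b ⊕ pos 2 ⊗ nn c) (solve (Hy ∷ Hs ∷ Hss ∷ l ∷ g ∷ rs ∷ []))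

  yrs : ∀ y s M rs → y ≤ s * s + + 2 * s → s * rs ≡ M → + 1 ≤ s → + 0 ≤ rs → y * rs ≤ + 3 * (s * M)
  yrs y s _ rs a refl b r = by (nn a ⊗ r ⊕ pos 2 ⊗ (nn b ⊗ (ℤP.≤-trans (pos 1) b ⊗ r))) (solve (y ∷ s ∷ rs ∷ []))

  Hy-hi : ∀ Hy Hs g rs M s → Hy - + 2 * Hs + g ≤ + 4 * rs → Hs ≤ s * M → rs ≤ M → + 0 ≤ g → + 0 ≤ M → + 1 ≤ s → Hy ≤ + 6 * (s * M)
  Hy-hi Hy Hs g rs M s a b c d e f = by (nn a ⊕ pos 2 ⊗ nn b ⊕ pos 4 ⊗ nn c ⊕ d ⊕ pos 4 ⊗ (nn f ⊗ e)) (solve (Hy ∷ Hs ∷ g ∷ rs ∷ M ∷ s ∷ []))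

  D-hi : ∀ y s M g Hy Hs Sl T1 rs → Sl ≤ ((+ 1 + y) * Hy - y * M) - y * g → y * Hs ≤ M * T1 + s * M → Hy - + 2 * Hs + g ≤ + 4 * rs → y * rs ≤ + 3 * (s * M) → Hy ≤ + 6 * (s * M) → s * s ≤ y → + 0 ≤ M → + 0 ≤ y →
    Sl - M * (+ 2 * T1 - s * s) + y * (+ 2 * g) ≤ + 20 * (s * M)
  D-hi y s M g Hy Hs Sl T1 rs a b c d e f m≥0 y≥0 = by (nn a ⊕ pos 2 ⊗ nn b ⊕ y≥0 ⊗ nn c ⊕ pos 4 ⊗ nn d ⊕ nn e ⊕ nn f ⊗ m≥0) (solve (y ∷ s ∷ M ∷ g ∷ Hy ∷ Hs ∷ Sl ∷ T1 ∷ rs ∷ []))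

  D-lo : ∀ y s M g Hy Hs Sl T1 rs → ((+ 1 + y) * Hy - y * M) - y * g ≤ Sl + + 2 * Hy → M * T1 ≤ y * Hs → - (+ 4 * rs) ≤ Hy - + 2 * Hs + g → y * rs ≤ + 3 * (s * M) → Hy ≤ + 6 * (s * M) → y ≤ s * s + + 2 * s → + 0 ≤ M → + 0 ≤ y →
    - (+ 20 * (s * M)) ≤ Sl - M * (+ 2 * T1 - s * s) + y * (+ 2 * g)
  D-lo y s M g Hy Hs Sl T1 rs a b c d e f m≥0 y≥0 = by (nn a ⊕ pos 2 ⊗ nn b ⊕ y≥0 ⊗ nn c ⊕ pos 4 ⊗ nn d ⊕ nn e ⊕ nn f ⊗ m≥0) (solve (y ∷ s ∷ M ∷ g ∷ Hy ∷ Hs ∷ Sl ∷ T1 ∷ rs ∷ []))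

  Δ-hi : ∀ h g r r' l l' → l' ≤ (h + r') - g → h - g ≤ l + + 2 * r → r' ≤ r → (l' - + 2 * g) - (l - + 2 * g) ≤ + 3 * r
  Δ-hi h g r r' l l' a b c = by (nn a ⊕ nn b ⊕ nn c) (solve (h ∷ g ∷ r ∷ r' ∷ l ∷ l' ∷ []))

  Δ-lo : ∀ h g r r' l l' → (h + r') - g ≤ l' + + 2 * r' → l ≤ h - g → r' ≤ r → + 0 ≤ r → - (+ 3 * r) ≤ (l' - + 2 * g) - (l - + 2 * g)
  Δ-lo h g r r' l l' a b c d = by (nn a ⊕ nn b ⊕ nn c ⊕ pos 2 ⊗ d) (solve (h ∷ g ∷ r ∷ r' ∷ l ∷ l' ∷ []))

  w-hi : ∀ h g M l → l ≤ h - g → + 0 ≤ g → + 0 ≤ M → l - + 2 * g ≤ h + + 5 * M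
  w-hi h g M l a b c = by (nn a ⊕ pos 3 ⊗ b ⊕ pos 5 ⊗ c) (solve (h ∷ g ∷ M ∷ l ∷ []))

  w-lo : ∀ h g M l r → h - g ≤ l + + 2 * r → r ≤ M → g ≤ M → + 0 ≤ h → - (h + + 5 * M) ≤ l - + 2 * g
  w-lo h g M l r a b c d = by (nn a ⊕ pos 2 ⊗ nn b ⊕ pos 3 ⊗ nn c ⊕ pos 2 ⊗ d) (solve (h ∷ g ∷ M ∷ l ∷ r ∷ []))

  quadratic≥0 : ∀ s a → + 0 ≤ a → + 0 ≤ s * s - s * a + + 2 * (a * a)
  quadratic≥0 s a a≥0 = cancel-≤ (+ 4) (+<+ (s≤s z≤n)) (by (square≥0 (+ 2 * s - a) ⊕ pos 7 ⊗ (a≥0 ⊗ a≥0)) (lem s a))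
    where
    lem : ∀ s a → + 4 * (s * s - s * a + + 2 * (a * a)) - + 4 * + 0 ≡ (+ 2 * s - a) * (+ 2 * s - a) + + 7 * (a * a)
    lem = solve-∀

  -- Since Hy ≤ 2 Hs + 4 M, twice the left side is at most 320 t s M Hs + 840 t s M². The slow
  -- growth of Hs bounds this by M² (s² + s A), and s A ≤ s² + 2 A² by `quadratic≥0`.
  E-arith : ∀ t r A s y M Hs Hy g rs → r ≡ + 320 * t → A ≡ r * r + + 840 * t → r * Hs ≤ M * (r * r + s) → Hy - + 2 * Hs + g ≤ + 4 * rs → rs ≤ M → + 0 ≤ g → s * s ≤ y → + 0 ≤ M → + 0 ≤ t → + 0 ≤ s → + 0 ≤ A →
    t * ((Hy + + 5 * M) * (+ 20 * (s * M)) + + 60 * (s * M) * Hy) ≤ M * M * (y + A * A)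
  E-arith t _ _ s y M Hs Hy g rs refl refl a b c d e m≥0 t≥0 s≥0 A≥0 = cancel-≤ (+ 2) (+<+ (s≤s z≤n))
    (by (m≥0 ⊗ s≥0 ⊗ nn a ⊕ pos 160 ⊗ (t≥0 ⊗ s≥0 ⊗ m≥0) ⊗ (nn b ⊕ pos 4 ⊗ nn c ⊕ d) ⊕ pos 2 ⊗ (m≥0 ⊗ m≥0 ⊗ nn e) ⊕ m≥0 ⊗ m≥0 ⊗ quadratic≥0 s A A≥0) (lem t s y M Hs Hy g rs))
    where
    A = (+ 320 * t) * (+ 320 * t) + + 840 * t
    lem : ∀ t s y M Hs Hy g rs →
      + 2 * (M * M * (y + ((+ 320 * t) * (+ 320 * t) + + 840 * t) * ((+ 320 * t) * (+ 320 * t) + + 840 * t))) - + 2 * (t * ((Hy + + 5 * M) * (+ 20 * (s * M)) + + 60 * (s * M) * Hy))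
      ≡ M * s * (M * ((+ 320 * t) * (+ 320 * t) + s) - + 320 * t * Hs) + + 160 * (t * s * M) * ((+ 4 * rs - (Hy - + 2 * Hs + g)) + + 4 * (M - rs) + g) + + 2 * (M * M * (y - s * s)) + M * M * (s * s - s * ((+ 320 * t) * (+ 320 * t) + + 840 * t) + + 2 * (((+ 320 * t) * (+ 320 * t) + + 840 * t) * ((+ 320 * t) * (+ 320 * t) + + 840 * t)))
    lem = solve-∀

  -- Inverting ∑ₖ R (x ÷ k) by sieving

  -- `Rough` and `Smooth` quantify over a bounded range so that `allUpTo?` decides them.
  Rough : ℕ → ℕ → Set
  Rough q k = ∀ {d} → d ℕ.< suc q → (2 ℕ.≤ d → ¬ (d ∣ k))

  rough? : ∀ q k → Dec (Rough q k)
  rough? q k = allUpTo? (λ d → (2 ℕ.≤? d) →-dec ¬? (d ∣? k)) (suc q)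

  Smooth : ℕ → ℕ → Set
  Smooth q k = ∀ {p} → p ℕ.< suc k → (Prime p → p ∣ k → p ℕ.≤ q)

  smooth? : ∀ q k → Dec (Smooth q k)
  smooth? q k = allUpTo? (λ p → prime? p →-dec ((p ∣? k) →-dec (p ℕ.≤? q))) (suc k)

  S-≥first : ∀ x {f : ℕ → ℤ} → 1 ℕ.≤ x → (∀ i → + 0 ≤ f i) → f 1 ≤ S x f
  S-≥first x {f} p h = subst (_≤ S x f) (ℤP.+-identityˡ (f 1)) (S-mono-n {1} {x} p λ i _ _ → h i)

  rough-* : ∀ q j → Prime (suc q) → Rough q j → Rough q (suc q ℕ.* j)
  rough-* q j pp r {d} d<P 2≤d d∣ = r d<P 2≤d (coprime-divisor (Cop.sym (prime⇒coprime pp {{ℕ.>-nonZero (≤-trans (s≤s z≤n) 2≤d)}} d<P)) d∣)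

  rough-suc-composite : ∀ q k → 1 ℕ.≤ q → ¬ Prime (suc q) → Rough q k → Rough (suc q) k
  rough-suc-composite q k 1≤q np r {d} d< 2≤d d∣k with d ℕ.≟ suc q
  ... | no ne = r (≤∧≢⇒< (≤-pred d<) ne) 2≤d d∣k
  ... | yes refl with ¬prime⇒composite {suc q} {{ℕ.n>1⇒nonTrivial (s≤s 1≤q)}} np
  ...   | Dv.hasNonTrivialDivisor {divisor = e} {{nt}} e<n e∣n = r e<n (ℕ.nonTrivial⇒n>1 e {{nt}}) (∣-trans e∣n d∣k)

  rough-suc→ : ∀ q k → Rough (suc q) k → Rough q k
  rough-suc→ q k r d< = r (m≤n⇒m≤1+n d<)

  ι-remove : ∀ {P Q D : Set} (a : Dec P) (b : Dec Q) (d : Dec D) → (P → Q) → (P → ¬ D) → (Q → ¬ D → P) →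
    ∀ z → ι a * z ≡ ι b * z - ι d * (ι b * z)
  ι-remove (yes p) _ (yes d) _ g _ z = ⊥-elim (g p d)
  ι-remove (yes p) (no ¬q) (no _) f _ _ z = ⊥-elim (¬q (f p))
  ι-remove (yes p) (yes _) (no _) _ _ _ z = lem z
    where
    lem : ∀ z → + 1 * z ≡ + 1 * z - + 0 * (+ 1 * z)
    lem = solve-∀
  ι-remove (no _) (yes _) (yes _) _ _ _ z = lem z
    where
    lem : ∀ z → + 0 * z ≡ + 1 * z - + 1 * (+ 1 * z)
    lem = solve-∀
  ι-remove (no ¬p) (yes q) (no ¬d) _ _ h z = ⊥-elim (¬p (h q ¬d))
  ι-remove (no _) (no _) d _ _ _ z = lem (ι d) z
    where
    lem : ∀ y z → + 0 * z ≡ + 0 * z - y * (+ 0 * z)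
    lem = solve-∀

  module Inversion (R : ℕ → ℤ) (B : ℕ → ℤ) (B≥0 : ∀ y → + 0 ≤ B y) (N : ℕ)
    (hE : ∀ y → 1 ℕ.≤ y → y ℕ.≤ N → Abs (S y (λ k → R (y ÷ k))) (B y)) where

    -- A sieve in place of Möbius inversion. At q = 1 all k are rough, and the whole sum is bounded
    -- by the term k = 1 of `Bq`. Passing a prime P subtracts the value at x ÷ P and adds its bound.
    -- At q = x the only rough k ≤ x is 1, which leaves R x.
    Rq Bq : ℕ → ℕ → ℤ
    Rq q x = S x (λ k → ι (rough? q k) * R (x ÷ k))
    Bq q x = S x (λ k → ι (smooth? q k) * B (x ÷ k))

    base : ∀ x → x ℕ.≤ N → Abs (Rq 1 x) (Bq 1 x)
    base zero _ = ℤP.≤-refl , ℤP.≤-refl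
    base x@(suc _) x≤N = subst (λ z → Abs z (Bq 1 x)) (S-ext x λ k → sym (ι1* (rough? 1 k) (R (x ÷ k)) λ d<2 2≤d → ⊥-elim (<⇒≱ d<2 2≤d)))
      (Abs-≤ {S x (λ k → R (x ÷ k))} (hE x (s≤s z≤n) x≤N) (subst (_≤ Bq 1 x) (trans (ι1* (smooth? 1 1) (B (x ÷ 1)) λ { (s≤s p≤1) _ _ → p≤1 }) (cong B (÷1 x)))
        (S-≥first x {λ k → ι (smooth? 1 k) * B (x ÷ k)} (s≤s z≤n) λ k → ι-nonneg (smooth? 1 k) ⊗ B≥0 (x ÷ k))))

    smooth-weaken : ∀ q k → Smooth q k → Smooth (suc q) k
    smooth-weaken q k s p< pp d = m≤n⇒m≤1+n (s p< pp d)

    Rq-prime : ∀ q x → Prime (suc q) → Rq (suc q) x ≡ Rq q x - Rq q (x ÷ suc q)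
    Rq-prime q x pp = begin
      S x (λ k → ι (rough? (suc q) k) * R (x ÷ k))
        ≡⟨ S-ext x (λ k → sieve k (R (x ÷ k))) ⟩
      S x (λ k → ι (rough? q k) * R (x ÷ k) - ι (suc q ∣? k) * (ι (rough? q k) * R (x ÷ k)))
        ≡⟨ S-- x _ _ ⟩
      Rq q x - S x (λ k → ι (suc q ∣? k) * (ι (rough? q k) * R (x ÷ k)))
        ≡⟨ cong (λ z → Rq q x - z) (dsum x (suc q) (λ k → ι (rough? q k) * R (x ÷ k)) (s≤s z≤n)) ⟩
      Rq q x - S (x ÷ suc q) (λ j → ι (rough? q (suc q ℕ.* j)) * R (x ÷ (suc q ℕ.* j)))
        ≡⟨ cong (λ z → Rq q x - z) (S-cong (x ÷ suc q) λ j 1≤j _ → cong₂ _*_ (ι-cong (rough? q (suc q ℕ.* j)) (rough? q j) (λ r d< 2≤d d∣ → r d< 2≤d (Dv.∣n⇒∣m*n (suc q) d∣)) (rough-* q j pp)) (cong R (sym (÷÷ x (s≤s z≤n) 1≤j)))) ⟩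
      Rq q x - Rq q (x ÷ suc q) ∎
      where
      open ≡-Reasoning
      sieve : ∀ k z → ι (rough? (suc q) k) * z ≡ ι (rough? q k) * z - ι (suc q ∣? k) * (ι (rough? q k) * z)
      sieve k = ι-remove (rough? (suc q) k) (rough? q k) (suc q ∣? k) (rough-suc→ q k) (λ r → r ≤-refl (prime≥2 pp)) r'
        where
        r' : Rough q k → ¬ (suc q ∣ k) → Rough (suc q) k
        r' r ¬d {d} d< 2≤d d∣k with d ℕ.≟ suc q
        ... | yes refl = ¬d d∣k
        ... | no ne = r (≤∧≢⇒< (≤-pred d<) ne) 2≤d d∣k

    -- A q-smooth k is not divisible by the prime q + 1, so the q-smooth k and the products (q + 1)
    -- j with j q-smooth are disjoint; all of them are (q + 1)-smooth.
    Bq-prime : ∀ q x → Prime (suc q) → Bq q x + Bq q (x ÷ suc q) ≤ Bq (suc q) x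
    Bq-prime q x pp = ℤP.≤-trans (ℤP.+-monoʳ-≤ (Bq q x) (ℤP.≤-trans (S-mono (x ÷ suc q) up) (ℤP.≤-reflexive (sym (dsum x (suc q) (λ k → ι (smooth? (suc q) k) * B (x ÷ k)) (s≤s z≤n))))))
      (ℤP.≤-trans (ℤP.≤-reflexive (sym (S-+ x _ _))) (S-mono x λ k 1≤k _ → pt k 1≤k (B (x ÷ k)) (B≥0 (x ÷ k))))
      where
      sm : ∀ j → 1 ℕ.≤ j → Smooth q j → Smooth (suc q) (suc q ℕ.* j)
      sm j 1≤j s {p} p< p-prime d with euclidsLemma (suc q) j p-prime d
      ... | inj₁ p∣P = Dv.∣⇒≤ p∣P
      ... | inj₂ p∣j = m≤n⇒m≤1+n (s (s≤s (Dv.∣⇒≤ {{ℕ.>-nonZero 1≤j}} p∣j)) p-prime p∣j)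
      up : ∀ j → 1 ℕ.≤ j → j ℕ.≤ x ÷ suc q → ι (smooth? q j) * B (x ÷ suc q ÷ j) ≤ ι (smooth? (suc q) (suc q ℕ.* j)) * B (x ÷ (suc q ℕ.* j))
      up j 1≤j _ rewrite ÷÷ x {suc q} {j} (s≤s z≤n) 1≤j = ℤP.*-monoʳ-≤-nonNeg (B (x ÷ (suc q ℕ.* j))) {{ℤ.nonNegative (B≥0 _)}} (ι-mono (smooth? q j) (smooth? (suc q) (suc q ℕ.* j)) (sm j 1≤j))
      e1 : ∀ b z → + 0 * b + + 1 * z ≡ z
      e1 = solve-∀
      e2 : ∀ y z → y + + 0 * z ≡ y
      e2 = solve-∀
      pt : ∀ k → 1 ℕ.≤ k → ∀ b → + 0 ≤ b → ι (smooth? q k) * b + ι (suc q ∣? k) * (ι (smooth? (suc q) k) * b) ≤ ι (smooth? (suc q) k) * b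
      pt k 1≤k b b≥0 with suc q ∣? k
      ... | yes d = ℤP.≤-reflexive (trans (cong (λ z → z * b + + 1 * (ι (smooth? (suc q) k) * b)) (ι-no (smooth? q k) λ s → <-irrefl refl (s (s≤s (Dv.∣⇒≤ {{ℕ.>-nonZero 1≤k}} d)) pp d))) (e1 b (ι (smooth? (suc q) k) * b)))
      ... | no _ = ℤP.≤-trans (ℤP.≤-reflexive (e2 (ι (smooth? q k) * b) (ι (smooth? (suc q) k) * b))) (ℤP.*-monoʳ-≤-nonNeg b {{ℤ.nonNegative b≥0}} (ι-mono (smooth? q k) (smooth? (suc q) k) (smooth-weaken q k)))

    step : ∀ q → 1 ℕ.≤ q → (∀ x → x ℕ.≤ N → Abs (Rq q x) (Bq q x)) → ∀ x → x ℕ.≤ N → Abs (Rq (suc q) x) (Bq (suc q) x)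
    step q 1≤q ih x x≤N with prime? (suc q)
    ... | yes pp = subst (λ z → Abs z (Bq (suc q) x)) (sym (Rq-prime q x pp)) (Abs-≤ {Rq q x - Rq q (x ÷ suc q)} (Abs-- {Rq q x} {Bq q x} {Rq q (x ÷ suc q)} (ih x x≤N) (ih (x ÷ suc q) (≤-trans (÷≤ x (suc q)) x≤N))) (Bq-prime q x pp))
    ... | no np = subst (λ z → Abs z (Bq (suc q) x)) (S-ext x λ k → cong (_* R (x ÷ k)) (ι-cong (rough? q k) (rough? (suc q) k) (rough-suc-composite q k 1≤q np) (rough-suc→ q k)))
        (Abs-≤ {Rq q x} (ih x x≤N) (S-mono x λ k _ _ → ℤP.*-monoʳ-≤-nonNeg (B (x ÷ k)) {{ℤ.nonNegative (B≥0 _)}} (ι-mono (smooth? q k) (smooth? (suc q) k) (smooth-weaken q k))))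

    all-q : ∀ q x → x ℕ.≤ N → Abs (Rq (suc q) x) (Bq (suc q) x)
    all-q zero = base
    all-q (suc q) = step (suc q) (s≤s z≤n) (all-q q)

    inversion : ∀ x → 1 ℕ.≤ x → x ℕ.≤ N → Abs (R x) (S x (λ k → B (x ÷ k)))
    inversion x@(suc x') p x≤N = subst (λ z → Abs z (S x (λ k → B (x ÷ k)))) eq
      (Abs-≤ {Rq x x} (all-q x' x x≤N) (S-mono x λ k _ _ → subst (ι (smooth? x k) * B (x ÷ k) ≤_) (ℤP.*-identityˡ (B (x ÷ k))) (ℤP.*-monoʳ-≤-nonNeg (B (x ÷ k)) {{ℤ.nonNegative (B≥0 _)}} (ι≤1 (smooth? x k)))))
      where
      eq : Rq x x ≡ R x
      eq = trans (S-cong x λ k 1≤k k≤x → cong (_* R (x ÷ k)) (ι-cong (rough? x k) (k ℕ.≟ 1) (f k 1≤k k≤x) (g k)))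
        (trans (S-δ x 1 (λ k → R (x ÷ k)) ≤-refl p) (cong R (÷1 x)))
        where
        f : ∀ k → 1 ℕ.≤ k → k ℕ.≤ x → Rough x k → k ≡ 1
        f 1 _ _ _ = refl
        f (suc (suc k)) _ k≤x r = ⊥-elim (r (s≤s k≤x) (s≤s (s≤s z≤n)) ∣-refl)
        g : ∀ k → k ≡ 1 → Rough x k
        g k refl d< 2≤d d∣1 = <⇒≱ 2≤d (Dv.∣⇒≤ d∣1)

  -- Constants and polynomial inequalities

  -- Constants: |t (S₂ x' − S₂ x − 2 M u H x)| ≤ 3 x M H x + selC t M² x, and the short interval bound holds once H x ≥ brunC t M.
  selC brunC : ℕ → ℕ
  selC t = 8 ℕ.* t ℕ.+ 2 ℕ.+ 3 ℕ.* errC t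
  brunC t = selC t ℕ.+ 6 ℕ.* t ℕ.+ 12

  S-shrink : ∀ {y X} (F : ℕ → ℤ) → y ℕ.≤ X → (∀ d → y ℕ.< d → F d ≡ + 0) → S X F ≡ S y F
  S-shrink {y} {X} F y≤X h = ℤP.i-j≡0⇒i≡j _ _ (trans (S-diff y≤X F) (S-zero (X ℕ.∸ y) λ i p _ → h (y ℕ.+ i) (m<m+n y p)))

  ÷-swap : ∀ y d j → 1 ℕ.≤ d → 1 ℕ.≤ j → y ÷ d ÷ j ≡ y ÷ j ÷ d
  ÷-swap y d j p q = trans (÷÷ y p q) (trans (cong (y ÷_) (*-comm d j)) (sym (÷÷ y q p)))

  sel-arith : ∀ t M x x' u Hx Hx' C k → Hx' ≤ Hx + M → x' ≤ + 2 * x → u ≤ x → k ≡ + 8 * t + + 2 + + 3 * C →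
    + 0 ≤ M → + 0 ≤ t → + 0 ≤ x' → + 0 ≤ Hx → + 0 ≤ C →
    (M * (x' * Hx') + M * M * C * x') + (M * (x * Hx) + M * M * C * x) + t * (+ 8 * (M * M * u)) ≤ + 3 * (x * (M * Hx)) + k * (M * M * x)
  sel-arith t M x x' u Hx Hx' C _ c d e refl m≥0 t≥0 x'≥0 h≥0 C≥0 =
    by (m≥0 ⊗ x'≥0 ⊗ nn c ⊕ (m≥0 ⊗ h≥0 ⊕ m≥0 ⊗ m≥0 ⊕ m≥0 ⊗ m≥0 ⊗ C≥0) ⊗ nn d ⊕ pos 8 ⊗ (t≥0 ⊗ m≥0 ⊗ m≥0) ⊗ nn e) (solve (t ∷ M ∷ x ∷ x' ∷ u ∷ Hx ∷ Hx' ∷ C ∷ []))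

  -- Of the term 4 x, a share of 3 x M H pays for Selberg's error. The remaining x M H must cover C
  -- M² x and the losses 12 M² x and 6 t M² u from replacing H by H - 3 M; hence the summand 6 t +
  -- 12.
  brun-arith : ∀ t M x u H C dψ dS → t * dS - t * (+ 2 * M * u * H) ≤ + 3 * (x * (M * H)) + C * (M * M * x) → dψ * (H - + 3 * M) ≤ dS →
    (C + + 6 * t + + 12) * M ≤ H → u ≤ x → + 0 ≤ C → + 0 < M → + 0 ≤ t → + 0 ≤ x → t * dψ ≤ M * (+ 2 * t * u + + 4 * x)
  brun-arith t M x u H C dψ dS a b c d C≥0 M>0 t≥0 x≥0 = cancel-≤ (H - + 3 * M) H> (by (nn a ⊕ t≥0 ⊗ nn b ⊕ x≥0 ⊗ m≥0 ⊗ nn c ⊕ pos 6 ⊗ (t≥0 ⊗ m≥0 ⊗ m≥0) ⊗ nn d) (lem t M x u H C dψ dS))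
    where
    m≥0 = ℤP.<⇒≤ M>0
    l1 : ∀ M H C t → (H - + 3 * M) - M ≡ (H - (C + + 6 * t + + 12) * M) + (C + + 6 * t + + 8) * M
    l1 = solve-∀
    H> : + 0 < H - + 3 * M
    H> = ℤP.<-≤-trans M>0 (by (nn c ⊕ (C≥0 ⊕ pos 6 ⊗ t≥0 ⊕ pos 8) ⊗ m≥0) (l1 M H C t))
    lem : ∀ t M x u H C dψ dS → (H - + 3 * M) * (M * (+ 2 * t * u + + 4 * x)) - (H - + 3 * M) * (t * dψ)
      ≡ (+ 3 * (x * (M * H)) + C * (M * M * x) - (t * dS - t * (+ 2 * M * u * H))) + t * (dS - dψ * (H - + 3 * M)) + x * M * (H - (C + + 6 * t + + 12) * M) + + 6 * (t * M * M) * (x - u)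
    lem = solve-∀

  -- Opaque: these numbers are too large to be evaluated.
  opaque
    threshold : ℕ → ℕ
    threshold t = 2 ℕ.^ (2 ℕ.* brunC t)

  opaque
    unfolding threshold

    threshold≥ : ∀ t → 2 ℕ.^ (2 ℕ.* brunC t) ℕ.≤ threshold t
    threshold≥ t = ≤-refl

    threshold≥1 : ∀ t → 1 ℕ.≤ threshold t
    threshold≥1 t = pow≥1 (2 ℕ.* brunC t) (s≤s z≤n)

  opaque
    -- The summand 2 `threshold 1` covers small y, where ℓ i ≤ i M is used. The 12 lets the halving
    -- step close: with a = ⌊y/2⌋ and z = y - a ≤ a + 1 it must dominate 2 a + 4 z ≤ 6 a + 4.
    cheb : ℕ
    cheb = 12 ℕ.+ 2 ℕ.* threshold 1

    cheb≥ : 12 ℕ.+ 2 ℕ.* threshold 1 ℕ.≤ cheb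
    cheb≥ = ≤-refl

  half-spec : ∀ y → (y ÷ 2 ℕ.+ y ÷ 2 ℕ.≤ y) × (y ℕ.≤ suc (y ÷ 2 ℕ.+ y ÷ 2))
  half-spec y = subst (ℕ._≤ y) eq (÷→ {y} {2} (s≤s z≤n) ≤-refl) , ≤-pred (subst (y ℕ.<_) eq' (÷< {y} {2} (s≤s z≤n)))
    where
    l1 : ∀ a → 2 ℕ.* a ≡ a ℕ.+ a
    l1 = solveℕ
    l2 : ∀ a → 2 ℕ.* suc a ≡ suc (suc (a ℕ.+ a))
    l2 = solveℕ
    eq = l1 (y ÷ 2)
    eq' = l2 (y ÷ 2)

  cheb-arith : ∀ A M y z a → y ≡ z + a → y ≤ + 1 + (a + a) → + 1 ≤ a → + 12 ≤ A → + 0 ≤ M →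
    A * M * z + M * (+ 2 * + 1 * (y - z) + + 4 * z) ≤ A * M * y
  cheb-arith A M _ z a refl b c d m = by (m ⊗ (nn d ⊗ (ℤP.≤-trans (pos 1) c) ⊕ pos 4 ⊗ nn b ⊕ pos 6 ⊗ nn c ⊕ pos 2)) (solve (A ∷ M ∷ z ∷ a ∷ []))

  ÷ℤ : ∀ x d → 1 ℕ.≤ d → + d * + (x ÷ d) ≤ + x
  ÷ℤ x d p = subst (_≤ + x) (*-ab d (x ÷ d)) (toℤ (÷→ {x} {d} p ≤-refl))

  ÷ℤ< : ∀ x d → 1 ℕ.≤ d → + x + + 1 ≤ + d * (+ (x ÷ d) + + 1)
  ÷ℤ< x d p = subst₂ _≤_ (trans (+-ab 1 x) (ℤP.+-comm (+ 1) (+ x))) (trans (*-ab d (suc (x ÷ d))) (cong (+ d *_) (trans (+-ab 1 (x ÷ d)) (ℤP.+-comm (+ 1) (+ (x ÷ d)))))) (toℤ (÷< {x} {d} p))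

  <⇒+1≤ : ∀ {a b} → a < b → a + + 1 ≤ b
  <⇒+1≤ {a} {b} p = subst (_≤ b) (ℤP.+-comm (+ 1) a) (ℤP.i<j⇒suc[i]≤j p)

  neg-absurd : ∀ {a} → + 0 ≤ a → a + + 1 ≤ + 0 → ⊥
  neg-absurd p q = ℤP.<-irrefl refl (ℤP.<-≤-trans (+<+ (s≤s z≤n)) (ℤP.≤-trans (ℤP.+-monoˡ-≤ (+ 1) p) q))

  J-arith : ∀ d x u I J → d * J ≤ x + u → x + + 1 ≤ d * (I + + 1) → + 16 * u ≤ x → + 2 * I + + 1 ≤ J → + 1 ≤ I → + 0 ≤ d → ⊥
  J-arith d x u I J a b c e f d≥0 = neg-absurd (pos 16 ⊗ nn a ⊕ pos 17 ⊗ nn b ⊕ nn c ⊕ pos 16 ⊗ (d≥0 ⊗ nn e) ⊕ pos 15 ⊗ (d≥0 ⊗ nn f) ⊕ pos 14 ⊗ d≥0 ⊕ pos 16)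
    (ℤP.≤-reflexive (lem d x u I J))
    where
    lem : ∀ d x u I J → + 16 * (x + u - d * J) + + 17 * (d * (I + + 1) - (x + + 1)) + (x - + 16 * u) + + 16 * (d * (J - (+ 2 * I + + 1))) + + 15 * (d * (I - + 1)) + + 14 * d + + 16 + + 1 ≡ + 0
    lem = solve-∀

  sub-mass-arith : ∀ t M θ x u r I J a b pI pa pb pJ → (+ 2 * t * u + + 5 * x) * r - t * (pJ - pI) ≤ θ * (x * r) →
    t * (pa - pI) ≤ M * (+ 2 * t * (a - I) + + 4 * I) → t * (pJ - pb) ≤ M * (+ 2 * t * (J - b) + + 4 * b) →
    M * J ≤ (x + u) * r → x * r ≤ M * (I + + 1) → M * I ≤ x * r → (x + u) * r ≤ M * (J + + 1) → b ≤ + 2 * I → + 0 ≤ M → + 0 ≤ t → + 0 ≤ θ → + 0 ≤ x * r →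
    + 2 * t * M * (b - a) - + 2 * t * M - θ * M * (I + + 1) - + 12 * M * I ≤ t * (pb - pa)
  sub-mass-arith t M θ x u r I J a b pI pa pb pJ g f1 f2 h1 h2 h3 h4 h5 m≥0 t≥0 θ≥0 xr≥0 =
    by (nn g ⊕ nn f1 ⊕ nn f2 ⊕ pos 2 ⊗ (t≥0 ⊗ nn h1) ⊕ pos 2 ⊗ (t≥0 ⊗ nn h2) ⊕ θ≥0 ⊗ nn h2 ⊕ pos 4 ⊗ (m≥0 ⊗ nn h5) ⊕ pos 5 ⊗ xr≥0) (solve (t ∷ M ∷ θ ∷ x ∷ u ∷ r ∷ I ∷ J ∷ a ∷ b ∷ pI ∷ pa ∷ pb ∷ pJ ∷ []))

  -- Here t w/2 = 16 q w (2 θ + 12) ≥ (2 θ + 12) I, and w ≥ 4, so the two losses are at most t M w/2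
  -- each. Of density 2, density 1 survives.
  window-arith : ∀ t M θ q I w dp → t ≡ + 32 * q * (+ 2 * θ + + 12) → + 2 * t * M * w - + 2 * t * M - θ * M * (I + + 1) - + 12 * M * I ≤ t * dp →
    I ≤ + 16 * q * w → + 64 * q ≤ I → + 1 ≤ q → + 0 ≤ θ → + 0 ≤ M → + 0 < t → M * w ≤ dp
  window-arith t M θ q I w dp refl a b c q≥1 θ≥0 m≥0 t>0 = cancel-≤ t t>0 (by (nn a ⊕ m≥0 ⊗ (pos 2 ⊗ θ≥0 ⊕ pos 12) ⊗ nn b ⊕ pos 16 ⊗ (m≥0 ⊗ (pos 2 ⊗ θ≥0 ⊕ pos 12)) ⊗ (q≥0 ⊗ w4) ⊕ m≥0 ⊗ θ≥0 ⊗ I1) (lem M θ q I w dp))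
    where
    q≥0 = ℤP.≤-trans (pos 1) q≥1
    q>0 : + 0 < q
    q>0 = ℤP.<-≤-trans (+<+ (s≤s z≤n)) q≥1
    4≤w : + 4 ≤ w
    4≤w = cancel-≤ (+ 16) (+<+ (s≤s z≤n)) (cancel-≤ q q>0 (by (nn b ⊕ nn c) (solve (q ∷ w ∷ I ∷ []))))
    w4 = nn 4≤w
    I1 : + 0 ≤ I - + 1
    I1 = subst (+ 0 ≤_) (li q I) (nn c ⊕ pos 64 ⊗ nn q≥1 ⊕ pos 63)
      where
      li : ∀ q I → I - + 64 * q + + 64 * (q - + 1) + + 63 ≡ I - + 1
      li = solve-∀
    lem : ∀ M θ q I w dp → + 32 * q * (+ 2 * θ + + 12) * dp - + 32 * q * (+ 2 * θ + + 12) * (M * w)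
      ≡ (+ 32 * q * (+ 2 * θ + + 12) * dp - (+ 2 * (+ 32 * q * (+ 2 * θ + + 12)) * M * w - + 2 * (+ 32 * q * (+ 2 * θ + + 12)) * M - θ * M * (I + + 1) - + 12 * M * I))
        + M * (+ 2 * θ + + 12) * (+ 16 * q * w - I) + + 16 * (M * (+ 2 * θ + + 12)) * (q * (w - + 4)) + M * θ * (I - + 1)
    lem = solve-∀

  -- On an interval longer by a factor 8 the same two losses are at most t M w/16 each, now with w ≥
  -- 32; and 2 - 2/16 = 15/8.
  long-arith : ∀ t M θ q I w dp → t ≡ + 32 * q * (+ 2 * θ + + 12) → + 2 * t * M * w - + 2 * t * M - θ * M * (I + + 1) - + 12 * M * I ≤ t * dp →
    I ≤ + 2 * q * w → + 64 * q ≤ I → + 1 ≤ q → + 0 ≤ θ → + 0 ≤ M → + 0 < t → + 15 * (M * w) ≤ + 8 * dp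
  long-arith t M θ q I w dp refl a b c q≥1 θ≥0 m≥0 t>0 = cancel-≤ t t>0 (by (pos 8 ⊗ nn a ⊕ pos 8 ⊗ (m≥0 ⊗ (pos 2 ⊗ θ≥0 ⊕ pos 12)) ⊗ nn b ⊕ pos 16 ⊗ (m≥0 ⊗ (pos 2 ⊗ θ≥0 ⊕ pos 12)) ⊗ (q≥0 ⊗ w32) ⊕ pos 8 ⊗ (m≥0 ⊗ θ≥0) ⊗ I1) (lem M θ q I w dp))
    where
    q≥0 = ℤP.≤-trans (pos 1) q≥1
    q>0 : + 0 < q
    q>0 = ℤP.<-≤-trans (+<+ (s≤s z≤n)) q≥1
    32≤w : + 32 ≤ w
    32≤w = cancel-≤ (+ 2) (+<+ (s≤s z≤n)) (cancel-≤ q q>0 (by (nn b ⊕ nn c) (solve (q ∷ w ∷ I ∷ []))))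
    w32 = nn 32≤w
    I1 : + 0 ≤ I - + 1
    I1 = subst (+ 0 ≤_) (li q I) (nn c ⊕ pos 64 ⊗ nn q≥1 ⊕ pos 63)
      where
      li : ∀ q I → I - + 64 * q + + 64 * (q - + 1) + + 63 ≡ I - + 1
      li = solve-∀
    lem : ∀ M θ q I w dp → + 32 * q * (+ 2 * θ + + 12) * (+ 8 * dp) - + 32 * q * (+ 2 * θ + + 12) * (+ 15 * (M * w))
      ≡ + 8 * (+ 32 * q * (+ 2 * θ + + 12) * dp - (+ 2 * (+ 32 * q * (+ 2 * θ + + 12)) * M * w - + 2 * (+ 32 * q * (+ 2 * θ + + 12)) * M - θ * M * (I + + 1) - + 12 * M * I))
        + + 8 * (M * (+ 2 * θ + + 12)) * (+ 2 * q * w - I) + + 16 * (M * (+ 2 * θ + + 12)) * (q * (w - + 32)) + + 8 * (M * θ) * (I - + 1)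
    lem = solve-∀

  find-arith : ∀ q θx M I b w r dp dG V → M * w ≤ dp → I ≤ + 16 * q * w → b ≤ + 2 * I → b * r ≡ M → r * dp ≤ dG → + 32 * q * V ≤ θx * (M * M) →
    + 0 ≤ r → + 0 ≤ M → + 0 ≤ θx → + 0 ≤ q → + 32 * q * V ≤ + 32 * q * (θx * dG)
  find-arith q θx _ I b w r dp dG V e1 e2 e3 refl e4 e5 r≥0 m≥0 θ≥0 q≥0 =
    by (nn e5 ⊕ pos 32 ⊗ (q≥0 ⊗ θ≥0 ⊗ (nn e4 ⊕ r≥0 ⊗ nn e1)) ⊕ pos 2 ⊗ (θ≥0 ⊗ (m≥0 ⊗ r≥0) ⊗ nn e2) ⊕ θ≥0 ⊗ (m≥0 ⊗ r≥0) ⊗ nn e3) (solve (q ∷ θx ∷ I ∷ b ∷ w ∷ r ∷ dp ∷ dG ∷ V ∷ []))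

  -- The interval is (x, x + x/q]; θ is the relative deficit tolerated in a good number, t the
  -- precision with which Selberg's formula is used, and x₁ a lower bound for the scales x/d
  -- considered.
  record Scale (q θ t x x₁ X : ℕ) : Set where
    field
      16≤q : 16 ℕ.≤ q
      t-def : + t ≡ + 32 * + q * (+ 2 * + θ + + 12)
      thr : threshold t ℕ.≤ x₁
      64q≤ : 64 ℕ.* q ℕ.≤ x₁
      2t≤ : 2 ℕ.* t ℕ.≤ x₁
      x'≤X : x ℕ.+ x ÷ q ℕ.≤ X

  opaque
    -- Ratios over which H grows by (2 `cheb` + 7) M and (`cheb` + 4) M. Over `R₂` Mertens forces G
    -- to grow by M², enough for a first good number; over `R₁` growth of G at 3/2 of the rate of M
    -- H contradicts Mertens.
    R₁ R₂ : ℕ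
    R₁ = 2 ℕ.^ (2 ℕ.* (2 ℕ.* cheb ℕ.+ 7))
    R₂ = 2 ℕ.^ (2 ℕ.* (cheb ℕ.+ 4))

    R₁≡ : R₁ ≡ 2 ℕ.^ (2 ℕ.* (2 ℕ.* cheb ℕ.+ 7))
    R₁≡ = refl

    R₂≡ : R₂ ≡ 2 ℕ.^ (2 ℕ.* (cheb ℕ.+ 4))
    R₂≡ = refl

  R₁≥1 : 1 ℕ.≤ R₁
  R₁≥1 = subst (1 ℕ.≤_) (sym R₁≡) (pow≥1 {2} (2 ℕ.* (2 ℕ.* cheb ℕ.+ 7)) (s≤s z≤n))

  R₂≥1 : 1 ℕ.≤ R₂
  R₂≥1 = subst (1 ℕ.≤_) (sym R₂≡) (pow≥1 {2} (2 ℕ.* (cheb ℕ.+ 4)) (s≤s z≤n))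

  cancel-< : ∀ c a b → + 0 ≤ c → c * a + + 1 ≤ c * b → a + + 1 ≤ b
  cancel-< c a b c≥0 p with ≤-case b a
  ... | inj₂ q = <⇒+1≤ q
  ... | inj₁ q = ⊥-elim (neg-absurd (c≥0 ⊗ nn q ⊕ nn p) (ℤP.≤-reflexive (lem c a b)))
    where
    lem : ∀ c a b → c * (a - b) + (c * b - (c * a + + 1)) + + 1 ≡ + 0
    lem = solve-∀

  -- The bounds `K1-arith` to `K4-arith` locate d' for z = x ÷ m and z' = x' ÷ m: z is at most about
  -- d/(8 q) below d, z' is about z + z/q, and d' is within w' ≤ z/(8 q) of z'. So d' exceeds d by
  -- at least z/(2 q), but by at most d/4.
  K1-arith : ∀ q d m z I w x → m ≤ I + w → + 8 * q * w ≤ I → d * I ≤ x → x + + 1 ≤ m * (z + + 1) → + 0 ≤ d → + 0 ≤ q → + 0 ≤ m →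
    + 8 * q * d + + 1 ≤ (+ 8 * q + + 1) * (z + + 1)
  K1-arith q d m z I w x a b c e d≥0 q≥0 m≥0 = cancel-< m (+ 8 * q * d) ((+ 8 * q + + 1) * (z + + 1)) m≥0
    (by (pos 8 ⊗ (q≥0 ⊗ d≥0 ⊗ nn a) ⊕ d≥0 ⊗ nn b ⊕ (pos 8 ⊗ q≥0 ⊕ pos 1) ⊗ nn c ⊕ (pos 8 ⊗ q≥0 ⊕ pos 1) ⊗ nn e ⊕ pos 8 ⊗ q≥0) (solve (q ∷ d ∷ m ∷ z ∷ I ∷ w ∷ x ∷ [])))

  K2-arith : ∀ q m z z' x u → x + u + + 1 ≤ m * (z' + + 1) → m * z ≤ x → x + + 1 ≤ q * (u + + 1) → + 0 ≤ q → + 0 ≤ m → q * z + z + + 1 ≤ q * (z' + + 1)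
  K2-arith q m z z' x u a b c q≥0 m≥0 = cancel-< m (q * z + z) (q * (z' + + 1)) m≥0 (by (q≥0 ⊗ nn a ⊕ (q≥0 ⊕ pos 1) ⊗ nn b ⊕ nn c) (solve (q ∷ m ∷ z ∷ z' ∷ x ∷ u ∷ [])))

  K3-arith : ∀ q d d' z z' w → + 8 * q * d + + 1 ≤ (+ 8 * q + + 1) * (z + + 1) → q * z + z + + 1 ≤ q * (z' + + 1) → z' - w + + 1 ≤ d' → + 8 * q * w ≤ z → + 64 * q ≤ z → + 0 ≤ q → z ≤ + 2 * q * (d' - d)
  K3-arith q d d' z z' w a b c e f q≥0 = cancel-≤ (+ 4) (+<+ (s≤s z≤n)) (by (nn a ⊕ pos 8 ⊗ nn b ⊕ pos 8 ⊗ (q≥0 ⊗ nn c) ⊕ nn e ⊕ pos 2 ⊗ nn f ⊕ pos 120 ⊗ q≥0 ⊕ pos 8) (solve (q ∷ d ∷ d' ∷ z ∷ z' ∷ w ∷ [])))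

  K4-arith : ∀ q d d' m z z' x u → m * z' ≤ x + u → q * u ≤ x → x + + 1 ≤ m * (z + + 1) → z + + 1 ≤ d → d' ≤ z' → + 16 ≤ q → + 0 ≤ m → + 0 ≤ d → + 4 * d' ≤ + 5 * d
  K4-arith q d d' m z z' x u a b c e f g m≥0 d≥0 = cancel-≤ q (ℤP.<-≤-trans (+<+ (s≤s {0} {15} z≤n)) g) (by (pos 4 ⊗ (q≥0 ⊗ nn f) ⊕ pos 4 ⊗ nn key ⊕ d≥0 ⊗ nn g ⊕ pos 12 ⊗ d≥0 ⊕ pos 4) (lem q d d' z'))
    where
    q≥0 = ℤP.≤-trans (pos 16) g
    key : q * z' + + 1 ≤ (q + + 1) * d
    key = cancel-< m (q * z') ((q + + 1) * d) m≥0 (by (q≥0 ⊗ nn a ⊕ nn b ⊕ (q≥0 ⊕ pos 1) ⊗ nn c ⊕ (q≥0 ⊕ pos 1) ⊗ (m≥0 ⊗ nn e) ⊕ q≥0) (solve (q ∷ d ∷ m ∷ z ∷ z' ∷ x ∷ u ∷ [])))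
    lem : ∀ q d d' z' → q * (+ 5 * d) - q * (+ 4 * d') ≡ + 4 * (q * (z' - d')) + + 4 * ((q + + 1) * d - (q * z' + + 1)) + d * (q - + 16) + + 12 * d + + 4
    lem = solve-∀

  rc-ratio : ∀ d d' r r' M → + 4 * d' ≤ + 5 * d → d * r ≡ M → d' * r' ≡ M → + 0 < d → + 0 ≤ r' → + 4 * r ≤ + 5 * r'
  rc-ratio d d' r r' M a refl e d>0 r'≥0 = cancel-≤ d d>0 (subst₂ _≤_ (trans (l1 d' r') (trans (cong (+ 4 *_) e) (l2 d r))) (l3 d r') (ℤP.*-monoʳ-≤-nonNeg r' {{ℤ.nonNegative r'≥0}} a))
    where
    l1 : ∀ a b → + 4 * a * b ≡ + 4 * (a * b)
    l1 = solve-∀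
    l2 : ∀ a b → + 4 * (a * b) ≡ a * (+ 4 * b)
    l2 = solve-∀
    l3 : ∀ a b → + 5 * a * b ≡ a * (+ 5 * b)
    l3 = solve-∀

  -- 15/8 · 4/5 = 3/2: the density from `long-arith`, and the loss from weighting by M/d' instead of
  -- M/d.
  step-arith : ∀ M δ r r' dH dG dp → dH ≤ δ * r → r' * dp ≤ dG → + 15 * (M * δ) ≤ + 8 * dp → + 4 * r ≤ + 5 * r' → + 0 ≤ M → + 0 ≤ δ → + 0 ≤ r' → + 3 * M * dH ≤ + 2 * dG
  step-arith M δ r r' dH dG dp a b c d m≥0 δ≥0 r'≥0 = cancel-≤ (+ 8) (+<+ (s≤s z≤n)) (by (pos 24 ⊗ (m≥0 ⊗ nn a) ⊕ pos 16 ⊗ nn b ⊕ pos 2 ⊗ (r'≥0 ⊗ nn c) ⊕ pos 6 ⊗ (m≥0 ⊗ δ≥0 ⊗ nn d)) (solve (M ∷ δ ∷ r ∷ r' ∷ dH ∷ dG ∷ dp ∷ [])))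

  deficit-const : ℕ → ℕ → ℕ
  deficit-const t x₁ = (2 ℕ.* t ℕ.+ 5) ℕ.* cheb ℕ.+ selC t ℕ.+ 512 ℕ.* t ℕ.+ 2 ℕ.* t ℕ.* cheb ℕ.* (4 ℕ.* x₁ ℕ.+ cheb ℕ.+ 3)

  deficit-constℤ : ∀ t x₁ → + deficit-const t x₁ ≡ (+ 2 * + t + + 5) * + cheb + + selC t + + 512 * + t + + 2 * + t * + cheb * (+ 4 * + x₁ + + cheb + + 3)
  deficit-constℤ t x₁ = trans (+-ab (a ℕ.+ selC t ℕ.+ 512 ℕ.* t) b) (cong₂ _+_ (trans (+-ab (a ℕ.+ selC t) (512 ℕ.* t)) (cong₂ _+_ (trans (+-ab a (selC t)) (cong (_+ + selC t) ea)) (*-ab 512 t))) eb)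
    where
    a = (2 ℕ.* t ℕ.+ 5) ℕ.* cheb
    b = 2 ℕ.* t ℕ.* cheb ℕ.* (4 ℕ.* x₁ ℕ.+ cheb ℕ.+ 3)
    ea : + a ≡ (+ 2 * + t + + 5) * + cheb
    ea = trans (*-ab (2 ℕ.* t ℕ.+ 5) cheb) (cong (_* + cheb) (trans (+-ab (2 ℕ.* t) 5) (cong (_+ + 5) (*-ab 2 t))))
    eb : + b ≡ + 2 * + t * + cheb * (+ 4 * + x₁ + + cheb + + 3)
    eb = trans (*-ab (2 ℕ.* t ℕ.* cheb) (4 ℕ.* x₁ ℕ.+ cheb ℕ.+ 3)) (cong₂ _*_ (trans (*-ab (2 ℕ.* t) cheb) (cong (_* + cheb) (*-ab 2 t)))
      (trans (+-ab (4 ℕ.* x₁ ℕ.+ cheb) 3) (cong (_+ + 3) (trans (+-ab (4 ℕ.* x₁) cheb) (cong (_+ + cheb) (*-ab 4 x₁))))))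

  -- The main terms 2 t u M H cancel. The coefficient 8 is 5 + 3, from the 5 x in `Def` and from
  -- Selberg's error; everything else is a multiple of M² x and is collected in K.
  W-arith : ∀ t M x x' u H A sel x1 FY GY HY Hx' Gx' SY Q T PP S2 K → FY ≡ (+ 2 * t * u + + 5 * x) * GY - t * SY → Q ≡ SY + T → S2 ≡ PP + Q →
    - (+ 3 * (x * (M * H)) + sel * (M * M * x)) ≤ t * (S2 - + 2 * M * u * H) → PP ≤ + 512 * (M * M * x) → T ≤ A * x' * (Gx' - GY) →
    Gx' ≤ M * Hx' + A * (M * M) → M * HY ≤ GY + + 3 * (M * M) → Hx' - HY ≤ + 4 * x1 * M → GY ≤ M * HY + A * (M * M) → HY ≤ H → u ≤ x → x' ≤ + 2 * x →
    K ≡ (+ 2 * t + + 5) * A + sel + + 512 * t + + 2 * t * A * (+ 4 * x1 + A + + 3) →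
    + 0 ≤ M → + 0 ≤ t → + 0 ≤ x → + 0 ≤ x' → + 0 ≤ u → + 0 ≤ A → + 0 ≤ x1 →
    FY ≤ + 8 * (x * (M * H)) + K * (M * M * x)
  W-arith t M x x' u H A sel x1 _ GY HY Hx' Gx' SY _ T PP _ _ refl refl refl s pp tl g1 g2 h1 g3 h2 ux x2 refl m≥0 t≥0 x≥0 x'≥0 u≥0 A≥0 x1≥0 =
    by (nn s ⊕ t≥0 ⊗ nn pp ⊕ t≥0 ⊗ nn tl ⊕ t≥0 ⊗ (A≥0 ⊗ x'≥0) ⊗ (nn g1 ⊕ nn g2 ⊕ m≥0 ⊗ nn h1) ⊕ (pos 2 ⊗ t≥0 ⊗ u≥0 ⊕ pos 5 ⊗ x≥0) ⊗ (nn g3 ⊕ m≥0 ⊗ nn h2)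
        ⊕ pos 2 ⊗ (t≥0 ⊗ A≥0 ⊗ (m≥0 ⊗ m≥0) ⊗ nn ux) ⊕ t≥0 ⊗ A≥0 ⊗ (m≥0 ⊗ m≥0) ⊗ (pos 4 ⊗ x1≥0 ⊕ A≥0 ⊕ pos 3) ⊗ nn x2) (solve (t ∷ M ∷ x ∷ x' ∷ u ∷ H ∷ A ∷ sel ∷ x1 ∷ GY ∷ HY ∷ Hx' ∷ Gx' ∷ SY ∷ T ∷ PP ∷ []))

  -- With s' about the fourth root of x', H ≤ 16 s' M. Hence H p ≤ s H² ≤ 256 M² s s'² ≤ 256 M² s²,
  -- and s² ≤ x' ≤ 2 x.
  pp-arith : ∀ M H Hs g rs s s' x x' p → H - + 2 * Hs + g ≤ + 4 * rs → Hs ≤ + 6 * (s' * M) → rs ≤ M → + 0 ≤ g → + 1 ≤ s' → s' * s' ≤ s → s * s ≤ x' → x' ≤ + 2 * x → p ≤ s * H → + 0 ≤ M → + 0 ≤ s → + 0 ≤ H →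
    H * p ≤ + 512 * (M * M * x)
  pp-arith M H Hs g rs s s' x x' p a b c d e f h i j m≥0 s≥0 H≥0 = by (H≥0 ⊗ nn j ⊕ s≥0 ⊗ (Hk ⊗ H≥0 ⊕ Hk ⊗ (pos 16 ⊗ (s'≥0 ⊗ m≥0))) ⊕ pos 256 ⊗ (m≥0 ⊗ m≥0 ⊗ (s≥0 ⊗ nn f)) ⊕ pos 256 ⊗ (m≥0 ⊗ m≥0 ⊗ nn h) ⊕ pos 256 ⊗ (m≥0 ⊗ m≥0 ⊗ nn i)) (lem M H s s' x x' p)
    where
    s'≥0 = ℤP.≤-trans (pos 1) e
    Hk : + 0 ≤ + 16 * (s' * M) - H
    Hk = subst (+ 0 ≤_) (l M H Hs g rs s') (nn a ⊕ pos 2 ⊗ nn b ⊕ pos 4 ⊗ nn c ⊕ d ⊕ pos 4 ⊗ (nn e ⊗ m≥0))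
      where
      l : ∀ M H Hs g rs s' → (+ 4 * rs - (H - + 2 * Hs + g)) + + 2 * (+ 6 * (s' * M) - Hs) + + 4 * (M - rs) + g + + 4 * ((s' - + 1) * M) ≡ + 16 * (s' * M) - H
      l = solve-∀
    lem : ∀ M H s s' x x' p → + 512 * (M * M * x) - H * p ≡ H * (s * H - p) + s * ((+ 16 * (s' * M) - H) * H + (+ 16 * (s' * M) - H) * (+ 16 * (s' * M))) + + 256 * (M * M * (s * (s - s' * s'))) + + 256 * (M * M * (x' - s * s)) + + 256 * (M * M * (+ 2 * x - x'))
    lem = solve-∀

  module WithLog (X : ℕ) (sys : LogSystem X) where
    open LogSystem sys

    -- Dirichlet's divisor problem with error O(√y)

    M≥0 : + 0 ≤ M
    M≥0 = ℤP.<⇒≤ 0<M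

    rc≥0 : ∀ k → 1 ℕ.≤ k → k ℕ.≤ X → + 0 ≤ rc k
    rc≥0 k p q = cancel-≤ (+ k) (+<+ p) (subst₂ _≤_ (sym (ℤP.*-zeroʳ (+ k))) (sym (rc-spec k p q)) M≥0)

    rc-anti : ∀ a b → 1 ℕ.≤ a → a ℕ.≤ b → b ℕ.≤ X → rc b ≤ rc a
    rc-anti a b p q r = cancel-≤ (+ a) (+<+ p) (subst (+ a * rc b ≤_) (trans (rc-spec b (≤-trans p q) r) (sym (rc-spec a p (≤-trans q r))))
      (ℤP.*-monoʳ-≤-nonNeg (rc b) {{ℤ.nonNegative (rc≥0 b (≤-trans p q) r)}} (toℤ q)))

    rc≤M : ∀ k → 1 ℕ.≤ k → k ℕ.≤ X → rc k ≤ M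
    rc≤M k p q = subst (rc k ≤_) (trans (sym (ℤP.*-identityˡ (rc 1))) (rc-spec 1 ≤-refl (≤-trans p q))) (rc-anti 1 k ≤-refl p q)

    H-mono : ∀ {a b} → a ℕ.≤ b → b ℕ.≤ X → H a ≤ H b
    H-mono p q = S-mono-n p λ i u v → rc≥0 i u (≤-trans v q)

    H≥0 : ∀ {a} → a ℕ.≤ X → + 0 ≤ H a
    H≥0 q = H-mono z≤n q

    H≤ : ∀ a → a ℕ.≤ X → H a ≤ + a * M
    H≤ a q = subst (H a ≤_) (S-const a M) (S-mono a λ i u v → rc≤M i u (≤-trans v q))

    -- The first r terms are at most M each, the later ones at most M/r. This is how H is made small
    -- against any fixed fraction of y.
    H-slow : ∀ r y → y ℕ.≤ X → + r * H y ≤ M * (+ r * + r + + y)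
    H-slow r zero _ = subst (_≤ M * (+ r * + r + + 0)) (sym (ℤP.*-zeroʳ (+ r))) (M≥0 ⊗ (pos r ⊗ pos r ⊕ pos 0))
    H-slow r (suc y) q with r ℕ.≤? suc y
    ... | yes p = stp (+ r) (+ y) (+ suc y) (H y) (rc (suc y)) (H-slow r y (≤-trans (n≤1+n y) q)) (+-ab 1 y)
          (subst (+ r * rc (suc y) ≤_) (rc-spec (suc y) (s≤s z≤n) q) (ℤP.*-monoʳ-≤-nonNeg (rc (suc y)) {{ℤ.nonNegative (rc≥0 (suc y) (s≤s z≤n) q)}} (toℤ p)))
      where
      stp : ∀ r y y' h c → r * h ≤ M * (r * r + y) → y' ≡ + 1 + y → r * c ≤ M → r * (h + c) ≤ M * (r * r + y')
      stp r y _ h c a refl b = by (nn a ⊕ nn b) (lem M r y h c)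
        where
        lem : ∀ M r y h c → M * (r * r + (+ 1 + y)) - r * (h + c) ≡ (M * (r * r + y) - r * h) + (M - r * c)
        lem = solve-∀
    ... | no ¬p = ℤP.≤-trans (ℤP.*-monoˡ-≤-nonNeg (+ r) (H≤ (suc y) q)) (stp (+ r) (+ suc y) (toℤ (<⇒≤ (≰⇒> ¬p))))
      where
      stp : ∀ r y → y ≤ r → {{_ : ℤ.NonNegative r}} {{_ : ℤ.NonNegative y}} → r * (y * M) ≤ M * (r * r + y)
      stp r y a = by (M≥0 ⊗ (ℤP.nonNegative⁻¹ r ⊗ nn a) ⊕ M≥0 ⊗ ℤP.nonNegative⁻¹ y) (lem M r y)
        where
        lem : ∀ M r y → M * (r * r + y) - r * (y * M) ≡ M * (r * (r - y)) + M * y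
        lem = solve-∀

    H-sum : ∀ y → y ℕ.≤ X → S y H ≡ (+ 1 + + y) * H y - + y * M
    H-sum zero _ = sym (z M)
      where
      z : ∀ M → (+ 1 + + 0) * + 0 - + 0 * M ≡ + 0
      z = solve-∀
    H-sum (suc y) q = trans (cong (_+ H (suc y)) (H-sum y (≤-trans (n≤1+n y) q))) (stp (+ y) (+ suc y) (H y) (rc (suc y)) (+-ab 1 y) (rc-spec (suc y) (s≤s z≤n) q))
      where
      stp : ∀ y y' h c → y' ≡ + 1 + y → y' * c ≡ M → ((+ 1 + y) * h - y * M) + (h + c) ≡ (+ 1 + y') * (h + c) - y' * M
      stp y _ h c refl e = trans (cong (λ M → ((+ 1 + y) * h - y * M) + (h + c)) (sym e)) (trans (lem y h c) (cong (λ M → (+ 1 + (+ 1 + y)) * (h + c) - (+ 1 + y) * M) e))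
        where
        lem : ∀ y h c → ((+ 1 + y) * h - y * ((+ 1 + y) * c)) + (h + c) ≡ (+ 1 + (+ 1 + y)) * (h + c) - (+ 1 + y) * ((+ 1 + y) * c)
        lem = solve-∀

    floor-hi : ∀ y a → 1 ℕ.≤ a → a ℕ.≤ X → M * + (y ÷ a) ≤ + y * rc a
    floor-hi y a p q = subst (_≤ + y * rc a) (trans (lem (+ a) (+ (y ÷ a)) (rc a)) (cong (_* + (y ÷ a)) (rc-spec a p q)))
      (ℤP.*-monoʳ-≤-nonNeg (rc a) {{ℤ.nonNegative (rc≥0 a p q)}} (subst (_≤ + y) (*-ab a _) (toℤ (÷→ p ≤-refl))))
      where
      lem : ∀ a q r → a * q * r ≡ a * r * q
      lem = solve-∀

    floor-lo : ∀ y a → 1 ℕ.≤ a → a ℕ.≤ X → + y * rc a ≤ M * (+ (y ÷ a) + + 1)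
    floor-lo y a p q = subst (+ y * rc a ≤_) (trans (lem (+ a) (+ (y ÷ a)) (rc a)) (cong (_* (+ (y ÷ a) + + 1)) (rc-spec a p q)))
      (ℤP.*-monoʳ-≤-nonNeg (rc a) {{ℤ.nonNegative (rc≥0 a p q)}} (subst (+ y ≤_) (trans (*-ab a _) (cong (+ a *_) (+-ab 1 (y ÷ a)))) (toℤ (<⇒≤ (÷< {y} {a} p)))))
      where
      lem : ∀ a q r → a * (+ 1 + q) * r ≡ a * r * (q + + 1)
      lem = solve-∀

    τ : ℕ → ℤ
    τ n = S X (λ k → ι (k ∣? n) * + 1)

    -- In units of M, `f` is log - τ + 2γ. By Dirichlet's Σ τ = y log y + (2γ - 1) y + O(√y) its
    -- partial sums are O(√y). Multiplying it by log - 2γ yields log² up to a divisor sum.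
    f wt : ℕ → ℤ
    f n = ℓ n - M * τ n + + 2 * g
    wt n = ℓ n - + 2 * g

    τ-sum : ∀ y → y ℕ.≤ X → S y τ ≡ S y (λ k → + (y ÷ k))
    τ-sum y y≤X = trans (S-swap y X _) (trans (S-cong X λ k p _ → trans (dsum y k (λ _ → + 1) p) (S-1 (y ÷ k)))
      (trans (sym (S-trunc' )) refl))
      where
      S-trunc' : S y (λ k → + (y ÷ k)) ≡ S X (λ k → + (y ÷ k))
      S-trunc' = trans (sym (S-trunc (λ k → + (y ÷ k)) y≤X)) (S-ext X g')
        where
        g' : ∀ k → ι (k ℕ.≤? y) * + (y ÷ k) ≡ + (y ÷ k)
        g' k with k ℕ.≤? y
        ... | yes _ = ℤP.*-identityˡ _
        ... | no ¬p = trans (ℤP.*-zeroˡ (+ (y ÷ k))) (cong +_ (sym (÷-big (≰⇒> ¬p))))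

    f-sum : ∀ y → y ℕ.≤ X → S y f ≡ S y ℓ - M * S y (λ k → + (y ÷ k)) + + y * (+ 2 * g)
    f-sum y y≤X = trans (S-+ y _ _) (cong₂ _+_ (trans (S-- y _ _) (cong (λ z → S y ℓ - z) (trans (S-* y M τ) (cong (M *_) (τ-sum y y≤X))))) (S-const y (+ 2 * g)))

    ℓ-sum-hi : ∀ y → y ℕ.≤ X → S y ℓ ≤ ((+ 1 + + y) * H y - + y * M) - + y * g
    ℓ-sum-hi y q = subst (S y ℓ ≤_) (trans (S-- y _ _) (cong₂ _-_ (H-sum y q) (S-const y g))) (S-mono y λ i u v → ℓ-hi i u (≤-trans v q))

    ℓ-sum-lo : ∀ y → y ℕ.≤ X → ((+ 1 + + y) * H y - + y * M) - + y * g ≤ S y ℓ + + 2 * H y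
    ℓ-sum-lo y q = subst₂ _≤_ (trans (S-- y _ _) (cong₂ _-_ (H-sum y q) (S-const y g))) (trans (S-+ y _ _) (cong (_+_ (S y ℓ)) (S-* y (+ 2) rc))) (S-mono y λ i u v → ℓ-lo i u (≤-trans v q))

    module AtSquare (y s : ℕ) (1≤y : 1 ℕ.≤ y) (y≤X : y ℕ.≤ X) (lo : s ℕ.* s ℕ.≤ y) (hi : y ℕ.< suc s ℕ.* suc s) where

      1≤s : 1 ℕ.≤ s
      1≤s = sqrt≥1 y s 1≤y hi

      1≤ss : 1 ℕ.≤ s ℕ.* s
      1≤ss = *-mono-≤ 1≤s 1≤s

      ss≤X : s ℕ.* s ℕ.≤ X
      ss≤X = ≤-trans lo y≤X

      s≤ss : s ℕ.≤ s ℕ.* s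
      s≤ss = m≤m*n s s {{ℕ.>-nonZero 1≤s}}

      s≤y : s ℕ.≤ y
      s≤y = ≤-trans s≤ss lo

      s≤X : s ℕ.≤ X
      s≤X = ≤-trans s≤y y≤X

      y≤ : + y ≤ + s * + s + + 2 * + s
      y≤ = subst (+ y ≤_) (trans (+-ab (s ℕ.* s) (2 ℕ.* s)) (cong₂ _+_ (*-ab s s) (*-ab 2 s))) (toℤ (≤-pred (≤-trans hi (≤-reflexive (sq s)))))
        where
        sq : ∀ s → suc s ℕ.* suc s ≡ suc (s ℕ.* s ℕ.+ 2 ℕ.* s)
        sq = solveℕ

      lo' : + s * + s ≤ + y
      lo' = subst (_≤ + y) (*-ab s s) (toℤ lo)

      rs-eq : + s * rc (s ℕ.* s) ≡ rc s
      rs-eq = ℤP.*-cancelˡ-≡ (+ s) _ _ {{ℤ.>-nonZero (+<+ 1≤s)}} (trans (sym (ℤP.*-assoc (+ s) (+ s) _)) (trans (cong (_* rc (s ℕ.* s)) (sym (*-ab s s))) (trans (rc-spec _ 1≤ss ss≤X) (sym (rc-spec s 1≤s s≤X)))))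

      Hy≤ : H y ≤ H (s ℕ.* s) + + 2 * rc s
      Hy≤ = cmb (H y) (H (s ℕ.* s)) (+ y) (+ s) (rc (s ℕ.* s)) (rc s) (subst (λ z → H y - H (s ℕ.* s) ≤ (+ y - z) * rc (s ℕ.* s)) (*-ab s s) (Sd-≤ (rc (s ℕ.* s)) lo λ i u v → rc-anti (s ℕ.* s) i 1≤ss (<⇒≤ u) (≤-trans v y≤X))) y≤ (rc≥0 _ 1≤ss ss≤X) rs-eq
        where
        cmb : ∀ a b y s r rs → a - b ≤ (y - s * s) * r → y ≤ s * s + + 2 * s → + 0 ≤ r → s * r ≡ rs → a ≤ b + + 2 * rs
        cmb a b y s r _ p q r≥0 refl = by (nn p ⊕ nn q ⊗ r≥0) (solve (a ∷ b ∷ y ∷ s ∷ r ∷ []))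

      ℓss : ℓ (s ℕ.* s) ≡ + 2 * ℓ s
      ℓss = trans (ℓ-* s s 1≤s 1≤s ss≤X) (dbl (ℓ s))
        where
        dbl : ∀ x → x + x ≡ + 2 * x
        dbl = solve-∀

      mv1 : ∀ h g l → l ≤ h - g → l + g ≤ h
      mv1 h g l a = by (nn a) (solve (h ∷ g ∷ l ∷ []))

      mv2 : ∀ h g l r → h - g ≤ l + r → h ≤ l + g + r
      mv2 h g l r a = by (nn a) (solve (h ∷ g ∷ l ∷ r ∷ []))

      δ≤ : H y - + 2 * H s + g ≤ + 4 * rc s
      δ≤ = δ-hi (H y) (H s) (H (s ℕ.* s)) (ℓ s) g (rc s) (rc (s ℕ.* s)) Hy≤ (subst (λ z → H (s ℕ.* s) ≤ z + g + + 2 * rc (s ℕ.* s)) ℓss (mv2 (H (s ℕ.* s)) g (ℓ (s ℕ.* s)) (+ 2 * rc (s ℕ.* s)) (ℓ-lo _ 1≤ss ss≤X))) (mv1 (H s) g (ℓ s) (ℓ-hi s 1≤s s≤X)) (rc-anti s _ 1≤s s≤ss ss≤X)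

      δ≥ : - (+ 4 * rc s) ≤ H y - + 2 * H s + g
      δ≥ = δ-lo (H y) (H s) (H (s ℕ.* s)) (ℓ s) g (rc s) (H-mono lo y≤X) (subst (λ z → z + g ≤ H (s ℕ.* s)) ℓss (mv1 (H (s ℕ.* s)) g (ℓ (s ℕ.* s)) (ℓ-hi _ 1≤ss ss≤X))) (mv2 (H s) g (ℓ s) (+ 2 * rc s) (ℓ-lo s 1≤s s≤X))

      y·rs : + y * rc s ≤ + 3 * (+ s * M)
      y·rs = yrs (+ y) (+ s) M (rc s) y≤ (rc-spec s 1≤s s≤X) (toℤ 1≤s) (rc≥0 s 1≤s s≤X)

      Hy≤6sM : H y ≤ + 6 * (+ s * M)
      Hy≤6sM = Hy-hi (H y) (H s) g (rc s) M (+ s) δ≤ (H≤ s s≤X) (rc≤M s 1≤s s≤X) g≥0 M≥0 (toℤ 1≤s)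

      T₁ : ℤ
      T₁ = S s (λ a → + (y ÷ a))

      MT₁-hi : M * T₁ ≤ + y * H s
      MT₁-hi = subst₂ _≤_ (S-* s M _) (S-* s (+ y) rc) (S-mono s λ a u v → floor-hi y a u (≤-trans v s≤X))

      MT₁-lo : + y * H s ≤ M * T₁ + + s * M
      MT₁-lo = subst₂ _≤_ (S-* s (+ y) rc) (trans (S-* s M _) (trans (cong (M *_) (trans (S-+ s _ _) (cong (_+_ T₁) (S-1 s)))) (lem M T₁ (+ s)))) (S-mono s λ a u v → floor-lo y a u (≤-trans v s≤X))
        where
        lem : ∀ M T s → M * (T + s) ≡ M * T + s * M
        lem = solve-∀

      -- The main terms y H y - y M - y g of Σ ℓ and 2 y H s - M s² of M Σ τ combine with 2 g y to y
      -- (H y - 2 H s + g) - M (y - s²), and both parts are of order s M.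
      D-bound : Abs (S y f) (+ 20 * (+ s * M))
      D-bound = subst (λ z → Abs z (+ 20 * (+ s * M))) (sym (trans (f-sum y y≤X) (cong (λ z → S y ℓ - M * z + + y * (+ 2 * g)) (dirichlet-hyperbola y s lo hi))))
        ( D-lo (+ y) (+ s) M g (H y) (H s) (S y ℓ) T₁ (rc s) (ℓ-sum-lo y y≤X) MT₁-hi δ≥ y·rs Hy≤6sM y≤ M≥0 (pos y)
        , D-hi (+ y) (+ s) M g (H y) (H s) (S y ℓ) T₁ (rc s) (ℓ-sum-hi y y≤X) MT₁-lo δ≤ y·rs Hy≤6sM lo' M≥0 (pos y))

    sqrt-mono : ∀ {y y' s s'} → s ℕ.* s ℕ.≤ y → y ℕ.≤ y' → y' ℕ.< suc s' ℕ.* suc s' → s ℕ.≤ s'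
    sqrt-mono {s = s} {s'} a b c with s ℕ.≤? s'
    ... | yes p = p
    ... | no ¬p = ⊥-elim (<⇒≱ c (≤-trans (*-mono-≤ (≰⇒> ¬p) (≰⇒> ¬p)) (≤-trans a b)))

    E : ℕ → ℤ
    E y = S y (λ n → wt n * f n)

    E-bound₀ : ∀ y s → 1 ℕ.≤ y → y ℕ.≤ X → s ℕ.* s ℕ.≤ y → y ℕ.< suc s ℕ.* suc s →
      Abs (E y) ((H y + + 5 * M) * (+ 20 * (+ s * M)) + + 60 * (+ s * M) * H y)
    E-bound₀ (suc y) s _ y≤X lo hi = subst (λ z → Abs z ((H (suc y) + + 5 * M) * (+ 20 * (+ s * M)) + + 60 * (+ s * M) * H (suc y))) (sym (abel y wt f))
      (Abs-- (Abs-* {wt (suc y)} {H (suc y) + + 5 * M} {S (suc y) f} w-abs (AtSquare.D-bound (suc y) s (s≤s z≤n) y≤X lo hi)) sum-abs)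
      where
      w-abs : Abs (wt (suc y)) (H (suc y) + + 5 * M)
      w-abs = w-lo (H (suc y)) g M (ℓ (suc y)) (rc (suc y)) (ℓ-lo _ (s≤s z≤n) y≤X) (rc≤M _ (s≤s z≤n) y≤X) g≤M (H≥0 y≤X)
            , w-hi (H (suc y)) g M (ℓ (suc y)) (ℓ-hi _ (s≤s z≤n) y≤X) g≥0 M≥0
      term : ∀ n → 1 ℕ.≤ n → n ℕ.≤ y → Abs ((wt (suc n) - wt n) * S n f) (+ 60 * (+ s * M) * rc n)
      term n 1≤n n≤y with isqrt n
      ... | s' , lo' , hi' = subst (Abs _) (lem (rc n) (+ s) M) (Abs-* {wt (suc n) - wt n} {+ 3 * rc n} {S n f}
          ( Δ-lo (H n) g (rc n) (rc (suc n)) (ℓ n) (ℓ (suc n)) (ℓ-lo (suc n) (s≤s z≤n) n'≤X) (ℓ-hi n 1≤n n≤X) (rc-anti n (suc n) 1≤n (n≤1+n n) n'≤X) (rc≥0 n 1≤n n≤X)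
          , Δ-hi (H n) g (rc n) (rc (suc n)) (ℓ n) (ℓ (suc n)) (ℓ-hi (suc n) (s≤s z≤n) n'≤X) (ℓ-lo n 1≤n n≤X) (rc-anti n (suc n) 1≤n (n≤1+n n) n'≤X))
          (Abs-≤ {S n f} (AtSquare.D-bound n s' 1≤n n≤X lo' hi') (ℤP.*-monoˡ-≤-nonNeg (+ 20) (ℤP.*-monoʳ-≤-nonNeg M {{ℤ.nonNegative M≥0}} (toℤ {s'} {s} (sqrt-mono lo' (m≤n⇒m≤1+n n≤y) hi))))))
        where
        n'≤X : suc n ℕ.≤ X
        n'≤X = ≤-trans (s≤s n≤y) y≤X
        n≤X = ≤-trans (n≤1+n n) n'≤X
        lem : ∀ r s m → + 3 * r * (+ 20 * (s * m)) ≡ + 60 * (s * m) * r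
        lem = solve-∀
      sum-abs : Abs (S y (λ n → (wt (suc n) - wt n) * S n f)) (+ 60 * (+ s * M) * H (suc y))
      sum-abs = Abs-≤ {S y (λ n → (wt (suc n) - wt n) * S n f)} (Abs-S y term) (subst (_≤ + 60 * (+ s * M) * H (suc y)) (sym (S-* y (+ 60 * (+ s * M)) rc))
        (ℤP.*-monoˡ-≤-nonNeg (+ 60 * (+ s * M)) {{ℤ.nonNegative (pos 60 ⊗ (pos s ⊗ M≥0))}} (H-mono (n≤1+n y) y≤X)))

    E-bound : ∀ t y → 1 ℕ.≤ y → y ℕ.≤ X → Abs (+ t * E y) (M * M * (+ y + + errC t))
    E-bound t y 1≤y y≤X with isqrt y
    ... | s , lo , hi = Abs-≤ {+ t * E y} {+ t * B} {M * M * (+ y + + errC t)} (Abs-* {+ t} {+ t} {E y} {B} (Abs-nn (pos t)) (E-bound₀ y s 1≤y y≤X lo hi))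
        (subst (λ z → + t * B ≤ M * M * (+ y + z)) (sym (*-ab (errA t) (errA t)))
          (E-arith (+ t) (+ (320 ℕ.* t)) (+ errA t) (+ s) (+ y) M (H s) (H y) g (rc s) (*-ab 320 t) (trans (+-ab ((320 ℕ.* t) ℕ.* (320 ℕ.* t)) (840 ℕ.* t)) (cong₂ _+_ (*-ab (320 ℕ.* t) (320 ℕ.* t)) (*-ab 840 t)))
            (H-slow (320 ℕ.* t) s Sq.s≤X) Sq.δ≤ (rc≤M s Sq.1≤s Sq.s≤X) g≥0 Sq.lo' M≥0 (pos t) (pos s) (pos (errA t))))
      where
      B = (H y + + 5 * M) * (+ 20 * (+ s * M)) + + 60 * (+ s * M) * H y
      module Sq = AtSquare y s 1≤y y≤X lo hi

    -- Selberg's symmetry formula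

    -- `S₂` sums Λ ℓ + Λ ∗ Λ, whose divisor sum is ℓ². `h` is its explicit approximation: the
    -- divisor sum of `h` is M τ ℓ - 2 g M τ + 4 g², since τ ℓ is that of 2 ℓ.
    ψ S₂ h Hs P R : ℕ → ℤ
    ψ n = S n Λ
    S₂ z = S z (λ n → Λ n * ℓ n) + S z (λ a → Λ a * ψ (z ÷ a))
    h n = (+ 2 * M * ℓ n - + 2 * g * M) + + 4 * (g * g) * ι (n ℕ.≟ 1)
    Hs z = S z h
    P y = S y (λ n → ℓ n * ℓ n)
    R z = S₂ z - Hs z

    ψ-mono : ∀ {a b} → a ℕ.≤ b → ψ a ≤ ψ b
    ψ-mono p = S-mono-n p λ i _ _ → Λ≥0 i

    ψ≥0 : ∀ a → + 0 ≤ ψ a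
    ψ≥0 a = ψ-mono {0} {a} z≤n

    ℓ-weight : ∀ y (v : ℕ → ℤ) → y ℕ.≤ X → S y (λ n → ℓ n * v n) ≡ S y (λ d → Λ d * S (y ÷ d) (λ k → v (d ℕ.* k)))
    ℓ-weight y v y≤X = begin
      S y (λ n → ℓ n * v n)
        ≡⟨ S-ext y (λ n → trans (ℤP.*-comm (ℓ n) (v n)) (trans (sym (S-* X (v n) _)) (S-ext X λ d → l1 (v n) (ι (d ∣? n)) (Λ d)))) ⟩
      S y (λ n → S X (λ d → Λ d * (ι (d ∣? n) * v n)))
        ≡⟨ S-swap y X _ ⟩
      S X (λ d → S y (λ n → Λ d * (ι (d ∣? n) * v n)))
        ≡⟨ S-cong X (λ d 1≤d _ → trans (S-* y (Λ d) _) (cong (Λ d *_) (dsum y d v 1≤d))) ⟩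
      S X (λ d → Λ d * S (y ÷ d) (λ k → v (d ℕ.* k)))
        ≡⟨ S-shrink _ y≤X (λ d y<d → trans (cong (λ z → Λ d * S z (λ k → v (d ℕ.* k))) (÷-big y<d)) (ℤP.*-zeroʳ (Λ d))) ⟩
      S y (λ d → Λ d * S (y ÷ d) (λ k → v (d ℕ.* k))) ∎
      where
      open ≡-Reasoning
      l1 : ∀ v i l → v * (i * l) ≡ l * (i * v)
      l1 = solve-∀

    ℓ-dk : ∀ y d k → y ℕ.≤ X → 1 ℕ.≤ d → 1 ℕ.≤ k → k ℕ.≤ y ÷ d → ℓ (d ℕ.* k) ≡ ℓ d + ℓ k
    ℓ-dk y d k y≤X p q r = ℓ-* d k p q (≤-trans (÷→ p r) y≤X)

    ℓ-sum : ∀ z → z ℕ.≤ X → S z ℓ ≡ S z (λ j → ψ (z ÷ j))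
    ℓ-sum z z≤X = trans (S-ext z λ n → sym (ℤP.*-identityʳ (ℓ n))) (trans (ℓ-weight z (λ _ → + 1) z≤X) (trans (S-ext z λ b → trans (sym (S-* (z ÷ b) (Λ b) _)) (S-ext (z ÷ b) λ _ → ℤP.*-identityʳ (Λ b))) (hyp-swap z λ b _ → Λ b)))

    -- In ℓ² one factor is expanded as the sum of Λ over the divisors d of n, and the other is split
    -- by ℓ (d k) = ℓ d + ℓ k; the two parts give Λ ℓ and Λ ∗ Λ.
    P-S₂ : ∀ y → y ℕ.≤ X → P y ≡ S y (λ k → S₂ (y ÷ k))
    P-S₂ y y≤X = begin
      P y
        ≡⟨ ℓ-weight y ℓ y≤X ⟩
      S y (λ d → Λ d * S (y ÷ d) (λ k → ℓ (d ℕ.* k)))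
        ≡⟨ S-cong y (λ d 1≤d _ → trans (cong (Λ d *_) (trans (S-cong (y ÷ d) λ k q r → ℓ-dk y d k y≤X 1≤d q r) (S-+ (y ÷ d) _ _))) (trans (ℤP.*-distribˡ-+ (Λ d) _ _) (cong₂ _+_ (sym (S-* (y ÷ d) (Λ d) _)) (cong (Λ d *_) (ℓ-sum (y ÷ d) (≤-trans (÷≤ y d) y≤X)))))) ⟩
      S y (λ d → S (y ÷ d) (λ _ → Λ d * ℓ d) + Λ d * S (y ÷ d) (λ j → ψ (y ÷ d ÷ j)))
        ≡⟨ S-+ y _ _ ⟩
      S y (λ d → S (y ÷ d) (λ _ → Λ d * ℓ d)) + S y (λ d → Λ d * S (y ÷ d) (λ j → ψ (y ÷ d ÷ j)))
        ≡⟨ cong₂ _+_ (hyp-swap y (λ d _ → Λ d * ℓ d)) second ⟩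
      S y (λ k → S (y ÷ k) (λ d → Λ d * ℓ d)) + S y (λ j → S (y ÷ j) (λ d → Λ d * ψ (y ÷ j ÷ d)))
        ≡⟨ sym (S-+ y _ _) ⟩
      S y (λ k → S₂ (y ÷ k)) ∎
      where
      open ≡-Reasoning
      second : S y (λ d → Λ d * S (y ÷ d) (λ j → ψ (y ÷ d ÷ j))) ≡ S y (λ j → S (y ÷ j) (λ d → Λ d * ψ (y ÷ j ÷ d)))
      second = trans (S-ext y λ d → sym (S-* (y ÷ d) (Λ d) _)) (trans (hyp-swap y (λ d j → Λ d * ψ (y ÷ d ÷ j)))
        (S-cong y λ j 1≤j _ → S-cong (y ÷ j) λ d 1≤d _ → cong (λ z → Λ d * ψ z) (÷-swap y d j 1≤d 1≤j)))

    -- For n = d k, ℓ n = ℓ d + ℓ k, and both parts have the same sum by symmetry.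
    τℓ-sum : ∀ y → y ℕ.≤ X → S y (λ n → τ n * ℓ n) ≡ + 2 * S y (λ k → S (y ÷ k) ℓ)
    τℓ-sum y y≤X = begin
      S y (λ n → τ n * ℓ n)
        ≡⟨ S-ext y (λ n → trans (ℤP.*-comm (τ n) (ℓ n)) (trans (sym (S-* X (ℓ n) _)) (S-ext X λ d → l1 (ℓ n) (ι (d ∣? n))))) ⟩
      S y (λ n → S X (λ d → ι (d ∣? n) * ℓ n))
        ≡⟨ S-swap y X _ ⟩
      S X (λ d → S y (λ n → ι (d ∣? n) * ℓ n))
        ≡⟨ S-cong X (λ d 1≤d _ → dsum y d ℓ 1≤d) ⟩
      S X (λ d → S (y ÷ d) (λ k → ℓ (d ℕ.* k)))
        ≡⟨ S-shrink _ y≤X (λ d y<d → cong (λ z → S z (λ k → ℓ (d ℕ.* k))) (÷-big y<d)) ⟩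
      S y (λ d → S (y ÷ d) (λ k → ℓ (d ℕ.* k)))
        ≡⟨ S-cong y (λ d 1≤d _ → trans (S-cong (y ÷ d) λ k q r → ℓ-dk y d k y≤X 1≤d q r) (S-+ (y ÷ d) _ _)) ⟩
      S y (λ d → S (y ÷ d) (λ _ → ℓ d) + S (y ÷ d) ℓ)
        ≡⟨ S-+ y _ _ ⟩
      S y (λ d → S (y ÷ d) (λ _ → ℓ d)) + S y (λ k → S (y ÷ k) ℓ)
        ≡⟨ cong (_+ S y (λ k → S (y ÷ k) ℓ)) (hyp-swap y (λ d _ → ℓ d)) ⟩
      S y (λ k → S (y ÷ k) ℓ) + S y (λ k → S (y ÷ k) ℓ)
        ≡⟨ l2 _ ⟩
      + 2 * S y (λ k → S (y ÷ k) ℓ) ∎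
      where
      open ≡-Reasoning
      l1 : ∀ l i → l * (i * + 1) ≡ i * l
      l1 = solve-∀
      l2 : ∀ a → a + a ≡ + 2 * a
      l2 = solve-∀

    Hs≡ : ∀ z → 1 ℕ.≤ z → Hs z ≡ (+ 2 * M * S z ℓ - + 2 * g * M * + z) + + 4 * (g * g)
    Hs≡ z 1≤z = trans (S-+ z _ _) (cong₂ _+_ (trans (S-- z _ _) (cong₂ _-_ (S-* z (+ 2 * M) ℓ) (trans (S-const z (+ 2 * g * M)) (ℤP.*-comm (+ z) _))))
      (trans (S-* z (+ 4 * (g * g)) _) (trans (cong (+ 4 * (g * g) *_) (trans (S-ext z λ n → sym (ℤP.*-identityʳ (ι (n ℕ.≟ 1)))) (S-δ z 1 (λ _ → + 1) ≤-refl 1≤z))) (ℤP.*-identityʳ _))))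

    -- ℓ² = wt·f + (1 ∗ h), where only the first summand is not a divisor sum.
    P-E : ∀ y → y ℕ.≤ X → P y ≡ E y + S y (λ k → Hs (y ÷ k))
    P-E y y≤X = begin
      P y
        ≡⟨ S-ext y (λ n → pt (ℓ n) (τ n) M g) ⟩
      S y (λ n → wt n * f n + ((M * (τ n * ℓ n) - + 2 * g * M * τ n) + + 4 * (g * g)))
        ≡⟨ trans (S-+ y _ _) (cong (_+_ (E y)) (trans (S-+ y _ _) (cong₂ _+_ (trans (S-- y _ _) (cong₂ _-_ (trans (S-* y M _) (cong (M *_) (τℓ-sum y y≤X))) (trans (S-* y (+ 2 * g * M) τ) (cong (+ 2 * g * M *_) (τ-sum y y≤X))))) (S-const y (+ 4 * (g * g)))))) ⟩
      E y + ((M * (+ 2 * S y (λ k → S (y ÷ k) ℓ)) - + 2 * g * M * S y (λ k → + (y ÷ k))) + + y * (+ 4 * (g * g)))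
        ≡⟨ cong (_+_ (E y)) (sym hs) ⟩
      E y + S y (λ k → Hs (y ÷ k)) ∎
      where
      open ≡-Reasoning
      pt : ∀ l t M g → l * l ≡ (l - + 2 * g) * (l - M * t + + 2 * g) + ((M * (t * l) - + 2 * g * M * t) + + 4 * (g * g))
      pt = solve-∀
      rr : ∀ M a → + 2 * M * a ≡ M * (+ 2 * a)
      rr = solve-∀
      hs : S y (λ k → Hs (y ÷ k)) ≡ (M * (+ 2 * S y (λ k → S (y ÷ k) ℓ)) - + 2 * g * M * S y (λ k → + (y ÷ k))) + + y * (+ 4 * (g * g))
      hs = trans (S-cong y λ k 1≤k k≤y → Hs≡ (y ÷ k) (÷← 1≤k (subst (ℕ._≤ y) (sym (*-identityʳ k)) k≤y)))
        (trans (S-+ y _ _) (cong₂ _+_ (trans (S-- y _ _) (cong₂ _-_ (trans (S-* y (+ 2 * M) _) (rr M (S y (λ k → S (y ÷ k) ℓ)))) (S-* y (+ 2 * g * M) _))) (S-const y (+ 4 * (g * g)))))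

    R-sum : ∀ y → y ℕ.≤ X → S y (λ k → R (y ÷ k)) ≡ E y
    R-sum y y≤X = trans (S-- y _ _) (trans (cong (_- S y (λ k → Hs (y ÷ k))) (trans (sym (P-S₂ y y≤X)) (P-E y y≤X))) (lem (E y) _))
      where
      lem : ∀ a b → a + b - b ≡ a
      lem = solve-∀

    err : ℕ → ℕ → ℤ
    err t x = M * (+ x * H x) + M * M * + errC t * + x

    -- Summing the bound of `E-bound` over x ÷ k multiplies its leading term by H x and so brings it
    -- to the order of the main term 2 M u (H x). This is why `E-bound` is proved with an
    -- arbitrarily large t.
    R-bound : ∀ t x → 1 ℕ.≤ x → x ℕ.≤ X → Abs (+ t * R x) (err t x)
    R-bound t x 1≤x x≤X = Abs-≤ {+ t * R x} (Inversion.inversion (λ y → + t * R y) B B≥0 X hE x 1≤x x≤X) sumB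
      where
      B : ℕ → ℤ
      B y = M * M * (+ y + + errC t)
      B≥0 : ∀ y → + 0 ≤ B y
      B≥0 y = M≥0 ⊗ M≥0 ⊗ (pos y ⊕ pos (errC t))
      hE : ∀ y → 1 ℕ.≤ y → y ℕ.≤ X → Abs (S y (λ k → + t * R (y ÷ k))) (B y)
      hE y p q = subst (λ z → Abs z (B y)) (sym (trans (S-* y (+ t) _) (cong (+ t *_) (R-sum y q)))) (E-bound t y p q)
      lem : ∀ M a c x → M * M * (a + x * c) ≡ M * (M * a) + M * M * c * x
      lem = solve-∀
      sumB : S x (λ k → B (x ÷ k)) ≤ err t x
      sumB = subst (_≤ err t x) (sym (trans (S-* x (M * M) _) (trans (cong (M * M *_) (trans (S-+ x _ _) (cong (_+_ (S x (λ k → + (x ÷ k)))) (S-const x (+ errC t))))) (lem M (S x (λ k → + (x ÷ k))) (+ errC t) (+ x)))))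
        (ℤP.+-monoˡ-≤ (M * M * + errC t * + x) (ℤP.*-monoˡ-≤-nonNeg M {{ℤ.nonNegative M≥0}} (subst₂ _≤_ (S-* x M _) (S-* x (+ x) rc) (S-mono x λ k p q → floor-hi x k p (≤-trans q x≤X)))))

    module Short (x x' : ℕ) (1≤x : 1 ℕ.≤ x) (x≤x' : x ℕ.≤ x') (x'≤2x : x' ℕ.≤ 2 ℕ.* x) (x'≤X : x' ℕ.≤ X) where
      x≤X : x ℕ.≤ X
      x≤X = ≤-trans x≤x' x'≤X

      u : ℤ
      u = + x' - + x

      u≥0 : + 0 ≤ u
      u≥0 = nn (toℤ x≤x')

      u≤x : u ≤ + x
      u≤x = al (+ x) (+ x') (subst (+ x' ≤_) (*-ab 2 x) (toℤ x'≤2x))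
        where
        al : ∀ x x' → x' ≤ + 2 * x → x' - x ≤ x
        al x x' p = by (nn p) (solve (x ∷ x' ∷ []))

      Hx' : H x' ≤ H x + M
      Hx' = al (H x) (H x') u (rc x) (+ x) M (Sd-≤ (rc x) x≤x' λ i a b → rc-anti x i 1≤x (<⇒≤ a) (≤-trans b x'≤X)) u≤x (rc≥0 x 1≤x x≤X) (rc-spec x 1≤x x≤X)
        where
        al : ∀ h h' u r x M → h' - h ≤ u * r → u ≤ x → + 0 ≤ r → x * r ≡ M → h' ≤ h + M
        al h h' u r x _ a b c refl = by (nn a ⊕ nn b ⊗ c) (solve (h ∷ h' ∷ u ∷ r ∷ x ∷ []))

      ℓ-ge : ∀ i → x ℕ.< i → i ℕ.≤ x' → H x - + 3 * M ≤ ℓ i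
      ℓ-ge i a b = al (H x) (H i) g M (rc i) (ℓ i) (H-mono (<⇒≤ a) i≤X) (ℓ-lo i 1≤i i≤X) g≤M (rc≤M i 1≤i i≤X)
        where
        i≤X = ≤-trans b x'≤X
        1≤i = ≤-trans (s≤s z≤n) a
        al : ∀ h hi g M r l → h ≤ hi → hi - g ≤ l + + 2 * r → g ≤ M → r ≤ M → h - + 3 * M ≤ l
        al h hi g M r l a b c d = by (nn a ⊕ nn b ⊕ nn c ⊕ pos 2 ⊗ nn d) (solve (h ∷ hi ∷ g ∷ M ∷ r ∷ l ∷ []))

      h-gt1 : ∀ i → x ℕ.< i → h i ≡ + 2 * M * ℓ i - + 2 * g * M
      h-gt1 i a = trans (cong (λ z → + 2 * M * ℓ i - + 2 * g * M + + 4 * (g * g) * z) (ι-no (i ℕ.≟ 1) λ { refl → <⇒≱ a 1≤x })) (lem (+ 2 * M * ℓ i - + 2 * g * M) (+ 4 * (g * g)))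
        where
        lem : ∀ a b → a + b * + 0 ≡ a
        lem = solve-∀

      dH-abs : Abs ((Hs x' - Hs x) - + 2 * M * u * H x) (+ 8 * (M * M * u))
      dH-abs = lo (Hs x' - Hs x) M u (H x) (Sd-≥ (+ 2 * M * (H x - + 3 * M) - + 2 * M * M) x≤x' λ i a b → subst (_ ≤_) (sym (h-gt1 i a)) (term-lo (H x) M g (ℓ i) (ℓ-ge i a b) g≤M M≥0))
             , hi (Hs x' - Hs x) M u (H x) u≥0 M≥0 (Sd-≤ (+ 2 * M * (H x + M)) x≤x' λ i a b → subst (_≤ + 2 * M * (H x + M)) (sym (h-gt1 i a)) (term-hi (H x) (H i) (H x') M g (ℓ i) (ℓ-hi i (≤-trans (s≤s z≤n) a) (≤-trans b x'≤X)) (H-mono b x'≤X) Hx' g≥0 M≥0))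
        where
        term-lo : ∀ h M g l → h - + 3 * M ≤ l → g ≤ M → + 0 ≤ M → + 2 * M * (h - + 3 * M) - + 2 * M * M ≤ + 2 * M * l - + 2 * g * M
        term-lo h M g l a b c = by (pos 2 ⊗ c ⊗ nn a ⊕ pos 2 ⊗ c ⊗ nn b) (solve (h ∷ M ∷ g ∷ l ∷ []))
        term-hi : ∀ h hi h' M g l → l ≤ hi - g → hi ≤ h' → h' ≤ h + M → + 0 ≤ g → + 0 ≤ M → + 2 * M * l - + 2 * g * M ≤ + 2 * M * (h + M)
        term-hi h hi h' M g l a b c d e = by (pos 2 ⊗ e ⊗ (nn a ⊕ nn b ⊕ nn c ⊕ pos 2 ⊗ d)) (solve (h ∷ hi ∷ h' ∷ M ∷ g ∷ l ∷ []))
        lo : ∀ d M u h → u * (+ 2 * M * (h - + 3 * M) - + 2 * M * M) ≤ d → - (+ 8 * (M * M * u)) ≤ d - + 2 * M * u * h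
        lo d M u h a = by (nn a) (solve (d ∷ M ∷ u ∷ h ∷ []))
        hi : ∀ d M u h → + 0 ≤ u → + 0 ≤ M → d ≤ u * (+ 2 * M * (h + M)) → d - + 2 * M * u * h ≤ + 8 * (M * M * u)
        hi d M u h b c a = by (nn a ⊕ pos 6 ⊗ (c ⊗ c ⊗ b)) (solve (d ∷ M ∷ u ∷ h ∷ []))

      selberg : ∀ t → Abs (+ t * ((S₂ x' - S₂ x) - + 2 * M * u * H x)) (+ 3 * (+ x * (M * H x)) + + selC t * (M * M * + x))
      selberg t = subst (λ z → Abs z bound) (l (+ t) (S₂ x') (S₂ x) (Hs x') (Hs x) (+ 2 * M * u * H x))
        (Abs-≤ {+ t * R x' - + t * R x + + t * (dH - + 2 * M * u * H x)}
          (Abs-+ {+ t * R x' - + t * R x} {err t x' + err t x} {+ t * (dH - + 2 * M * u * H x)} {+ t * (+ 8 * (M * M * u))}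
            (Abs-- {+ t * R x'} {err t x'} {+ t * R x} (R-bound t x' (≤-trans 1≤x x≤x') x'≤X) (R-bound t x 1≤x x≤X))
            (Abs-* {+ t} {+ t} {dH - + 2 * M * u * H x} {+ 8 * (M * M * u)} (Abs-nn (pos t)) dH-abs))
          (sel-arith (+ t) M (+ x) (+ x') u (H x) (H x') (+ errC t) (+ selC t) Hx' (subst (+ x' ≤_) (*-ab 2 x) (toℤ x'≤2x)) u≤x
            (trans (+-ab (8 ℕ.* t ℕ.+ 2) (3 ℕ.* errC t)) (cong₂ _+_ (trans (+-ab (8 ℕ.* t) 2) (cong (_+ + 2) (*-ab 8 t))) (*-ab 3 (errC t))))
            M≥0 (pos t) (pos x') (H≥0 x≤X) (pos (errC t))))
        where
        dH bound : ℤ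
        dH = Hs x' - Hs x
        bound = + 3 * (+ x * (M * H x)) + + selC t * (M * M * + x)
        l : ∀ t s' s h' h c → t * (s' - h') - t * (s - h) + t * ((h' - h) - c) ≡ t * ((s' - s) - c)
        l = solve-∀

      second-mono : S x (λ a → Λ a * ψ (x ÷ a)) ≤ S x' (λ a → Λ a * ψ (x' ÷ a))
      second-mono = ℤP.≤-trans (S-mono x λ a _ _ → ℤP.*-monoˡ-≤-nonNeg (Λ a) {{ℤ.nonNegative (Λ≥0 a)}} (ψ-mono (÷-monoˡ a x≤x'))) (S-mono-n x≤x' λ a _ _ → Λ≥0 a ⊗ ψ≥0 (x' ÷ a))

      -- A Brun-Titchmarsh bound from Selberg's formula: the second sum of `S₂` can only grow, and
      -- in the first ℓ is at least H x - 3 M throughout (x, x'].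
      brun : ∀ t → + brunC t * M ≤ H x → + t * (ψ x' - ψ x) ≤ M * (+ 2 * + t * u + + 4 * + x)
      brun t hH = brun-arith (+ t) M (+ x) u (H x) (+ selC t) (ψ x' - ψ x) (S₂ x' - S₂ x)
        (subst (_≤ + 3 * (+ x * (M * H x)) + + selC t * (M * M * + x)) (dis (+ t) (S₂ x' - S₂ x) (+ 2 * M * u * H x)) (proj₂ (selberg t)))
        low (subst (λ z → z * M ≤ H x) (trans (+-ab (selC t ℕ.+ 6 ℕ.* t) 12) (cong (_+ + 12) (trans (+-ab (selC t) (6 ℕ.* t)) (cong (_+_ (+ selC t)) (*-ab 6 t))))) hH) u≤x (pos (selC t)) 0<M (pos t) (pos x)
        where
        dis : ∀ t a b → t * (a - b) ≡ t * a - t * b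
        dis = solve-∀
        c : ℤ
        c = H x - + 3 * M
        low : (ψ x' - ψ x) * c ≤ S₂ x' - S₂ x
        low = fin (ψ x' - ψ x) c (S x (λ n → Λ n * ℓ n)) (S x' (λ n → Λ n * ℓ n)) (S x (λ a → Λ a * ψ (x ÷ a))) (S x' (λ a → Λ a * ψ (x' ÷ a)))
          (subst (_≤ S x' (λ n → Λ n * ℓ n) - S x (λ n → Λ n * ℓ n)) (trans (cong₂ _-_ (S-* x' c Λ) (S-* x c Λ)) (l0 c (ψ x') (ψ x)))
            (Sd-mono x≤x' λ i a b → subst (_≤ Λ i * ℓ i) (ℤP.*-comm (Λ i) c) (ℤP.*-monoˡ-≤-nonNeg (Λ i) {{ℤ.nonNegative (Λ≥0 i)}} (ℓ-ge i a b)))) second-mono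
          where
          l0 : ∀ c a b → c * a - c * b ≡ (a - b) * c
          l0 = solve-∀
          fin : ∀ d c a a' b b' → d * c ≤ a' - a → b ≤ b' → d * c ≤ (a' + b') - (a + b)
          fin d c a a' b b' p q = by (nn p ⊕ nn q) (solve (d ∷ c ∷ a ∷ a' ∷ b ∷ b' ∷ []))

    -- Chebyshev and Mertens

    H-double : ∀ a → 1 ℕ.≤ a → 2 ℕ.* a ℕ.≤ X → M ≤ + 2 * (H (2 ℕ.* a) - H a)
    H-double a 1≤a h = al (+ a) (rc (2 ℕ.* a)) (H (2 ℕ.* a) - H a) M
      (subst (λ z → (z - + a) * rc (2 ℕ.* a) ≤ H (2 ℕ.* a) - H a) (*-ab 2 a) (Sd-≥ (rc (2 ℕ.* a)) a≤ λ i p q → rc-anti i (2 ℕ.* a) (≤-trans (s≤s z≤n) p) q h))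
      (trans (cong (_* rc (2 ℕ.* a)) (sym (*-ab 2 a))) (rc-spec (2 ℕ.* a) (≤-trans 1≤a a≤) h))
      where
      a≤ : a ℕ.≤ 2 ℕ.* a
      a≤ = m≤m+n a (a ℕ.+ 0)
      al : ∀ a r d M → (+ 2 * a - a) * r ≤ d → + 2 * a * r ≡ M → M ≤ + 2 * d
      al a r d _ p refl = by (pos 2 ⊗ nn p) (solve (a ∷ r ∷ d ∷ []))

    H-pow : ∀ j a → 1 ℕ.≤ a → 2 ℕ.^ j ℕ.* a ℕ.≤ X → + j * M ≤ + 2 * (H (2 ℕ.^ j ℕ.* a) - H a)
    H-pow zero a 1≤a h = ℤP.≤-reflexive (trans (ℤP.*-zeroˡ M) (sym (trans (cong (λ z → + 2 * (H z - H a)) (*-identityˡ a)) (trans (cong (+ 2 *_) (ℤP.+-inverseʳ (H a))) (ℤP.*-zeroʳ (+ 2))))))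
    H-pow (suc j) a 1≤a h = subst (λ z → + suc j * M ≤ + 2 * (H z - H a)) (sym eq)
      (al (+ j) (+ suc j) M (H (2 ℕ.* b)) (H b) (H a) (+-ab 1 j) (H-pow j a 1≤a (≤-trans (m≤m+n b (b ℕ.+ 0)) h')) (H-double b (*-mono-≤ (pow≥1 j (s≤s z≤n)) 1≤a) h'))
      where
      b = 2 ℕ.^ j ℕ.* a
      eq : 2 ℕ.^ suc j ℕ.* a ≡ 2 ℕ.* b
      eq = *-assoc 2 (2 ℕ.^ j) a
      h' : 2 ℕ.* b ℕ.≤ X
      h' = subst (ℕ._≤ X) eq h
      al : ∀ j j' M h2 h1 h0 → j' ≡ + 1 + j → j * M ≤ + 2 * (h1 - h0) → M ≤ + 2 * (h2 - h1) → j' * M ≤ + 2 * (h2 - h0)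
      al j _ M h2 h1 h0 refl p q = by (nn p ⊕ nn q) (solve (j ∷ M ∷ h2 ∷ h1 ∷ h0 ∷ []))

    H-large : ∀ k x → 2 ℕ.^ (2 ℕ.* k) ℕ.≤ x → x ℕ.≤ X → + k * M ≤ H x
    H-large k x p q = ℤP.≤-trans (cancel-≤ (+ 2) (+<+ (s≤s z≤n)) (al (+ k) M (H (2 ℕ.^ (2 ℕ.* k) ℕ.* 1)) (H 1) (+ (2 ℕ.* k)) (*-ab 2 k) (H-pow (2 ℕ.* k) 1 ≤-refl (subst (ℕ._≤ X) (sym (*-identityʳ _)) (≤-trans p q))) (H≥0 (≤-trans (pow≥1 (2 ℕ.* k) (s≤s z≤n)) (≤-trans p q)))))
        (subst (λ z → H z ≤ H x) (sym (*-identityʳ (2 ℕ.^ (2 ℕ.* k)))) (H-mono p q))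
      where
      al : ∀ k M h h1 k2 → k2 ≡ + 2 * k → k2 * M ≤ + 2 * (h - h1) → + 0 ≤ h1 → + 2 * (k * M) ≤ + 2 * h
      al k M h h1 _ refl a b = by (nn a ⊕ pos 2 ⊗ b) (solve (k ∷ M ∷ h ∷ h1 ∷ []))

    H-ratio : ∀ k a b → 1 ℕ.≤ a → b ℕ.≤ k ℕ.* a → b ℕ.≤ X → a ℕ.≤ X → H b - H a ≤ + k * M
    H-ratio k a b 1≤a b≤ b≤X a≤X with ≤-total a b
    ... | inj₂ b≤a = ℤP.≤-trans (ℤP.i≤j⇒i-j≤0 (H-mono b≤a a≤X)) (pos k ⊗ M≥0)
    ... | inj₁ a≤b = al (H b - H a) (+ a) (+ b) (+ k) (rc a) M (Sd-≤ (rc a) a≤b λ i p q → rc-anti a i 1≤a (<⇒≤ p) (≤-trans q b≤X)) (subst (+ b ≤_) (*-ab k a) (toℤ b≤)) (rc≥0 a 1≤a a≤X) (rc-spec a 1≤a a≤X) M≥0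
      where
      al : ∀ d a b k r M → d ≤ (b - a) * r → b ≤ k * a → + 0 ≤ r → a * r ≡ M → + 0 ≤ M → d ≤ k * M
      al d a b k r _ p q r≥0 refl m≥0 = by (nn p ⊕ nn q ⊗ r≥0 ⊕ m≥0) (solve (d ∷ a ∷ b ∷ k ∷ r ∷ []))

    H-log : ∀ k x → x ℕ.< 2 ℕ.^ k → x ℕ.≤ X → H x ≤ + k * M
    H-log zero zero _ _ = ℤP.≤-refl
    H-log zero (suc x) (s≤s ()) _
    H-log (suc k) x h x≤X with suc (x ÷ 2) ℕ.≤? X
    -- Here x ≤ X ≤ x ÷ 2, so x = X = 0.
    ... | no ¬p = ℤP.≤-trans (H-mono (≤-trans x≤X (≤-pred (≰⇒> ¬p))) y≤X) (ℤP.≤-trans ih (ℤP.*-monoʳ-≤-nonNeg M {{ℤ.nonNegative M≥0}} (toℤ {k} {suc k} (n≤1+n k))))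
      where
      y≤X = ≤-trans (÷≤ x 2) x≤X
      ih : H (x ÷ 2) ≤ + k * M
      ih = H-log k (x ÷ 2) (≰⇒> λ p → <⇒≱ h (÷→ {x} {2} (s≤s z≤n) p)) y≤X
    ... | yes p = al (H x) (H y) (+ x) (+ y) (rc (suc y)) (+ suc y) (+ k) (+ suc k) M
        (Sd-≤ (rc (suc y)) (÷≤ x 2) λ i u v → rc-anti (suc y) i (s≤s z≤n) u (≤-trans v x≤X))
        (subst (+ x ≤_) (+-ab (suc y) y) (toℤ (proj₂ (half-spec x)))) (rc≥0 (suc y) (s≤s z≤n) p) (rc-spec (suc y) (s≤s z≤n) p)
        (+-ab 1 k) (H-log k y (≰⇒> λ p → <⇒≱ h (÷→ {x} {2} (s≤s z≤n) p)) (≤-trans (÷≤ x 2) x≤X))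
      where
      y = x ÷ 2
      al : ∀ h hy xx yy r y' k k' M → h - hy ≤ (xx - yy) * r → xx ≤ y' + yy → + 0 ≤ r → y' * r ≡ M → k' ≡ + 1 + k → hy ≤ k * M → h ≤ k' * M
      al h hy xx yy r y' k _ _ a b r≥0 refl refl e = by (nn a ⊕ nn b ⊗ r≥0 ⊕ nn e) (solve (h ∷ hy ∷ xx ∷ yy ∷ r ∷ y' ∷ k ∷ []))

    brunAt : ∀ t a b → threshold t ℕ.≤ a → a ℕ.≤ b → b ℕ.≤ 2 ℕ.* a → b ℕ.≤ X → + t * (ψ b - ψ a) ≤ M * (+ 2 * + t * (+ b - + a) + + 4 * + a)
    brunAt t a b h p q r = Short.brun a b (≤-trans (threshold≥1 t) h) p q r t (H-large (brunC t) a (≤-trans (threshold≥ t) h) (≤-trans p r))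

    ψ≤ℓ-sum : ∀ y → y ℕ.≤ X → ψ y ≤ S y ℓ
    ψ≤ℓ-sum zero _ = ℤP.≤-refl
    ψ≤ℓ-sum y@(suc _) y≤X = subst₂ _≤_ (cong ψ (÷1 y)) (sym (ℓ-sum y y≤X)) (S-≥first y {λ j → ψ (y ÷ j)} (s≤s z≤n) λ i → ψ≥0 (y ÷ i))

    -- Induction from y - ⌊y/2⌋ to y by `brunAt` with t = 1, which admits intervals up to twice
    -- their left end. Below 2 `threshold 1` the trivial bound ψ y ≤ Σ ℓ is used.
    chebyshev : ∀ y → y ℕ.≤ X → ψ y ≤ + cheb * M * + y
    chebyshev = <-rec (λ y → y ℕ.≤ X → ψ y ≤ + cheb * M * + y) go
      where
      go : ∀ y → (∀ {z} → z ℕ.< y → z ℕ.≤ X → ψ z ≤ + cheb * M * + z) → y ℕ.≤ X → ψ y ≤ + cheb * M * + y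
      go y ih y≤X with 2 ℕ.* threshold 1 ℕ.≤? y
      ... | no ¬p = ℤP.≤-trans (ψ≤ℓ-sum y y≤X) (subst (S y ℓ ≤_) (trans (S-const y (+ cheb * M)) (ℤP.*-comm (+ y) (+ cheb * M)))
          (S-mono y λ i a b → al (ℓ i) (H i) g M (+ i) (+ cheb) (ℓ-hi i a (≤-trans b y≤X)) (H≤ i (≤-trans b y≤X)) g≥0 (toℤ (≤-trans b (≤-trans (<⇒≤ (≰⇒> ¬p)) (≤-trans (m≤n+m _ 12) cheb≥)))) M≥0))
        where
        al : ∀ l h g M i A → l ≤ h - g → h ≤ i * M → + 0 ≤ g → i ≤ A → + 0 ≤ M → l ≤ A * M
        al l h g M i A a b c d e = by (nn a ⊕ nn b ⊕ c ⊕ nn d ⊗ e) (solve (l ∷ h ∷ g ∷ M ∷ i ∷ A ∷ []))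
      ... | yes p = ℤP.≤-trans (split (ψ y) (ψ z) (+ cheb * M * + z) (M * (+ 2 * + 1 * (+ y - + z) + + 4 * + z)) (ih z<y z≤X) (subst (_≤ M * (+ 2 * + 1 * (+ y - + z) + + 4 * + z)) (ℤP.*-identityˡ (ψ y - ψ z)) (brunAt 1 z y thr z≤y y≤2z y≤X)))
          (cheb-arith (+ cheb) M (+ y) (+ z) (+ a) (trans (cong +_ (sym z+a)) (+-ab z a)) (subst (+ y ≤_) (trans (+-ab 1 (a ℕ.+ a)) (cong (_+_ (+ 1)) (+-ab a a))) (toℤ (proj₂ (half-spec y)))) (toℤ 1≤a) (toℤ (≤-trans (m≤m+n 12 (2 ℕ.* threshold 1)) cheb≥)) M≥0)
        where
        a = y ÷ 2
        z = y ℕ.∸ a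
        z+a : z ℕ.+ a ≡ y
        z+a = m∸n+n≡m (÷≤ y 2)
        1≤t : 1 ℕ.≤ threshold 1
        1≤t = threshold≥1 1
        1≤a : 1 ℕ.≤ a
        1≤a = ≤-trans 1≤t (÷← {y} {2} (s≤s z≤n) p)
        a≤z : a ℕ.≤ z
        a≤z = +-cancelʳ-≤ a a z (≤-trans (proj₁ (half-spec y)) (≤-reflexive (sym z+a)))
        thr : threshold 1 ℕ.≤ z
        thr = ≤-trans (÷← {y} {2} (s≤s z≤n) p) a≤z
        z≤y : z ℕ.≤ y
        z≤y = m∸n≤m y a
        z≤X = ≤-trans z≤y y≤X
        z<y : z ℕ.< y
        z<y = subst (z ℕ.<_) z+a (m<m+n z 1≤a)
        y≤2z : y ℕ.≤ 2 ℕ.* z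
        y≤2z = ≤-trans (≤-reflexive (sym z+a)) (+-monoʳ-≤ z (≤-trans a≤z (≤-reflexive (sym (+-identityʳ z)))))
        split : ∀ p q a b → q ≤ a → p - q ≤ b → p ≤ a + b
        split p q a b c d = by (nn c ⊕ nn d) (solve (p ∷ q ∷ a ∷ b ∷ []))

    G : ℕ → ℤ
    G x = S x (λ d → Λ d * rc d)

    ℓ-sum-÷ : ∀ x → x ℕ.≤ X → S x ℓ ≡ S x (λ d → Λ d * + (x ÷ d))
    ℓ-sum-÷ x x≤X = trans (S-ext x λ n → sym (ℤP.*-identityʳ (ℓ n))) (trans (ℓ-weight x (λ _ → + 1) x≤X) (S-ext x λ d → cong (Λ d *_) (S-1 (x ÷ d))))

    -- Σ ℓ is the sum of Λ d (x ÷ d). Replacing x ÷ d by x/d costs at most ψ x, which `chebyshev`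
    -- bounds.
    mertens-hi : ∀ x → 1 ℕ.≤ x → x ℕ.≤ X → G x ≤ M * H x + + cheb * (M * M)
    mertens-hi x 1≤x x≤X = cancel-≤ (+ x) (+<+ 1≤x) (al (+ x) (G x) M (S x ℓ) (ψ x) (H x) g (+ cheb) s1 (ℓ-sum-hi x x≤X) (chebyshev x x≤X) (H≤ x x≤X) g≥0 M≥0 (pos x))
      where
      l1 : ∀ a b c → a * (b * c) ≡ b * (a * c)
      l1 = solve-∀
      l2 : ∀ l m q → l * (m * (q + + 1)) ≡ m * (l * q) + m * l
      l2 = solve-∀
      s1 : + x * G x ≤ M * S x ℓ + M * ψ x
      s1 = subst₂ _≤_ (S-* x (+ x) _) (trans (S-ext x λ d → l2 (Λ d) M (+ (x ÷ d))) (trans (S-+ x _ _) (cong₂ _+_ (trans (S-* x M _) (cong (M *_) (sym (ℓ-sum-÷ x x≤X)))) (S-* x M Λ))))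
        (S-mono x λ d p q → subst (_≤ Λ d * (M * (+ (x ÷ d) + + 1))) (l1 (Λ d) (+ x) (rc d)) (ℤP.*-monoˡ-≤-nonNeg (Λ d) {{ℤ.nonNegative (Λ≥0 d)}} (floor-lo x d p (≤-trans q x≤X))))
      al : ∀ x G M s p H g A → x * G ≤ M * s + M * p → s ≤ ((+ 1 + x) * H - x * M) - x * g → p ≤ A * M * x → H ≤ x * M → + 0 ≤ g → + 0 ≤ M → + 0 ≤ x → x * G ≤ x * (M * H + A * (M * M))
      al x G M s p H g A a b c d e m x≥0 = by (nn a ⊕ m ⊗ nn b ⊕ m ⊗ nn c ⊕ m ⊗ nn d ⊕ m ⊗ (x≥0 ⊗ e)) (solve (x ∷ G ∷ M ∷ s ∷ p ∷ H ∷ g ∷ A ∷ []))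

    mertens-lo : ∀ x → 1 ℕ.≤ x → x ℕ.≤ X → M * H x ≤ G x + + 3 * (M * M)
    mertens-lo x 1≤x x≤X = cancel-≤ (+ x) (+<+ 1≤x) (al (+ x) (G x) M (S x ℓ) (H x) g s1 (ℓ-sum-lo x x≤X) (H≤ x x≤X) g≤M M≥0 (pos x))
      where
      l1 : ∀ a b c → a * (b * c) ≡ b * (a * c)
      l1 = solve-∀
      s1 : M * S x ℓ ≤ + x * G x
      s1 = subst₂ _≤_ (trans (S-* x M _) (cong (M *_) (sym (ℓ-sum-÷ x x≤X)))) (S-* x (+ x) _)
        (S-mono x λ d p q → subst₂ _≤_ (l1 (Λ d) M (+ (x ÷ d))) (l1 (Λ d) (+ x) (rc d)) (ℤP.*-monoˡ-≤-nonNeg (Λ d) {{ℤ.nonNegative (Λ≥0 d)}} (floor-hi x d p (≤-trans q x≤X))))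
      al : ∀ x G M s H g → M * s ≤ x * G → ((+ 1 + x) * H - x * M) - x * g ≤ s + + 2 * H → H ≤ x * M → g ≤ M → + 0 ≤ M → + 0 ≤ x → x * (M * H) ≤ x * (G + + 3 * (M * M))
      al x G M s H g a b c d m x≥0 = by (nn a ⊕ m ⊗ nn b ⊕ m ⊗ nn c ⊕ m ⊗ (x≥0 ⊗ nn d)) (solve (x ∷ G ∷ M ∷ s ∷ H ∷ g ∷ []))

    -- Primes in short intervals

    module Deficit (q θ t x x₁ : ℕ) (sc : Scale q θ t x x₁ X) where
      open Scale sc

      x' : ℕ
      x' = x ℕ.+ x ÷ q

      u : ℤ
      u = + (x ÷ q)

      x'≡ : + x' ≡ + x + u
      x'≡ = +-ab x (x ÷ q)

      1≤q : 1 ℕ.≤ q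
      1≤q = ≤-trans (s≤s z≤n) 16≤q

      16u≤x : + 16 * u ≤ + x
      16u≤x = ℤP.≤-trans (ℤP.*-monoʳ-≤-nonNeg u (toℤ 16≤q)) (÷ℤ x q 1≤q)

      t>0 : + 0 < + t
      t>0 = subst (+ 0 <_) (sym t-def) (ℤP.<-≤-trans (+<+ (s≤s {0} {0} z≤n)) (al (+ q) (+ θ) (toℤ 1≤q) (pos θ)))
        where
        al : ∀ q θ → + 1 ≤ q → + 0 ≤ θ → + 1 ≤ + 32 * q * (+ 2 * θ + + 12)
        al q θ a b = by (pos 64 ⊗ ((ℤP.≤-trans (pos 1) a) ⊗ b) ⊕ pos 384 ⊗ nn a ⊕ pos 383) (solve (q ∷ θ ∷ []))

      1≤x₁ : 1 ℕ.≤ x₁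
      1≤x₁ = ≤-trans (threshold≥1 t) thr

      -- `Def d` is t times the amount by which the mass of (x/d, x'/d] falls short of twice the
      -- expected weight, with 5 x/d added to make it nonnegative. `F` weights it by Λ because
      -- Selberg's formula does so.
      Def F : ℕ → ℤ
      Def d = (+ 2 * + t * u + + 5 * + x) * rc d - + t * (ψ (x' ÷ d) - ψ (x ÷ d))
      F n = S n (λ d → Λ d * Def d)

      Good : ℕ → Set
      Good d = Def d ≤ + θ * (+ x * rc d)

      x≤X : x ℕ.≤ X
      x≤X = ≤-trans (m≤m+n x (x ÷ q)) x'≤X

      32q>0 : + 0 < + 32 * + q
      32q>0 = ℤP.<-≤-trans (+<+ (s≤s {0} {0} z≤n)) (ql (+ q) (toℤ 1≤q))
        where
        ql : ∀ q → + 1 ≤ q → + 1 ≤ + 32 * q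
        ql q p = by (pos 32 ⊗ nn p ⊕ pos 31) (solve (q ∷ []))

      -- Otherwise each term Λ m Def m of F b - F a would be at least θ x Λ m rc m, and their sum at
      -- least V.
      pigeon : ∀ a b V → a ℕ.≤ b → F b - F a < V → V ≤ + θ * + x * (G b - G a) → ∃[ m ] (a ℕ.< m × m ℕ.≤ b × Good m)
      pigeon a b V a≤b hF hV = conclude (Sd-find {a} {b} {λ m → Λ m * Def m} {λ m → Λ m * (+ θ * (+ x * rc m))} a≤b (subst (F b - F a <_) (sym eqG) (ℤP.<-≤-trans hF hV)))
        where
        l : ∀ a b c d → a * (b * (c * d)) ≡ b * c * (a * d)
        l = solve-∀
        l2 : ∀ c a b → c * a - c * b ≡ c * (a - b)
        l2 = solve-∀
        eqG : S b (λ m → Λ m * (+ θ * (+ x * rc m))) - S a (λ m → Λ m * (+ θ * (+ x * rc m))) ≡ + θ * + x * (G b - G a)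
        eqG = trans (cong₂ _-_ (trans (S-ext b λ m → l (Λ m) (+ θ) (+ x) (rc m)) (S-* b (+ θ * + x) _)) (trans (S-ext a λ m → l (Λ m) (+ θ) (+ x) (rc m)) (S-* a (+ θ * + x) _))) (l2 (+ θ * + x) (G b) (G a))
        good-m : ∀ m → Λ m * Def m < Λ m * (+ θ * (+ x * rc m)) → (Def m ≤ + θ * (+ x * rc m)) ⊎ (+ θ * (+ x * rc m) < Def m) → Good m
        good-m m l (inj₁ g) = g
        good-m m l (inj₂ g) = ⊥-elim (<-irr l (ℤP.*-monoˡ-≤-nonNeg (Λ m) {{ℤ.nonNegative (Λ≥0 m)}} (ℤP.<⇒≤ g)))
        conclude : ∃[ m ] (a ℕ.< m × m ℕ.≤ b × Λ m * Def m < Λ m * (+ θ * (+ x * rc m))) → ∃[ m ] (a ℕ.< m × m ℕ.≤ b × Good m)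
        conclude (m , p , r , l) = m , p , r , good-m m l (≤-case (Def m) (+ θ * (+ x * rc m)))

      module At (d : ℕ) (1≤d : 1 ℕ.≤ d) (d≤ : x₁ ℕ.* d ℕ.≤ x) where
        -- `w`, about an eighth of the length x/(q d) of (I, J], is the width of the windows
        -- searched for good numbers: narrow enough to fix their position, wide enough to carry
        -- mass.
        I J w : ℕ
        I = x ÷ d
        J = x' ÷ d
        w = I ÷ (8 ℕ.* q)

        d≤x : d ℕ.≤ x
        d≤x = ≤-trans (m≤n*m d x₁ {{ℕ.>-nonZero 1≤x₁}}) d≤

        d≤X : d ℕ.≤ X
        d≤X = ≤-trans d≤x x≤X

        x₁≤I : x₁ ℕ.≤ I
        x₁≤I = ÷← 1≤d (subst (ℕ._≤ x) (*-comm x₁ d) d≤)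

        1≤I : 1 ℕ.≤ I
        1≤I = ≤-trans 1≤x₁ x₁≤I

        I≤J : I ℕ.≤ J
        I≤J = ÷-monoˡ d (m≤m+n x (x ÷ q))

        J≤2I : J ℕ.≤ 2 ℕ.* I
        J≤2I with J ℕ.≤? 2 ℕ.* I
        ... | yes p = p
        ... | no ¬p = ⊥-elim (J-arith (+ d) (+ x) u (+ I) (+ J) (subst (+ d * + J ≤_) x'≡ (÷ℤ x' d 1≤d)) (÷ℤ< x d 1≤d) 16u≤x
              (subst (_≤ + J) (trans (+-ab 1 (2 ℕ.* I)) (trans (ℤP.+-comm (+ 1) (+ (2 ℕ.* I))) (cong (_+ + 1) (*-ab 2 I)))) (toℤ (≰⇒> ¬p))) (toℤ 1≤I) (pos d))

        J≤X : J ℕ.≤ X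
        J≤X = ≤-trans (÷≤ x' d) x'≤X

        MI : M * + I ≤ + x * rc d
        MI = floor-hi x d 1≤d d≤X

        xr : + x * rc d ≤ M * (+ I + + 1)
        xr = floor-lo x d 1≤d d≤X

        MJ : M * + J ≤ (+ x + u) * rc d
        MJ = subst (λ z → M * + J ≤ z * rc d) x'≡ (floor-hi x' d 1≤d d≤X)

        x'r : (+ x + u) * rc d ≤ M * (+ J + + 1)
        x'r = subst (λ z → z * rc d ≤ M * (+ J + + 1)) x'≡ (floor-lo x' d 1≤d d≤X)

        xr≥0 : + 0 ≤ + x * rc d
        xr≥0 = pos x ⊗ rc≥0 d 1≤d d≤X

        thrI : threshold t ℕ.≤ I
        thrI = ≤-trans thr x₁≤I

        64q≤I : + 64 * + q ≤ + I
        64q≤I = subst (_≤ + I) (*-ab 64 q) (toℤ (≤-trans 64q≤ x₁≤I))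

        -- Of the 5 x in `Def`, 4 x is the error of `brunAt`. The fifth, worth x rc d ≥ M I, absorbs
        -- the rounding loss 2 t M, since 2 t ≤ x₁ ≤ I.
        Def≥0 : + 0 ≤ Def d
        Def≥0 = al (+ t) M (+ x) u (rc d) (+ I) (+ J) (ψ J - ψ I) (brunAt t I J thrI I≤J J≤2I J≤X) MJ xr MI (subst (_≤ + I) (*-ab 2 t) (toℤ (≤-trans 2t≤ x₁≤I))) M≥0 (pos t)
          where
          al : ∀ t M x u r I J dp → t * dp ≤ M * (+ 2 * t * (J - I) + + 4 * I) → M * J ≤ (x + u) * r → x * r ≤ M * (I + + 1) → M * I ≤ x * r → + 2 * t ≤ I → + 0 ≤ M → + 0 ≤ t →
            + 0 ≤ (+ 2 * t * u + + 5 * x) * r - t * dp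
          al t M x u r I J dp a b c d e m≥0 t≥0 = subst (+ 0 ≤_) (lem t M x u r I J dp) (nn a ⊕ pos 2 ⊗ (t≥0 ⊗ nn b) ⊕ pos 2 ⊗ (t≥0 ⊗ nn c) ⊕ pos 5 ⊗ nn d ⊕ m≥0 ⊗ nn e)
            where
            lem : ∀ t M x u r I J dp → (M * (+ 2 * t * (J - I) + + 4 * I) - t * dp) + + 2 * (t * ((x + u) * r - M * J)) + + 2 * (t * (M * (I + + 1) - x * r)) + + 5 * (x * r - M * I) + M * (I - + 2 * t)
              ≡ (+ 2 * t * u + + 5 * x) * r - t * dp
            lem = solve-∀

        8qw : + 8 * + q * + w ≤ + I
        8qw = subst (λ z → z * + w ≤ + I) (*-ab 8 q) (÷ℤ I (8 ℕ.* q) (*-mono-≤ {1} {8} (s≤s z≤n) 1≤q))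

        16qw : + I ≤ + 16 * + q * + w
        16qw = al (+ q) (+ I) (+ w) (subst (λ z → + I + + 1 ≤ z * (+ w + + 1)) (*-ab 8 q) (÷ℤ< I (8 ℕ.* q) (*-mono-≤ {1} {8} (s≤s z≤n) 1≤q))) 64q≤I (toℤ 1≤w) (pos q)
          where
          1≤w : 1 ℕ.≤ w
          1≤w = ÷← (*-mono-≤ {1} {8} (s≤s z≤n) 1≤q) (≤-trans (≤-reflexive (*-identityʳ (8 ℕ.* q))) (≤-trans (*-monoˡ-≤ q (m≤m+n 8 56)) (≤-trans 64q≤ x₁≤I)))
          al : ∀ q I w → I + + 1 ≤ + 8 * q * (w + + 1) → + 64 * q ≤ I → + 1 ≤ w → + 0 ≤ q → I ≤ + 16 * q * w
          al q I w a b c d = by (nn a ⊕ pos 8 ⊗ (d ⊗ nn c) ⊕ pos 1) (solve (q ∷ I ∷ w ∷ []))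

        I+w≤J : I ℕ.+ w ℕ.≤ J
        I+w≤J = ÷← 1≤d (≤-trans (≤-reflexive (*-distribˡ-+ d I w)) (+-mono-≤ (÷→ 1≤d ≤-refl) (÷← 1≤q
          (fromℤ (subst (_≤ + x) (sym (trans (*-ab q (d ℕ.* w)) (cong (+ q *_) (*-ab d w)))) (al (+ q) (+ d) (+ w) (+ I) (+ x) 8qw (÷ℤ x d 1≤d) (pos q ⊗ pos d ⊗ pos w) (pos d)))))))
          where
          al : ∀ q d w I x → + 8 * q * w ≤ I → d * I ≤ x → + 0 ≤ q * d * w → + 0 ≤ d → q * (d * w) ≤ x
          al q d w I x a b c e = by (e ⊗ nn a ⊕ nn b ⊕ pos 7 ⊗ c) (solve (q ∷ d ∷ w ∷ I ∷ x ∷ []))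

        module _ (good : Good d) (a b : ℕ) (I≤a : I ℕ.≤ a) (a≤b : a ℕ.≤ b) (b≤J : b ℕ.≤ J) where

          b≤2I : b ℕ.≤ 2 ℕ.* I
          b≤2I = ≤-trans b≤J J≤2I

          -- (I, J] carries nearly double density, while `brunAt` allows (I, a] and (b, J] little
          -- more than double; the difference is left for (a, b].
          sub-mass : + 2 * + t * M * (+ b - + a) - + 2 * + t * M - + θ * M * (+ I + + 1) - + 12 * M * + I ≤ + t * (ψ b - ψ a)
          sub-mass = sub-mass-arith (+ t) M (+ θ) (+ x) u (rc d) (+ I) (+ J) (+ a) (+ b) (ψ I) (ψ a) (ψ b) (ψ J) good
            (brunAt t I a thrI I≤a (≤-trans a≤b b≤2I) (≤-trans a≤b (≤-trans b≤J J≤X)))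
            (brunAt t b J (≤-trans thrI (≤-trans I≤a a≤b)) b≤J (≤-trans J≤2I (*-monoʳ-≤ 2 (≤-trans I≤a a≤b))) J≤X)
            MJ xr MI x'r (subst (+ b ≤_) (*-ab 2 I) (toℤ b≤2I)) M≥0 (pos t) (pos θ) xr≥0

          window-mass : + I ≤ + 16 * + q * (+ b - + a) → M * (+ b - + a) ≤ ψ b - ψ a
          window-mass h = window-arith (+ t) M (+ θ) (+ q) (+ I) (+ b - + a) (ψ b - ψ a) t-def sub-mass h 64q≤I (toℤ 1≤q) (pos θ) M≥0 t>0

          long-mass : + I ≤ + 2 * + q * (+ b - + a) → + 15 * (M * (+ b - + a)) ≤ + 8 * (ψ b - ψ a)
          long-mass h = long-arith (+ t) M (+ θ) (+ q) (+ I) (+ b - + a) (ψ b - ψ a) t-def sub-mass h 64q≤I (toℤ 1≤q) (pos θ) M≥0 t>0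

          1≤b : 1 ℕ.≤ b
          1≤b = ≤-trans 1≤I (≤-trans I≤a a≤b)

          b≤X : b ℕ.≤ X
          b≤X = ≤-trans b≤J J≤X

          G-mass : rc b * (ψ b - ψ a) ≤ G b - G a
          G-mass = subst (_≤ G b - G a) (trans (cong₂ _-_ (S-* b (rc b) Λ) (S-* a (rc b) Λ)) (sym (l (rc b) (ψ b) (ψ a))))
            (Sd-mono a≤b λ i p r → subst (_≤ Λ i * rc i) (ℤP.*-comm (Λ i) (rc b)) (ℤP.*-monoˡ-≤-nonNeg (Λ i) {{ℤ.nonNegative (Λ≥0 i)}} (rc-anti i b (≤-trans (s≤s z≤n) p) r b≤X)))
            where
            l : ∀ c a b → c * (a - b) ≡ c * a - c * b
            l = solve-∀

          -- By `window-mass` and b ≤ 2 I the window contributes at least M (b - a) M/b ≥ M²/(32 q)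
          -- to G, and 32 q V ≤ θ x M².
          find-good : ∀ V → + I ≤ + 16 * + q * (+ b - + a) → F b - F a < V → + 32 * + q * V ≤ + θ * + x * (M * M) → ∃[ m ] (a ℕ.< m × m ℕ.≤ b × Good m)
          find-good V h hF hV = pigeon a b V a≤b hF (cancel-≤ (+ 32 * + q) 32q>0
              (find-arith (+ q) (+ θ * + x) M (+ I) (+ b) (+ b - + a) (rc b) (ψ b - ψ a) (G b - G a) V (window-mass h) h (subst (+ b ≤_) (*-ab 2 I) (toℤ b≤2I)) (rc-spec b 1≤b b≤X) G-mass hV (rc≥0 b 1≤b b≤X) M≥0 (pos θ ⊗ pos x) (pos q)))

      F-mono : ∀ {a b} → a ℕ.≤ b → x₁ ℕ.* b ℕ.≤ x → F a ≤ F b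
      F-mono {a} {b} p h = S-mono-n p λ d u v → Λ≥0 d ⊗ At.Def≥0 d u (≤-trans (*-monoʳ-≤ x₁ v) h)

      F-sub : ∀ {a b c d} → a ℕ.≤ b → b ℕ.≤ c → c ℕ.≤ d → x₁ ℕ.* d ℕ.≤ x → F c - F b ≤ F d - F a
      F-sub p r s h = ℤP.+-mono-≤ (F-mono s h) (ℤP.neg-mono-≤ (F-mono p (≤-trans (*-monoʳ-≤ x₁ (≤-trans r s)) h)))

      module Run (D R : ℕ) (V : ℤ) (x₁≤D : x₁ ℕ.≤ D) (hR : x₁ ℕ.* (R ℕ.* D) ℕ.≤ x) where

        1≤D : 1 ℕ.≤ D
        1≤D = ≤-trans 1≤x₁ x₁≤D

        Advance : ℕ → Set
        Advance d = ∃[ d' ] (Good d' × d ℕ.< d' × d' ℕ.≤ 2 ℕ.* d × + 3 * M * (H d' - H d) ≤ + 2 * (G d' - G d))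

        module Steps (Fa : F (R ℕ.* D) - F D < V) (Fb : F (x ÷ D) - F (x ÷ (R ℕ.* D)) < V) (hV : + 32 * + q * V ≤ + θ * + x * (M * M)) where

          -- From a good d to a good m slightly above x/d, and from m back to a good d' slightly above d.
          module Step (d : ℕ) (good : Good d) (2D≤d : 2 ℕ.* D ℕ.≤ d) (2d≤ : 2 ℕ.* d ℕ.≤ R ℕ.* D) where
            D≤d : D ℕ.≤ d
            D≤d = ≤-trans (m≤m+n D (D ℕ.+ 0)) 2D≤d

            1≤d : 1 ℕ.≤ d
            1≤d = ≤-trans 1≤D D≤d

            d≤RD : d ℕ.≤ R ℕ.* D
            d≤RD = ≤-trans (m≤m+n d (d ℕ.+ 0)) 2d≤

            module Ad = At d 1≤d (≤-trans (*-monoʳ-≤ x₁ d≤RD) hR)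

            w≤I : Ad.w ℕ.≤ Ad.I
            w≤I = ÷≤ Ad.I (8 ℕ.* q)

            D[I+w]≤x : D ℕ.* (Ad.I ℕ.+ Ad.w) ℕ.≤ x
            D[I+w]≤x = ≤-trans (*-monoʳ-≤ D (+-monoʳ-≤ Ad.I w≤I)) (≤-trans (≤-reflexive (sw D Ad.I)) (≤-trans (*-monoˡ-≤ Ad.I 2D≤d) (÷→ {x} {d} 1≤d ≤-refl)))
              where
              sw : ∀ D I → D ℕ.* (I ℕ.+ I) ≡ 2 ℕ.* D ℕ.* I
              sw = solveℕ

            I+w≤ : Ad.I ℕ.+ Ad.w ℕ.≤ x ÷ D
            I+w≤ = ÷← 1≤D D[I+w]≤x

            x₁[x÷D]≤x : x₁ ℕ.* (x ÷ D) ℕ.≤ x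
            x₁[x÷D]≤x = ≤-trans (*-monoˡ-≤ (x ÷ D) x₁≤D) (÷→ {x} {D} 1≤D ≤-refl)

            width : + (Ad.I ℕ.+ Ad.w) - + Ad.I ≡ + Ad.w
            width = trans (cong (_- + Ad.I) (+-ab Ad.I Ad.w)) (lem (+ Ad.I) (+ Ad.w))
              where
              lem : ∀ a b → a + b - a ≡ b
              lem = solve-∀

            -- The window lies at the left end of (I, J], so that x/m stays close to d.
            dual : ∃[ m ] (Ad.I ℕ.< m × m ℕ.≤ Ad.I ℕ.+ Ad.w × Good m)
            dual = Ad.find-good good Ad.I (Ad.I ℕ.+ Ad.w) ≤-refl (m≤m+n Ad.I Ad.w) Ad.I+w≤J V (subst (λ z → + Ad.I ≤ + 16 * + q * z) (sym width) Ad.16qw)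
              (ℤP.≤-<-trans (F-sub {x ÷ (R ℕ.* D)} {Ad.I} {Ad.I ℕ.+ Ad.w} {x ÷ D} (÷-monoʳ x 1≤d d≤RD) (m≤m+n Ad.I Ad.w) I+w≤ x₁[x÷D]≤x) Fb) hV

            module Dual (m : ℕ) (I<m : Ad.I ℕ.< m) (m≤ : m ℕ.≤ Ad.I ℕ.+ Ad.w) (good-m : Good m) where
              1≤m : 1 ℕ.≤ m
              1≤m = ≤-trans (s≤s z≤n) I<m

              mD≤x : m ℕ.* D ℕ.≤ x
              mD≤x = ≤-trans (*-monoˡ-≤ D m≤) (≤-trans (≤-reflexive (*-comm (Ad.I ℕ.+ Ad.w) D)) D[I+w]≤x)

              module Bm = At m 1≤m (≤-trans (*-monoˡ-≤ m x₁≤D) (≤-trans (≤-reflexive (*-comm D m)) mD≤x))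

              z z' w' : ℕ
              z = Bm.I
              z' = Bm.J
              w' = Bm.w

              z<d : z ℕ.< d
              z<d = ≰⇒> λ d≤z → <⇒≱ (÷< {x} {d} 1≤d) (≤-trans (*-monoʳ-≤ d I<m) (≤-trans (≤-reflexive (*-comm d m)) (÷→ {x} {m} 1≤m d≤z)))

              w'≤z' : w' ℕ.≤ z'
              w'≤z' = ≤-trans (m≤n+m w' z) Bm.I+w≤J

              z≤ : z ℕ.≤ z' ℕ.∸ w'
              z≤ = ≤-trans (≤-reflexive (sym (m+n∸n≡m z w'))) (∸-monoˡ-≤ w' Bm.I+w≤J)

              ∸≡ : + (z' ℕ.∸ w') ≡ + z' - + w'
              ∸≡ = trans (sym (ℤP.⊖-≥ w'≤z')) (sym (ℤP.m-n≡m⊖n z' w'))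

              z'≤2d : z' ℕ.≤ 2 ℕ.* d
              z'≤2d = ≤-trans Bm.J≤2I (*-monoʳ-≤ 2 (<⇒≤ z<d))

              width' : + z' - + (z' ℕ.∸ w') ≡ + w'
              width' = trans (cong (λ y → + z' - y) ∸≡) (lem (+ z') (+ w'))
                where
                lem : ∀ a b → a - (a - b) ≡ b
                lem = solve-∀

              -- The window lies at the right end of (z, z'], so that the step from d to d' covers
              -- most of that interval.
              next : ∃[ d' ] (z' ℕ.∸ w' ℕ.< d' × d' ℕ.≤ z' × Good d')
              next = Bm.find-good good-m (z' ℕ.∸ w') z' z≤ (m∸n≤m z' w') ≤-refl V (subst (λ y → + z ≤ + 16 * + q * y) (sym width') Bm.16qw)
                (ℤP.≤-<-trans (F-sub {D} {z' ℕ.∸ w'} {z'} {R ℕ.* D} (≤-trans (÷← 1≤m mD≤x) z≤) (m∸n≤m z' w') (≤-trans z'≤2d 2d≤) hR) Fa) hV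

              finish : ∀ d' → z' ℕ.∸ w' ℕ.< d' → d' ℕ.≤ z' → Good d' → Advance d
              finish d' lo hi good-d' = d' , good-d' , d<d' , ≤-trans hi z'≤2d ,
                step-arith M (+ d' - + d) (rc d) (rc d') (H d' - H d) (G d' - G d) (ψ d' - ψ d)
                  (Sd-≤ (rc d) d≤d' λ i p r → rc-anti d i 1≤d (<⇒≤ p) (≤-trans r d'≤X))
                  -- As z < d < d' ≤ z', the stretch (d, d'] lies inside the interval attached to
                  -- the good number m, and nearly double density applies to it.
                  (Bm.G-mass good-m d d' (<⇒≤ z<d) d≤d' hi)
                  (Bm.long-mass good-m d d' (<⇒≤ z<d) d≤d' hi k3)
                  (rc-ratio (+ d) (+ d') (rc d) (rc d') M k4 (rc-spec d 1≤d Ad.d≤X) (rc-spec d' 1≤d' d'≤X) (+<+ 1≤d) (rc≥0 d' 1≤d' d'≤X))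
                  M≥0 (nn (toℤ d≤d')) (rc≥0 d' 1≤d' d'≤X)
                where
                d'≤X = ≤-trans hi Bm.J≤X
                1≤d' = ≤-trans (s≤s z≤n) lo
                m≤ℤ : + m ≤ + Ad.I + + Ad.w
                m≤ℤ = subst (+ m ≤_) (+-ab Ad.I Ad.w) (toℤ m≤)
                k1 : + 8 * + q * + d + + 1 ≤ (+ 8 * + q + + 1) * (+ z + + 1)
                k1 = K1-arith (+ q) (+ d) (+ m) (+ z) (+ Ad.I) (+ Ad.w) (+ x) m≤ℤ Ad.8qw (÷ℤ x d 1≤d) (÷ℤ< x m 1≤m) (pos d) (pos q) (pos m)
                k2 : + q * + z + + z + + 1 ≤ + q * (+ z' + + 1)
                k2 = K2-arith (+ q) (+ m) (+ z) (+ z') (+ x) u (subst (λ y → y + + 1 ≤ + m * (+ z' + + 1)) x'≡ (÷ℤ< x' m 1≤m)) (÷ℤ x m 1≤m) (÷ℤ< x q 1≤q) (pos q) (pos m)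
                lo' : + z' - + w' + + 1 ≤ + d'
                lo' = subst (λ y → y + + 1 ≤ + d') ∸≡ (<⇒+1≤ (+<+ lo))
                k3 : + z ≤ + 2 * + q * (+ d' - + d)
                k3 = K3-arith (+ q) (+ d) (+ d') (+ z) (+ z') (+ w') k1 k2 lo' Bm.8qw Bm.64q≤I (pos q)
                k4 : + 4 * + d' ≤ + 5 * + d
                k4 = K4-arith (+ q) (+ d) (+ d') (+ m) (+ z) (+ z') (+ x) u (subst (+ m * + z' ≤_) x'≡ (÷ℤ x' m 1≤m)) (÷ℤ x q 1≤q) (÷ℤ< x m 1≤m) (<⇒+1≤ (+<+ z<d)) (toℤ hi) (toℤ 16≤q) (pos m) (pos d)
                d<d' : d ℕ.< d'
                d<d' = ≰⇒> λ d'≤d → neg-absurd (pos 2 ⊗ (pos q ⊗ nn (toℤ d'≤d)) ⊕ nn k3 ⊕ nn (toℤ Bm.1≤I)) (ℤP.≤-reflexive (lem (+ q) (+ d) (+ d') (+ z)))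
                  where
                  lem : ∀ q d d' z → + 2 * (q * (d - d')) + (+ 2 * q * (d' - d) - z) + (z - + 1) + + 1 ≡ + 0
                  lem = solve-∀
                d≤d' = <⇒≤ d<d'

              advance₂ : Advance d
              advance₂ = finish (proj₁ next) (proj₁ (proj₂ next)) (proj₁ (proj₂ (proj₂ next))) (proj₂ (proj₂ (proj₂ next)))

            advance₁ : Advance d
            advance₁ = Dual.advance₂ (proj₁ dual) (proj₁ (proj₂ dual)) (proj₁ (proj₂ (proj₂ dual))) (proj₂ (proj₂ (proj₂ dual)))

          Reach : ℕ → ℕ → Set
          Reach d₀ N = ∃[ d ] (N ℕ.< d × d ℕ.≤ 2 ℕ.* N × + 3 * M * (H d - H d₀) ≤ + 2 * (G d - G d₀))

          -- Each step raises d by at least 1, which keeps N < d + `fuel` while the fuel drops. A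
          -- step taken from d ≤ N ends at most at 2 N.
          chain : ∀ N → 2 ℕ.* N ℕ.≤ R ℕ.* D → ∀ d₀ fuel d → N ℕ.< d ℕ.+ fuel → Good d → 2 ℕ.* D ℕ.≤ d → d ℕ.≤ 2 ℕ.* N →
            + 3 * M * (H d - H d₀) ≤ + 2 * (G d - G d₀) → Reach d₀ N
          chain N hN d₀ zero d hf good 2D≤ d≤ inv = d , subst (N ℕ.<_) (+-identityʳ d) hf , d≤ , inv
          chain N hN d₀ (suc fuel) d hf good 2D≤ d≤ inv = go (N ℕ.<? d)
            where
            next : Advance d → d ℕ.≤ N → Reach d₀ N
            next (d' , good' , d<d' , d'≤ , adv) d≤N = chain N hN d₀ fuel d' (≤-trans (≤-trans hf (≤-reflexive (+-suc d fuel))) (+-monoˡ-≤ fuel d<d')) good' (≤-trans 2D≤ (<⇒≤ d<d')) (≤-trans d'≤ (*-monoʳ-≤ 2 d≤N))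
              (tr (+ 3 * M) (H d₀) (H d) (H d') (G d₀) (G d) (G d') inv adv)
              where
              tr : ∀ c h0 h h' g0 g g' → c * (h - h0) ≤ + 2 * (g - g0) → c * (h' - h) ≤ + 2 * (g' - g) → c * (h' - h0) ≤ + 2 * (g' - g0)
              tr c h0 h h' g0 g g' a b = by (nn a ⊕ nn b) (solve (c ∷ h0 ∷ h ∷ h' ∷ g0 ∷ g ∷ g' ∷ []))
            go : Dec (N ℕ.< d) → Reach d₀ N
            go (yes p) = d , p , d≤ , inv
            go (no ¬p) = next (Step.advance₁ d good 2D≤ (≤-trans (*-monoʳ-≤ 2 d≤N) hN)) d≤N
              where
              d≤N = ≮⇒≥ ¬p

          module Contradiction (R≡ : R ≡ 4 ℕ.* (R₁ ℕ.* R₂)) (V≥0 : + 0 ≤ V) where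

            -- The inner factor 2 keeps the chain above 2 D, as `Step` asks; `R₂` leaves room for
            -- the first good number and `R₁` for the growth. Overshooting is harmless up to 2 N = R
            -- D.
            N : ℕ
            N = R₁ ℕ.* (R₂ ℕ.* (2 ℕ.* D))

            2N≡ : 2 ℕ.* N ≡ R ℕ.* D
            2N≡ = trans (l R₁ R₂ D) (cong (ℕ._* D) (sym R≡))
              where
              l : ∀ a b c → 2 ℕ.* (a ℕ.* (b ℕ.* (2 ℕ.* c))) ≡ 4 ℕ.* (a ℕ.* b) ℕ.* c
              l = solveℕ

            RD≤x : R ℕ.* D ℕ.≤ x
            RD≤x = ≤-trans (m≤n*m (R ℕ.* D) x₁ {{ℕ.>-nonZero 1≤x₁}}) hR

            RD≤X = ≤-trans RD≤x x≤X

            N≤RD : N ℕ.≤ R ℕ.* D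
            N≤RD = ≤-trans (m≤m+n N (N ℕ.+ 0)) (≤-reflexive 2N≡)

            lo₀ hi₀ : ℕ
            lo₀ = 2 ℕ.* D
            hi₀ = R₂ ℕ.* (2 ℕ.* D)

            1≤lo₀ : 1 ℕ.≤ lo₀
            1≤lo₀ = ≤-trans 1≤D (m≤m+n D (D ℕ.+ 0))

            lo≤hi : lo₀ ℕ.≤ hi₀
            lo≤hi = m≤n*m lo₀ R₂ {{ℕ.>-nonZero R₂≥1}}

            hi≤N : hi₀ ℕ.≤ N
            hi≤N = m≤n*m hi₀ R₁ {{ℕ.>-nonZero R₁≥1}}

            hi≤X : hi₀ ℕ.≤ X
            hi≤X = ≤-trans hi≤N (≤-trans N≤RD RD≤X)

            jump : ∀ k a → 1 ℕ.≤ a → 2 ℕ.^ (2 ℕ.* k) ℕ.* a ℕ.≤ X → + k * M ≤ H (2 ℕ.^ (2 ℕ.* k) ℕ.* a) - H a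
            jump k a 1≤a h = cancel-≤ (+ 2) (+<+ (s≤s z≤n)) (subst (_≤ + 2 * (H (2 ℕ.^ (2 ℕ.* k) ℕ.* a) - H a)) (trans (cong (_* M) (*-ab 2 k)) (ℤP.*-assoc (+ 2) (+ k) M)) (H-pow (2 ℕ.* k) a 1≤a h))

            jump₂ : ∀ a → 1 ℕ.≤ a → R₂ ℕ.* a ℕ.≤ X → (+ cheb + + 4) * M ≤ H (R₂ ℕ.* a) - H a
            jump₂ a p h = subst₂ _≤_ (cong (_* M) (+-ab cheb 4)) (cong (λ r → H (r ℕ.* a) - H a) (sym R₂≡)) (jump (cheb ℕ.+ 4) a p (subst (λ r → r ℕ.* a ℕ.≤ X) R₂≡ h))

            jump₁ : ∀ a → 1 ℕ.≤ a → R₁ ℕ.* a ℕ.≤ X → (+ 2 * + cheb + + 7) * M ≤ H (R₁ ℕ.* a) - H a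
            jump₁ a p h = subst₂ _≤_ (cong (_* M) (trans (+-ab (2 ℕ.* cheb) 7) (cong (_+ + 7) (*-ab 2 cheb)))) (cong (λ r → H (r ℕ.* a) - H a) (sym R₁≡)) (jump (2 ℕ.* cheb ℕ.+ 7) a p (subst (λ r → r ℕ.* a ℕ.≤ X) R₁≡ h))

            start : ∃[ d ] (lo₀ ℕ.< d × d ℕ.≤ hi₀ × Good d)
            start = pigeon lo₀ hi₀ V lo≤hi (ℤP.≤-<-trans (F-sub {D} {lo₀} {hi₀} {R ℕ.* D} (m≤m+n D (D ℕ.+ 0)) lo≤hi (≤-trans hi≤N N≤RD) hR) Fa)
              (al (+ q) (+ θ * + x) M V (G hi₀) (G lo₀) (H hi₀) (H lo₀) (+ cheb) (mertens-lo hi₀ (≤-trans 1≤lo₀ lo≤hi) hi≤X) (mertens-hi lo₀ 1≤lo₀ (≤-trans lo≤hi hi≤X)) (jump₂ lo₀ 1≤lo₀ hi≤X) hV V≥0 (toℤ 1≤q) (pos θ ⊗ pos x) M≥0)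
              where
              al : ∀ q θx M V G1 G0 H1 H0 A → M * H1 ≤ G1 + + 3 * (M * M) → G0 ≤ M * H0 + A * (M * M) → (A + + 4) * M ≤ H1 - H0 → + 32 * q * V ≤ θx * (M * M) → + 0 ≤ V → + 1 ≤ q → + 0 ≤ θx → + 0 ≤ M → V ≤ θx * (G1 - G0)
              al q θx M V G1 G0 H1 H0 A a b c e V≥0 q≥1 θ≥0 m≥0 = by (nn e ⊕ θ≥0 ⊗ nn a ⊕ θ≥0 ⊗ nn b ⊕ θ≥0 ⊗ (m≥0 ⊗ nn c) ⊕ pos 32 ⊗ (nn q≥1 ⊗ V≥0) ⊕ pos 31 ⊗ V≥0) (solve (q ∷ θx ∷ M ∷ V ∷ G1 ∷ G0 ∷ H1 ∷ H0 ∷ A ∷ []))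

            -- Mertens lets G exceed the growth of M H by at most (`cheb` + 3) M². A growth of 3/2
            -- times that of M H is then possible only while H gains at most (2 `cheb` + 6) M, but
            -- from d₀ to beyond R₁ d₀ it gains more.
            absurd : ⊥
            absurd = end (proj₁ start) (proj₁ (proj₂ start)) (proj₁ (proj₂ (proj₂ start))) (proj₂ (proj₂ (proj₂ start)))
              where
              end : ∀ d₀ → lo₀ ℕ.< d₀ → d₀ ℕ.≤ hi₀ → Good d₀ → ⊥
              end d₀ lo< ≤hi good = fin (chain N (≤-reflexive 2N≡) d₀ N d₀ (m<n+m N 1≤d₀) good (<⇒≤ lo<) (≤-trans ≤hi (≤-trans hi≤N (m≤m+n N (N ℕ.+ 0)))) (ℤP.≤-reflexive (z (+ 3 * M) (H d₀) (G d₀))))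
                where
                1≤d₀ : 1 ℕ.≤ d₀
                1≤d₀ = ≤-trans 1≤lo₀ (<⇒≤ lo<)
                z : ∀ c h g → c * (h - h) ≡ + 2 * (g - g)
                z = solve-∀
                R₁d₀≤N : R₁ ℕ.* d₀ ℕ.≤ N
                R₁d₀≤N = *-monoʳ-≤ R₁ ≤hi
                fin : Reach d₀ N → ⊥
                fin (d , N<d , d≤2N , inv) = al M (H d) (H (R₁ ℕ.* d₀)) (H d₀) (G d) (G d₀) (+ cheb) inv (mertens-hi d (≤-trans (s≤s z≤n) N<d) d≤X) (mertens-lo d₀ 1≤d₀ (≤-trans ≤hi hi≤X))
                    (jump₁ d₀ 1≤d₀ (≤-trans R₁d₀≤N (≤-trans N≤RD RD≤X))) (H-mono (≤-trans R₁d₀≤N (<⇒≤ N<d)) d≤X) 0<M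
                  where
                  d≤X : d ℕ.≤ X
                  d≤X = ≤-trans d≤2N (≤-trans (≤-reflexive 2N≡) RD≤X)
                  al : ∀ M h h1 h0 g g0 A → + 3 * M * (h - h0) ≤ + 2 * (g - g0) → g ≤ M * h + A * (M * M) → M * h0 ≤ g0 + + 3 * (M * M) → (+ 2 * A + + 7) * M ≤ h1 - h0 → h1 ≤ h → + 0 < M → ⊥
                  al M h h1 h0 g g0 A a b c e f m>0 = neg-absurd (nn a ⊕ pos 2 ⊗ nn b ⊕ pos 2 ⊗ nn c ⊕ m≥0 ⊗ nn e ⊕ m≥0 ⊗ nn f ⊕ nn MM) (ℤP.≤-reflexive (lem M h h1 h0 g g0 A))
                    where
                    m≥0 = ℤP.<⇒≤ m>0
                    MM : + 1 ≤ M * M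
                    MM = by (nn (ℤP.i<j⇒suc[i]≤j m>0) ⊗ nn (ℤP.i<j⇒suc[i]≤j m>0) ⊕ pos 2 ⊗ nn (ℤP.i<j⇒suc[i]≤j m>0)) (solve (M ∷ []))
                    lem : ∀ M h h1 h0 g g0 A → (+ 2 * (g - g0) - + 3 * M * (h - h0)) + + 2 * (M * h + A * (M * M) - g) + + 2 * (g0 + + 3 * (M * M) - M * h0) + M * (h1 - h0 - (+ 2 * A + + 7) * M) + M * (h - h1) + (M * M - + 1) + + 1 ≡ + 0
                    lem = solve-∀

      module DeficitSum (np : ∀ n → x ℕ.< n → n ℕ.≤ x ℕ.+ x ÷ q → ¬ Prime n) (x₁≤x : x₁ ℕ.≤ x) where

        Y : ℕ
        Y = x ÷ x₁

        1≤Y : 1 ℕ.≤ Y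
        1≤Y = ÷← 1≤x₁ (subst (ℕ._≤ x) (sym (*-identityʳ x₁)) x₁≤x)

        Y≤x : Y ℕ.≤ x
        Y≤x = ÷≤ x x₁

        1≤x : 1 ℕ.≤ x
        1≤x = ≤-trans 1≤x₁ x₁≤x

        x≤x' : x ℕ.≤ x'
        x≤x' = m≤m+n x (x ÷ q)

        x'≤2x : x' ℕ.≤ 2 ℕ.* x
        x'≤2x = +-monoʳ-≤ x (≤-trans (÷≤ x q) (≤-reflexive (sym (+-identityʳ x))))

        u≡ : + x' - + x ≡ u
        u≡ = trans (cong (_- + x) x'≡) (lem (+ x) u)
          where
          lem : ∀ a b → a + b - a ≡ b
          lem = solve-∀

        mass : ℕ → ℤ
        mass d = ψ (x' ÷ d) - ψ (x ÷ d)

        PP Q : ℤ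
        PP = S x' (λ n → Λ n * ℓ n) - S x (λ n → Λ n * ℓ n)
        Q = S x' (λ d → Λ d * mass d)

        S₂-split : S₂ x' - S₂ x ≡ PP + Q
        S₂-split = trans (l (S x' (λ n → Λ n * ℓ n)) (S x' (λ a → Λ a * ψ (x' ÷ a))) (S x (λ n → Λ n * ℓ n)) (S x (λ a → Λ a * ψ (x ÷ a))))
          (cong (_+_ PP) (sym (trans (S-ext x' λ d → l2 (Λ d) (ψ (x' ÷ d)) (ψ (x ÷ d))) (trans (S-- x' _ _) (cong (λ z → S x' (λ a → Λ a * ψ (x' ÷ a)) - z) (S-shrink (λ a → Λ a * ψ (x ÷ a)) x≤x' λ d x<d → trans (cong (λ z → Λ d * ψ z) (÷-big x<d)) (ℤP.*-zeroʳ (Λ d))))))))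
          where
          l : ∀ a b c d → (a + b) - (c + d) ≡ (a - c) + (b - d)
          l = solve-∀
          l2 : ∀ a b c → a * (b - c) ≡ a * b - a * c
          l2 = solve-∀

        PP≤ : PP ≤ + 512 * (M * M * + x)
        PP≤ = ℤP.≤-trans (subst (PP ≤_) (trans (cong₂ _-_ (S-* x' (H x') Λ) (S-* x (H x') Λ)) (l (H x') (ψ x') (ψ x))) (Sd-mono x≤x' λ i p r → subst (Λ i * ℓ i ≤_) (ℤP.*-comm (Λ i) (H x')) (ℤP.*-monoˡ-≤-nonNeg (Λ i) {{ℤ.nonNegative (Λ≥0 i)}} (ℓ≤H i (≤-trans (s≤s z≤n) p) r))))
            (bound (isqrt x'))
          where
          l : ∀ c a b → c * a - c * b ≡ c * (a - b)
          l = solve-∀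
          ℓ≤H : ∀ i → 1 ℕ.≤ i → i ℕ.≤ x' → ℓ i ≤ H x'
          ℓ≤H i p r = al (ℓ i) (H i) (H x') g (ℓ-hi i p (≤-trans r x'≤X)) (H-mono r x'≤X) g≥0
            where
            al : ∀ l h h' g → l ≤ h - g → h ≤ h' → + 0 ≤ g → l ≤ h'
            al l h h' g a b c = by (nn a ⊕ nn b ⊕ c) (solve (l ∷ h ∷ h' ∷ g ∷ []))
          bound : ∃[ s ] (s ℕ.* s ℕ.≤ x' × x' ℕ.< suc s ℕ.* suc s) → H x' * (ψ x' - ψ x) ≤ + 512 * (M * M * + x)
          bound (s , lo , hi) = bound' (isqrt s)
            where
            module Sq = AtSquare x' s (≤-trans 1≤x x≤x') x'≤X lo hi
            bound' : ∃[ s' ] (s' ℕ.* s' ℕ.≤ s × s ℕ.< suc s' ℕ.* suc s') → H x' * (ψ x' - ψ x) ≤ + 512 * (M * M * + x)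
            bound' (s' , lo' , hi') = pp-arith M (H x') (H s) g (rc s) (+ s) (+ s') (+ x) (+ x') (ψ x' - ψ x) Sq.δ≤ Sq'.Hy≤6sM (rc≤M s Sq.1≤s Sq.s≤X) g≥0 (toℤ Sq'.1≤s) (subst (_≤ + s) (*-ab s' s') (toℤ lo')) Sq.lo' (subst (+ x' ≤_) (*-ab 2 x) (toℤ x'≤2x))
              (sparse x x' s (H x') x≤x' x'≤X hi Sq.s≤X (H≥0 x'≤X) ℓ≤H np) M≥0 (pos s) (H≥0 x'≤X)
              where
              module Sq' = AtSquare s s' Sq.1≤s Sq.s≤X lo' hi'

        -- For d > Y the scale x/d is below `x₁`, where `brunAt` is not guaranteed. Chebyshev bounds
        -- the mass instead; as x'/Y ≤ 4 x₁, Mertens keeps G x' - G Y within a constant times M².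
        tail-bound : Q - S Y (λ d → Λ d * mass d) ≤ + cheb * + x' * (G x' - G Y)
        tail-bound = subst (Q - S Y (λ d → Λ d * mass d) ≤_) (trans (cong₂ _-_ (S-* x' (+ cheb * + x') _) (S-* Y (+ cheb * + x') _)) (l (+ cheb * + x') (G x') (G Y)))
          (Sd-mono (≤-trans Y≤x x≤x') λ d p r → subst (Λ d * mass d ≤_) (l2 (Λ d) (+ cheb * + x') (rc d)) (ℤP.*-monoˡ-≤-nonNeg (Λ d) {{ℤ.nonNegative (Λ≥0 d)}}
            (al (ψ (x' ÷ d)) (ψ (x ÷ d)) (+ cheb) M (+ (x' ÷ d)) (+ x') (rc d) (chebyshev (x' ÷ d) (≤-trans (÷≤ x' d) x'≤X)) (ψ≥0 (x ÷ d)) (floor-hi x' d (≤-trans (s≤s z≤n) p) (≤-trans r x'≤X)) (pos cheb))))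
          where
          l : ∀ c a b → c * a - c * b ≡ c * (a - b)
          l = solve-∀
          l2 : ∀ a c r → a * (c * r) ≡ c * (a * r)
          l2 = solve-∀
          al : ∀ p p' A M J x' r → p ≤ A * M * J → + 0 ≤ p' → M * J ≤ x' * r → + 0 ≤ A → p - p' ≤ A * x' * r
          al p p' A M J x' r a b c d = by (nn a ⊕ b ⊕ d ⊗ nn c) (solve (p ∷ p' ∷ A ∷ M ∷ J ∷ x' ∷ r ∷ []))

        F-expand : F Y ≡ (+ 2 * + t * u + + 5 * + x) * G Y - + t * S Y (λ d → Λ d * mass d)
        F-expand = trans (S-ext Y λ d → l (Λ d) (+ 2 * + t * u + + 5 * + x) (rc d) (+ t) (mass d)) (trans (S-- Y _ _) (cong₂ _-_ (S-* Y (+ 2 * + t * u + + 5 * + x) _) (S-* Y (+ t) _)))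
          where
          l : ∀ a b r t m → a * (b * r - t * m) ≡ b * (a * r) - t * (a * m)
          l = solve-∀

        x'≤4x₁Y : x' ℕ.≤ 4 ℕ.* x₁ ℕ.* Y
        x'≤4x₁Y = ≤-trans x'≤2x (≤-trans (*-monoʳ-≤ 2 (≤-trans (<⇒≤ (÷< {x} {x₁} 1≤x₁)) (*-monoʳ-≤ x₁ (+-monoˡ-≤ Y 1≤Y)))) (≤-reflexive (l x₁ Y)))
          where
          l : ∀ a b → 2 ℕ.* (a ℕ.* (b ℕ.+ b)) ≡ 4 ℕ.* a ℕ.* b
          l = solveℕ

        -- Without primes in (x, x'] the first sum of `S₂` hardly grows, so Selberg's 2 M u (H x)
        -- must come from the masses at d, nearly all of it from d ≤ Y. By Mertens that is nearly
        -- the most that nonnegative deficits permit, so their weighted sum is small.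
        deficit-sum : F Y ≤ + 8 * (+ x * (M * H x)) + + deficit-const t x₁ * (M * M * + x)
        deficit-sum = W-arith (+ t) M (+ x) (+ x') u (H x) (+ cheb) (+ selC t) (+ x₁) (F Y) (G Y) (H Y) (H x') (G x') (S Y (λ d → Λ d * mass d)) Q (Q - S Y (λ d → Λ d * mass d)) PP (S₂ x' - S₂ x) (+ deficit-const t x₁)
          F-expand (l Q (S Y (λ d → Λ d * mass d))) S₂-split
          (subst (λ u → - (+ 3 * (+ x * (M * H x)) + + selC t * (M * M * + x)) ≤ + t * (S₂ x' - S₂ x - + 2 * M * u * H x)) u≡ (proj₁ (Short.selberg x x' 1≤x x≤x' x'≤2x x'≤X t)))
          PP≤ tail-bound (mertens-hi x' (≤-trans 1≤x x≤x') x'≤X) (mertens-lo Y 1≤Y Y≤X) (subst (λ k → H x' - H Y ≤ k * M) (*-ab 4 x₁) (H-ratio (4 ℕ.* x₁) Y x' 1≤Y x'≤4x₁Y x'≤X Y≤X))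
          (mertens-hi Y 1≤Y Y≤X) (H-mono Y≤x x≤X) (toℤ (÷≤ x q)) (subst (+ x' ≤_) (*-ab 2 x) (toℤ x'≤2x)) (deficit-constℤ t x₁) M≥0 (pos t) (pos x) (pos x') (pos (x ÷ q)) (pos cheb) (pos x₁)
          where
          Y≤X = ≤-trans Y≤x x≤X
          l : ∀ a b → a ≡ b + (a - b)
          l = solve-∀

        deficit-sum' : + deficit-const t x₁ * M ≤ H x → F Y ≤ + 9 * (+ x * (M * H x))
        deficit-sum' h = ℤP.≤-trans deficit-sum (al (+ x) M (H x) (+ deficit-const t x₁) h M≥0 (pos x))
          where
          al : ∀ x M H K → K * M ≤ H → + 0 ≤ M → + 0 ≤ x → + 8 * (x * (M * H)) + K * (M * M * x) ≤ + 9 * (x * (M * H))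
          al x M H K a b c = by (c ⊗ b ⊗ nn a) (solve (x ∷ M ∷ H ∷ K ∷ []))

        module Pigeonhole (R r₀ J Vc : ℕ) (2≤R : 2 ℕ.≤ R) (x₁≡ : x₁ ≡ R ℕ.^ r₀) (Vc≡ : Vc ≡ 36 ℕ.* R ℕ.+ 1) (lo : R ℕ.^ (2 ℕ.* r₀ ℕ.+ J) ℕ.≤ x) (hi : x ℕ.< R ℕ.^ suc (2 ℕ.* r₀ ℕ.+ J))
          (J≥ : suc (2 ℕ.* r₀) ℕ.≤ J) (hH : + deficit-const t x₁ * M ≤ H x) where

          1≤R : 1 ℕ.≤ R
          1≤R = ≤-trans (s≤s z≤n) 2≤R

          V : ℤ
          V = + Vc * + x * (M * M)

          -- Ends of blocks of ratio `R`, from N 0 = x₁ up to N J ≤ x/x₁; the dual points x ÷ N i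
          -- then stay below x/x₁ as well, where deficits are nonnegative.
          N : ℕ → ℕ
          N i = R ℕ.^ (r₀ ℕ.+ i)

          N≥1 : ∀ i → 1 ℕ.≤ N i
          N≥1 i = pow≥1 (r₀ ℕ.+ i) 1≤R

          N-mono : ∀ {i j} → i ℕ.≤ j → N i ℕ.≤ N j
          N-mono p = ^-monoʳ-≤ R {{ℕ.>-nonZero 1≤R}} (+-monoʳ-≤ r₀ p)

          x₁≤N : ∀ i → x₁ ℕ.≤ N i
          x₁≤N i = ≤-trans (≤-reflexive (trans x₁≡ (cong (R ℕ.^_) (sym (+-identityʳ r₀))))) (N-mono z≤n)

          top : x₁ ℕ.* N J ℕ.≤ x
          top = subst (ℕ._≤ x) (trans (cong (R ℕ.^_) (l r₀ J)) (trans (^-distribˡ-+-* R r₀ (r₀ ℕ.+ J)) (cong (ℕ._* N J) (sym x₁≡)))) lo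
            where
            l : ∀ r J → 2 ℕ.* r ℕ.+ J ≡ r ℕ.+ (r ℕ.+ J)
            l = solveℕ

          dualOK : ∀ i → x₁ ℕ.* (x ÷ N i) ℕ.≤ x
          dualOK i = ≤-trans (*-monoˡ-≤ (x ÷ N i) (x₁≤N i)) (÷→ {x} {N i} (N≥1 i) ≤-refl)

          YOK : x₁ ℕ.* Y ℕ.≤ x
          YOK = ÷→ {x} {x₁} 1≤x₁ ≤-refl

          A B : ℕ → ℤ
          A i = F (N i)
          B i = - F (x ÷ N i)

          -- The deficits in a block (N (i − 1), N i] and in its dual (x / N i, x / N (i − 1)].
          run : ℕ → ℤ
          run i = (A i - A (i ℕ.∸ 1)) + (B i - B (i ℕ.∸ 1))

          F≥0 : ∀ {a} → x₁ ℕ.* a ℕ.≤ x → + 0 ≤ F a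
          F≥0 {a} h = F-mono {0} {a} z≤n h

          total : S J run ≤ + 2 * F Y
          total = subst (_≤ + 2 * F Y) (sym (trans (S-+ J _ _) (cong₂ _+_ (S-telescope J A) (S-telescope J B))))
            (al (F (N J)) (F (N 0)) (F (x ÷ N J)) (F (x ÷ N 0)) (F Y) (F-mono {N J} {Y} (÷← 1≤x₁ top) YOK) (F≥0 (≤-trans (*-monoʳ-≤ x₁ (N-mono {0} {J} z≤n)) top)) (F≥0 (dualOK J)) (F-mono {x ÷ N 0} {Y} (÷-monoʳ x 1≤x₁ (x₁≤N 0)) YOK))
            where
            al : ∀ a b c d f → a ≤ f → + 0 ≤ b → + 0 ≤ c → d ≤ f → (a - b) + (- c - - d) ≤ + 2 * f
            al a b c d f p q r s = by (nn p ⊕ q ⊕ r ⊕ nn s) (solve (a ∷ b ∷ c ∷ d ∷ f ∷ []))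

          -- From R ≤ 2^R follows R^k ≤ 2^(R k), and 2 r₀ + 1 ≤ J bounds the exponent by 2 J. A
          -- constant depending on `R` is harmless, because `R` is fixed before `Vc`.
          Hx≤ : H x ≤ + 2 * + R * + J * M
          Hx≤ = ℤP.≤-trans (H-log (R ℕ.* suc (2 ℕ.* r₀ ℕ.+ J)) x (<-≤-trans hi pw) x≤X) (subst (λ z → + (R ℕ.* suc (2 ℕ.* r₀ ℕ.+ J)) * M ≤ z * M) eq (ℤP.*-monoʳ-≤-nonNeg M {{ℤ.nonNegative M≥0}} (toℤ (≤-trans (*-monoʳ-≤ R (+-monoˡ-≤ J J≥)) (≤-reflexive (l R J))))))
            where
            l : ∀ R J → R ℕ.* (J ℕ.+ J) ≡ 2 ℕ.* R ℕ.* J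
            l = solveℕ
            eq : + (2 ℕ.* R ℕ.* J) ≡ + 2 * + R * + J
            eq = trans (*-ab (2 ℕ.* R) J) (cong (_* + J) (*-ab 2 R))
            pw : R ℕ.^ suc (2 ℕ.* r₀ ℕ.+ J) ℕ.≤ 2 ℕ.^ (R ℕ.* suc (2 ℕ.* r₀ ℕ.+ J))
            pw = subst (R ℕ.^ suc (2 ℕ.* r₀ ℕ.+ J) ℕ.≤_) (^-*-assoc 2 R (suc (2 ℕ.* r₀ ℕ.+ J))) (^-monoˡ-≤ (suc (2 ℕ.* r₀ ℕ.+ J)) (<⇒≤ (n<pow R ≤-refl)))

          -- 2 · 9 · 2 R = 36 R, from `total`, `deficit-sum'` and `Hx≤`; the extra 1 in `Vc` makes
          -- the inequality strict.
          small : S J run < S J (λ _ → V)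
          small = subst (S J run <_) (sym (S-const J V)) (al (+ x) M (H x) (+ R) (+ J) (F Y) (+ Vc) (S J run) total (deficit-sum' hH) Hx≤ (trans (cong +_ Vc≡) (trans (+-ab (36 ℕ.* R) 1) (cong (_+ + 1) (*-ab 36 R)))) 0<M (toℤ 1≤x) (toℤ (≤-trans (s≤s z≤n) J≥)))
            where
            al : ∀ x M H R J F Vc s → s ≤ + 2 * F → F ≤ + 9 * (x * (M * H)) → H ≤ + 2 * R * J * M → Vc ≡ + 36 * R + + 1 → + 0 < M → + 1 ≤ x → + 1 ≤ J → s < J * (Vc * x * (M * M))
            al x M H R J F _ s a b c refl m>0 x≥1 J≥1 = ℤP.<-≤-trans (ℤP.≤-<-trans s≤ lt) (ℤP.≤-reflexive (l2 x M R J))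
              where
              m≥0 = ℤP.<⇒≤ m>0
              x≥0 = ℤP.≤-trans (pos 1) x≥1
              s≤ : s ≤ + 36 * (R * J * x * (M * M))
              s≤ = by (nn a ⊕ pos 2 ⊗ nn b ⊕ pos 18 ⊗ (x≥0 ⊗ m≥0 ⊗ nn c)) (solve (x ∷ M ∷ H ∷ R ∷ J ∷ F ∷ s ∷ []))
              JxMM : + 1 ≤ J * (x * (M * M))
              JxMM = one* J≥1 (one* x≥1 (one* M≥1 M≥1))
                where
                M≥1 = ℤP.i<j⇒suc[i]≤j m>0
                one* : ∀ {a b} → + 1 ≤ a → + 1 ≤ b → + 1 ≤ a * b
                one* {a} {b} p q = by (nn p ⊗ nn q ⊕ nn p ⊕ nn q) (solve (a ∷ b ∷ []))
              lt : + 36 * (R * J * x * (M * M)) < + 36 * (R * J * x * (M * M)) + J * (x * (M * M))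
              lt = subst (_< + 36 * (R * J * x * (M * M)) + J * (x * (M * M))) (ℤP.+-identityʳ _) (ℤP.+-monoʳ-< (+ 36 * (R * J * x * (M * M))) (ℤP.<-≤-trans (+<+ (s≤s z≤n)) JxMM))
              l2 : ∀ x M R J → + 36 * (R * J * x * (M * M)) + J * (x * (M * M)) ≡ J * ((+ 36 * R + + 1) * x * (M * M))
              l2 = solve-∀

          good-run : ∃[ D ] (x₁ ℕ.≤ D × x₁ ℕ.* (R ℕ.* D) ℕ.≤ x × F (R ℕ.* D) - F D < V × F (x ÷ D) - F (x ÷ (R ℕ.* D)) < V)
          good-run = conclude (S-find J {run} {λ _ → V} small)
            where
            conclude : ∃[ i ] (1 ℕ.≤ i × i ℕ.≤ J × run i < V) → ∃[ D ] (x₁ ℕ.≤ D × x₁ ℕ.* (R ℕ.* D) ℕ.≤ x × F (R ℕ.* D) - F D < V × F (x ÷ D) - F (x ÷ (R ℕ.* D)) < V)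
            conclude (suc i , _ , i≤J , lt) = N i , x₁≤N i , subst (λ n → x₁ ℕ.* n ℕ.≤ x) eq okRD ,
                subst (λ n → F n - F (N i) < V) eq (ℤP.≤-<-trans (al₁ (F (N (suc i))) (F (N i)) (F (x ÷ N (suc i))) (F (x ÷ N i)) fb) lt) ,
                subst (λ n → F (x ÷ N i) - F (x ÷ n) < V) eq (ℤP.≤-<-trans (al₂ (F (N (suc i))) (F (N i)) (F (x ÷ N (suc i))) (F (x ÷ N i)) fa) lt)
              where
              eq : N (suc i) ≡ R ℕ.* N i
              eq = cong (R ℕ.^_) (+-suc r₀ i)
              okRD : x₁ ℕ.* N (suc i) ℕ.≤ x
              okRD = ≤-trans (*-monoʳ-≤ x₁ (N-mono i≤J)) top
              fa : F (N i) ≤ F (N (suc i))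
              fa = F-mono {N i} {N (suc i)} (N-mono (n≤1+n i)) okRD
              fb : F (x ÷ N (suc i)) ≤ F (x ÷ N i)
              fb = F-mono {x ÷ N (suc i)} {x ÷ N i} (÷-monoʳ x (N≥1 i) (N-mono (n≤1+n i))) (dualOK i)
              al₁ : ∀ a b c d → c ≤ d → a - b ≤ (a - b) + (- c - - d)
              al₁ a b c d p = by (nn p) (solve (a ∷ b ∷ c ∷ d ∷ []))
              al₂ : ∀ a b c d → b ≤ a → d - c ≤ (a - b) + (- c - - d)
              al₂ a b c d p = by (nn p) (solve (a ∷ b ∷ c ∷ d ∷ []))

  ilog : ∀ b → 2 ℕ.≤ b → ∀ x → 1 ℕ.≤ x → ∃[ k ] (b ℕ.^ k ℕ.≤ x × x ℕ.< b ℕ.^ suc k)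
  ilog b 2≤b (suc zero) _ = 0 , ≤-refl , subst (1 ℕ.<_) (sym (*-identityʳ b)) 2≤b
  ilog b 2≤b (suc (suc x)) _ with ilog b 2≤b (suc x) (s≤s z≤n)
  ... | k , p , q with b ℕ.^ suc k ℕ.≤? suc (suc x)
  ...   | yes r = suc k , r , ≤-<-trans q (<-≤-trans (m<m+n (b ℕ.^ suc k) (≤-trans (pow≥1 (suc k) (≤-trans (s≤s z≤n) 2≤b)) (m≤m+n _ 0))) (*-monoˡ-≤ (b ℕ.^ suc k) 2≤b))
  ...   | no r = k , m≤n⇒m≤1+n p , ≰⇒> r

  module PrimeGap (q : ℕ) (16≤q : 16 ℕ.≤ q) where

    opaque
      -- Each is fixed from its predecessors: `R` is absolute, `Vc` bounds the deficit of the best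
      -- block, `θ` gives 32 q V ≤ θ x M², `t` is as `Scale` asks, and `r₀` lifts `x₁` above
      -- `threshold t`, 64 q and 2 t. In `threshold-x` the first summand ensures J > 2 r₀, the
      -- second H x ≥ `deficit-const` M.
      R Vc θ t r₀ x₁ threshold-x : ℕ
      R = 4 ℕ.* (R₁ ℕ.* R₂)
      Vc = 36 ℕ.* R ℕ.+ 1
      θ = 32 ℕ.* q ℕ.* (Vc ℕ.+ 1)
      t = 32 ℕ.* q ℕ.* (2 ℕ.* θ ℕ.+ 12)
      r₀ = threshold t ℕ.+ (64 ℕ.* q ℕ.+ 2 ℕ.* t)
      x₁ = R ℕ.^ r₀
      threshold-x = R ℕ.^ (4 ℕ.* r₀ ℕ.+ 1) ℕ.+ 2 ℕ.^ (2 ℕ.* deficit-const t x₁)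

      R≡ : R ≡ 4 ℕ.* (R₁ ℕ.* R₂)
      R≡ = refl
      Vc≡ : Vc ≡ 36 ℕ.* R ℕ.+ 1
      Vc≡ = refl
      θ≡ : θ ≡ 32 ℕ.* q ℕ.* (Vc ℕ.+ 1)
      θ≡ = refl
      t≡ : t ≡ 32 ℕ.* q ℕ.* (2 ℕ.* θ ℕ.+ 12)
      t≡ = refl
      r₀≡ : r₀ ≡ threshold t ℕ.+ (64 ℕ.* q ℕ.+ 2 ℕ.* t)
      r₀≡ = refl
      x₁≡ : x₁ ≡ R ℕ.^ r₀
      x₁≡ = refl
      threshold-x≡ : threshold-x ≡ R ℕ.^ (4 ℕ.* r₀ ℕ.+ 1) ℕ.+ 2 ℕ.^ (2 ℕ.* deficit-const t x₁)
      threshold-x≡ = refl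

    2≤R : 2 ℕ.≤ R
    2≤R = subst (2 ℕ.≤_) (sym R≡) (≤-trans (s≤s (s≤s z≤n)) (*-monoʳ-≤ 4 (*-mono-≤ R₁≥1 R₂≥1)))

    r₀≤x₁ : r₀ ℕ.≤ x₁
    r₀≤x₁ = subst (r₀ ℕ.≤_) (sym x₁≡) (<⇒≤ (n<pow r₀ 2≤R))

    module Above (x : ℕ) (x≥ : threshold-x ℕ.≤ x) (np : ∀ n → x ℕ.< n → n ℕ.≤ x ℕ.+ x ÷ q → ¬ Prime n) where
      X : ℕ
      X = x ℕ.+ x ÷ q

      big₁ : R ℕ.^ (4 ℕ.* r₀ ℕ.+ 1) ℕ.≤ x
      big₁ = ≤-trans (m≤m+n _ _) (subst (ℕ._≤ x) threshold-x≡ x≥)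

      big₂ : 2 ℕ.^ (2 ℕ.* deficit-const t x₁) ℕ.≤ x
      big₂ = ≤-trans (m≤n+m _ (R ℕ.^ (4 ℕ.* r₀ ℕ.+ 1))) (subst (ℕ._≤ x) threshold-x≡ x≥)

      1≤R : 1 ℕ.≤ R
      1≤R = ≤-trans (s≤s z≤n) 2≤R

      1≤x : 1 ℕ.≤ x
      1≤x = ≤-trans (pow≥1 (4 ℕ.* r₀ ℕ.+ 1) 1≤R) big₁

      x₁≤x : x₁ ℕ.≤ x
      x₁≤x = ≤-trans (≤-reflexive x₁≡) (≤-trans (^-monoʳ-≤ R {{ℕ.>-nonZero 1≤R}} (≤-trans (m≤m+n r₀ _) (m≤m+n (4 ℕ.* r₀) 1))) big₁)

      -- Every x gets a logarithm of its own; the right end of the interval is the largest argument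
      -- that occurs.
      sys : LogSystem X
      sys = Construct.logSystem X (≤-trans 1≤x (m≤m+n x _))

      open LogSystem sys using (M; H; 0<M)

      sc : Scale q θ t x x₁ X
      sc = record
        { 16≤q = 16≤q
        ; t-def = trans (cong +_ t≡) (trans (*-ab (32 ℕ.* q) (2 ℕ.* θ ℕ.+ 12)) (cong₂ _*_ (*-ab 32 q) (trans (+-ab (2 ℕ.* θ) 12) (cong (_+ + 12) (*-ab 2 θ)))))
        ; thr = ≤-trans (≤-trans (m≤m+n (threshold t) _) (≤-reflexive (sym r₀≡))) r₀≤x₁
        ; 64q≤ = ≤-trans (≤-trans (m≤m+n (64 ℕ.* q) (2 ℕ.* t)) (≤-trans (m≤n+m _ (threshold t)) (≤-reflexive (sym r₀≡)))) r₀≤x₁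
        ; 2t≤ = ≤-trans (≤-trans (m≤n+m (2 ℕ.* t) (64 ℕ.* q)) (≤-trans (m≤n+m _ (threshold t)) (≤-reflexive (sym r₀≡)))) r₀≤x₁
        ; x'≤X = ≤-refl
        }

      hH : + deficit-const t x₁ * M ≤ H x
      hH = WithLog.H-large X sys (deficit-const t x₁) x big₂ (m≤m+n x _)

      module Between (k : ℕ) (lo : R ℕ.^ k ℕ.≤ x) (hi : x ℕ.< R ℕ.^ suc k) where
        k≥ : 4 ℕ.* r₀ ℕ.+ 1 ℕ.≤ k
        k≥ = ≮⇒≥ λ k< → <⇒≱ hi (≤-trans (^-monoʳ-≤ R {{ℕ.>-nonZero 1≤R}} k<) big₁)

        J : ℕ
        J = k ℕ.∸ 2 ℕ.* r₀

        k≡ : 2 ℕ.* r₀ ℕ.+ J ≡ k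
        k≡ = m+[n∸m]≡n (≤-trans (≤-trans (*-monoˡ-≤ r₀ {2} {4} (s≤s (s≤s z≤n))) (m≤m+n (4 ℕ.* r₀) 1)) k≥)

        J≥ : suc (2 ℕ.* r₀) ℕ.≤ J
        J≥ = +-cancelˡ-≤ (2 ℕ.* r₀) _ _ (subst (2 ℕ.* r₀ ℕ.+ suc (2 ℕ.* r₀) ℕ.≤_) (sym k≡) (subst (ℕ._≤ k) (l r₀) k≥))
          where
          l : ∀ r → 4 ℕ.* r ℕ.+ 1 ≡ 2 ℕ.* r ℕ.+ suc (2 ℕ.* r)
          l = solveℕ

        V : ℤ
        V = + Vc * + x * (M * M)

        hV : + 32 * + q * V ≤ + θ * + x * (M * M)
        hV = al (+ q) (+ Vc) (+ x) M (+ θ) (trans (cong +_ θ≡) (trans (*-ab (32 ℕ.* q) (Vc ℕ.+ 1)) (cong₂ _*_ (*-ab 32 q) (+-ab Vc 1)))) (ℤP.<⇒≤ 0<M) (pos x) (pos q)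
          where
          al : ∀ q V x M θ → θ ≡ + 32 * q * (V + + 1) → + 0 ≤ M → + 0 ≤ x → + 0 ≤ q → + 32 * q * (V * x * (M * M)) ≤ θ * x * (M * M)
          al q V x M _ refl a b c = by (pos 32 ⊗ (c ⊗ b ⊗ (a ⊗ a))) (solve (q ∷ V ∷ x ∷ M ∷ []))

        absurd : ⊥
        absurd = go (WithLog.Deficit.DeficitSum.Pigeonhole.good-run X sys q θ t x x₁ sc np x₁≤x R r₀ J Vc 2≤R x₁≡ Vc≡ (subst (λ k → R ℕ.^ k ℕ.≤ x) (sym k≡) lo) (subst (λ k → x ℕ.< R ℕ.^ suc k) (sym k≡) hi) J≥ hH)
          where
          F : ℕ → ℤ
          F = WithLog.Deficit.F X sys q θ t x x₁ sc
          go : ∃[ D ] (x₁ ℕ.≤ D × x₁ ℕ.* (R ℕ.* D) ℕ.≤ x × F (R ℕ.* D) - F D < V × F (x ÷ D) - F (x ÷ (R ℕ.* D)) < V) → ⊥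
          go (D , p , h , a , b) = WithLog.Deficit.Run.Steps.Contradiction.absurd X sys q θ t x x₁ sc D R V p h a b hV R≡ (pos Vc ⊗ pos x ⊗ (ℤP.<⇒≤ 0<M ⊗ ℤP.<⇒≤ 0<M))

      absurd : ⊥
      absurd = go (ilog R 2≤R x 1≤x)
        where
        go : ∃[ k ] (R ℕ.^ k ℕ.≤ x × x ℕ.< R ℕ.^ suc k) → ⊥
        go (k , lo , hi) = Between.absurd k lo hi

  -- The interval is finite and primality decidable, so refuting the absence of primes produces one.
  prime-in-interval : ∀ q → 16 ℕ.≤ q → ∃[ N ] (∀ x → N ℕ.≤ x → ∃[ p ] (Prime p × x ℕ.< p × p ℕ.≤ x ℕ.+ x ÷ q))
  prime-in-interval q 16≤q = PrimeGap.threshold-x q 16≤q , find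
    where
    find : ∀ x → PrimeGap.threshold-x q 16≤q ℕ.≤ x → ∃[ p ] (Prime p × x ℕ.< p × p ℕ.≤ x ℕ.+ x ÷ q)
    find x x≥ with anyUpTo? (λ p → prime? p ×-dec (x ℕ.<? p)) (suc (x ℕ.+ x ÷ q))
    ... | yes (p , s≤s p≤ , pp , x<p) = p , pp , x<p , p≤
    ... | no none = ⊥-elim (PrimeGap.Above.absurd q 16≤q x x≥ λ n x<n n≤ pn → none (n , s≤s n≤ , pn , x<n))

  open import Defs using (Triple; triple; _∈₃_)
  open import Data.Fin using (Fin; zero; suc; toℕ; fromℕ<)
  open import Data.Fin.Properties using (_≟_; any?; toℕ-injective; toℕ<n; toℕ-fromℕ<)
  open import Relation.Binary.Definitions using (tri<; tri≈; tri>)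

  -- Counting paths through a designated vertex of each edge

  opaque
    ∑ : ∀ {n} → (Fin n → ℤ) → ℤ
    ∑ {zero} f = + 0
    ∑ {suc n} f = f zero + ∑ (f ∘ suc)

  opaque
    unfolding ∑

    ∑-cong : ∀ {n} {f g : Fin n → ℤ} → (∀ i → f i ≡ g i) → ∑ f ≡ ∑ g
    ∑-cong {zero} h = refl
    ∑-cong {suc n} h = cong₂ _+_ (h zero) (∑-cong (h ∘ suc))

    ∑-mono : ∀ {n} {f g : Fin n → ℤ} → (∀ i → f i ≤ g i) → ∑ f ≤ ∑ g
    ∑-mono {zero} h = ℤP.≤-refl
    ∑-mono {suc n} h = ℤP.+-mono-≤ (h zero) (∑-mono (h ∘ suc))

    ∑-const : ∀ n c → ∑ {n} (λ _ → c) ≡ + n * c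
    ∑-const zero c = sym (ℤP.*-zeroˡ c)
    ∑-const (suc n) c = trans (cong (_+_ c) (∑-const n c)) (trans (lem c (+ n)) (cong (_* c) (sym (+-ab 1 n))))
      where
      lem : ∀ c n → c + n * c ≡ (+ 1 + n) * c
      lem = solve-∀

    ∑-0 : ∀ n → ∑ {n} (λ _ → + 0) ≡ + 0
    ∑-0 n = trans (∑-const n (+ 0)) (ℤP.*-zeroʳ (+ n))

    ∑-nonneg : ∀ {n} {f : Fin n → ℤ} → (∀ i → + 0 ≤ f i) → + 0 ≤ ∑ f
    ∑-nonneg {n} {f} h = subst (_≤ ∑ f) (∑-0 n) (∑-mono h)

    ∑-+ : ∀ {n} (f g : Fin n → ℤ) → ∑ (λ i → f i + g i) ≡ ∑ f + ∑ g
    ∑-+ {zero} f g = refl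
    ∑-+ {suc n} f g = trans (cong (_+_ (f zero + g zero)) (∑-+ (f ∘ suc) (g ∘ suc))) (lem (f zero) (g zero) (∑ (f ∘ suc)) (∑ (g ∘ suc)))
      where
      lem : ∀ a b c d → (a + b) + (c + d) ≡ (a + c) + (b + d)
      lem = solve-∀

    ∑-* : ∀ {n} c (f : Fin n → ℤ) → ∑ (λ i → c * f i) ≡ c * ∑ f
    ∑-* {zero} c f = sym (ℤP.*-zeroʳ c)
    ∑-* {suc n} c f = trans (cong (_+_ (c * f zero)) (∑-* c (f ∘ suc))) (sym (ℤP.*-distribˡ-+ c (f zero) (∑ (f ∘ suc))))

    ∑-*ʳ : ∀ {n} c (f : Fin n → ℤ) → ∑ (λ i → f i * c) ≡ ∑ f * c
    ∑-*ʳ c f = trans (∑-cong λ i → ℤP.*-comm (f i) c) (trans (∑-* c f) (ℤP.*-comm c (∑ f)))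

    ∑-swap : ∀ {n m} (f : Fin n → Fin m → ℤ) → ∑ (λ i → ∑ (λ j → f i j)) ≡ ∑ (λ j → ∑ (λ i → f i j))
    ∑-swap {zero} {m} f = sym (∑-0 m)
    ∑-swap {suc n} {m} f = trans (cong (_+_ (∑ (f zero))) (∑-swap (f ∘ suc))) (sym (∑-+ (f zero) (λ j → ∑ (λ i → f (suc i) j))))

    ∑-∑* : ∀ {n m} (f : Fin n → ℤ) (g : Fin m → ℤ) → ∑ f * ∑ g ≡ ∑ (λ i → ∑ (λ j → f i * g j))
    ∑-∑* f g = trans (sym (∑-*ʳ (∑ g) f)) (∑-cong λ i → sym (∑-* (f i) g))

    ∑-term : ∀ {n} {f : Fin n → ℤ} → (∀ i → + 0 ≤ f i) → ∀ i → f i ≤ ∑ f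
    ∑-term {suc n} {f} h zero = subst (_≤ ∑ f) (ℤP.+-identityʳ (f zero)) (ℤP.+-monoʳ-≤ (f zero) (∑-nonneg (h ∘ suc)))
    ∑-term {suc n} {f} h (suc i) = ℤP.≤-trans (∑-term (h ∘ suc) i) (subst (_≤ ∑ f) (ℤP.+-identityˡ _) (ℤP.+-monoˡ-≤ (∑ (f ∘ suc)) (h zero)))

    ι-suc : ∀ {n} (i j : Fin n) → ι (suc i ≟ suc j) ≡ ι (i ≟ j)
    ι-suc i j = ι-cong (suc i ≟ suc j) (i ≟ j) (λ { refl → refl }) (cong suc)

    ∑-δ : ∀ {n} (j : Fin n) (g : Fin n → ℤ) → ∑ (λ i → ι (i ≟ j) * g i) ≡ g j
    ∑-δ {suc n} zero g = trans (cong₂ _+_ (ℤP.*-identityˡ (g zero)) (trans (∑-cong λ i → ℤP.*-zeroˡ (g (suc i))) (∑-0 n))) (ℤP.+-identityʳ (g zero))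
    ∑-δ {suc n} (suc j) g = trans (cong₂ _+_ (ℤP.*-zeroˡ (g zero)) (trans (∑-cong λ i → cong (_* g (suc i)) (ι-suc i j)) (∑-δ j (g ∘ suc)))) (ℤP.+-identityˡ (g (suc j)))

  ∑-ι≟ : ∀ {n} (j : Fin n) → ∑ (λ i → ι (i ≟ j)) ≡ + 1
  ∑-ι≟ j = trans (∑-cong λ i → sym (ℤP.*-identityʳ (ι (i ≟ j)))) (∑-δ j (λ _ → + 1))

  ∑-unique : ∀ {n p q} {P : Fin n → Set p} {Q : Set q} (P? : ∀ i → Dec (P i)) (d : Dec Q) → (∀ i → P i → Q) → (∀ i j → P i → P j → i ≡ j) → ∑ (λ i → ι (P? i)) ≤ ι d
  ∑-unique {n} {P = P} P? d f u with any? P?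
  ... | no none = subst (_≤ ι d) (sym (trans (∑-cong λ i → ι-no (P? i) λ p → none (i , p)) (∑-0 n))) (ι-nonneg d)
  ... | yes (i₀ , p₀) = ℤP.≤-trans (∑-mono λ i → ι-mono (P? i) (i ≟ i₀) λ p → u i i₀ p p₀) (ℤP.≤-reflexive (trans (∑-ι≟ i₀) (sym (ι-yes d (f i₀ p₀)))))

  ι-× : ∀ {p q} {P : Set p} {Q : Set q} (a : Dec P) (b : Dec Q) → ι (a ×-dec b) ≡ ι a * ι b
  ι-× (yes _) (yes _) = refl
  ι-× (yes _) (no _) = refl
  ι-× (no _) b = sym (ℤP.*-zeroˡ (ι b))

  ι-⊎ : ∀ {p q} {P : Set p} {Q : Set q} (a : Dec P) (b : Dec Q) → (P → ¬ Q) → ι (a ⊎-dec b) ≡ ι a + ι b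
  ι-⊎ (yes p) (yes q) h = ⊥-elim (h p q)
  ι-⊎ (yes _) (no _) _ = refl
  ι-⊎ (no _) (yes _) _ = refl
  ι-⊎ (no _) (no _) _ = refl

  ι-idem : ∀ {p} {P : Set p} (a : Dec P) → ι a * ι a ≡ ι a
  ι-idem (yes _) = refl
  ι-idem (no _) = refl

  -- By Lagrange's identity, twice the difference is the sum of (v i - v j)² over all i and j.
  cauchy-schwarz : ∀ {n} (v : Fin n → ℤ) → ∑ v * ∑ v ≤ + n * ∑ (λ i → v i * v i)
  cauchy-schwarz {n} v = cancel-≤ (+ 2) (+<+ (s≤s z≤n)) (by (∑-nonneg λ i → ∑-nonneg λ j → square≥0 (v i - v j)) eq)
    where
    V = ∑ (λ i → v i * v i)
    inner : ∀ i → ∑ (λ j → (v i - v j) * (v i - v j)) ≡ + n * (v i * v i) + (V + - (+ 2 * ∑ v) * v i)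
    inner i = trans (∑-cong λ j → l (v i) (v j)) (trans (∑-+ _ _) (cong₂ _+_ (∑-const n (v i * v i)) (trans (∑-+ _ _) (cong (_+_ V) (trans (∑-* (- + 2 * v i) v) (l2 (v i) (∑ v)))))))
      where
      l : ∀ a b → (a - b) * (a - b) ≡ a * a + (b * b + - + 2 * a * b)
      l = solve-∀
      l2 : ∀ a s → - + 2 * a * s ≡ - (+ 2 * s) * a
      l2 = solve-∀
    eq : + 2 * (+ n * V) - + 2 * (∑ v * ∑ v) ≡ ∑ (λ i → ∑ (λ j → (v i - v j) * (v i - v j)))
    eq = sym (trans (∑-cong inner) (trans (∑-+ _ _) (trans (cong₂ _+_ (∑-* (+ n) (λ i → v i * v i)) (trans (∑-+ _ _) (cong₂ _+_ (∑-const n V) (∑-* (- (+ 2 * ∑ v)) v)))) (l (+ n) V (∑ v)))))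
      where
      l : ∀ n V s → n * V + (n * V + - (+ 2 * s) * s) ≡ + 2 * (n * V) - + 2 * (s * s)
      l = solve-∀

  module Count (n m : ℕ) (w c c' : Fin m → Fin n) (w≢c : ∀ i → w i ≢ c i) (w≢c' : ∀ i → w i ≢ c' i) (c≢c' : ∀ i → c i ≢ c' i) where

    Center : Fin m → Fin n → Set
    Center i x = (x ≡ c i) ⊎ (x ≡ c' i)

    -- The graph has two pairs per edge, leaf-c and leaf-c', and this relation makes them unordered.
    -- In what follows c and c' are the centers of the edge.
    Inc : Fin m → Fin n → Fin n → Set
    Inc i z x = ((z ≡ w i) × Center i x) ⊎ ((x ≡ w i) × Center i z)

    center? : ∀ i x → Dec (Center i x)
    center? i x = (x ≟ c i) ⊎-dec (x ≟ c' i)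

    inc? : ∀ i z x → Dec (Inc i z x)
    inc? i z x = ((z ≟ w i) ×-dec center? i x) ⊎-dec ((x ≟ w i) ×-dec center? i z)

    w-not-center : ∀ i → ¬ Center i (w i)
    w-not-center i (inj₁ e) = w≢c i e
    w-not-center i (inj₂ e) = w≢c' i e

    inc-sym : ∀ {i z x} → Inc i z x → Inc i x z
    inc-sym (inj₁ p) = inj₂ p
    inc-sym (inj₂ p) = inj₁ p

    inc-≢ : ∀ {i z x} → Inc i z x → z ≢ x
    inc-≢ {i} (inj₁ (refl , h)) refl = w-not-center i h
    inc-≢ {i} (inj₂ (refl , h)) refl = w-not-center i h

    Centers : Fin m → Fin n → Fin n → Set
    Centers i z z' = ((z ≡ c i) × (z' ≡ c' i)) ⊎ ((z ≡ c' i) × (z' ≡ c i))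

    centers? : ∀ i z z' → Dec (Centers i z z')
    centers? i z z' = ((z ≟ c i) ×-dec (z' ≟ c' i)) ⊎-dec ((z ≟ c' i) ×-dec (z' ≟ c i))

    mk-centers : ∀ {i z z'} → z ≢ z' → Center i z → Center i z' → Centers i z z'
    mk-centers ne (inj₁ refl) (inj₁ refl) = ⊥-elim (ne refl)
    mk-centers ne (inj₁ p) (inj₂ q) = inj₁ (p , q)
    mk-centers ne (inj₂ p) (inj₁ q) = inj₂ (p , q)
    mk-centers ne (inj₂ refl) (inj₂ refl) = ⊥-elim (ne refl)

    -- The two pairs of one edge have only the leaf in common.
    fork : ∀ {i x z z'} → z ≢ z' → Inc i z x → Inc i z' x → (x ≡ w i) × Centers i z z'
    fork ne (inj₂ (p , q)) (inj₂ (_ , q')) = p , mk-centers ne q q'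
    fork ne (inj₁ (refl , _)) (inj₁ (refl , _)) = ⊥-elim (ne refl)
    fork {i} ne (inj₁ (refl , h)) (inj₂ (refl , _)) = ⊥-elim (w-not-center i h)
    fork {i} ne (inj₂ (refl , _)) (inj₁ (refl , h)) = ⊥-elim (w-not-center i h)

    L C : Fin m → Fin n → ℤ
    L i z = ι (z ≟ w i)
    C i z = ι (z ≟ c i) + ι (z ≟ c' i)

    CP : Fin m → Fin n → Fin n → ℤ
    CP i z z' = ι (z ≟ c i) * ι (z' ≟ c' i) + ι (z ≟ c' i) * ι (z' ≟ c i)

    ι-center : ∀ i x → ι (center? i x) ≡ C i x
    ι-center i x = ι-⊎ (x ≟ c i) (x ≟ c' i) λ { refl e → c≢c' i e }

    ι-centers : ∀ i z z' → ι (centers? i z z') ≡ CP i z z'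
    ι-centers i z z' = trans (ι-⊎ ((z ≟ c i) ×-dec (z' ≟ c' i)) ((z ≟ c' i) ×-dec (z' ≟ c i)) λ { (refl , _) (e , _) → c≢c' i e }) (cong₂ _+_ (ι-× (z ≟ c i) (z' ≟ c' i)) (ι-× (z ≟ c' i) (z' ≟ c i)))

    ι-inc : ∀ i z x → ι (inc? i z x) ≡ L i z * C i x + L i x * C i z
    ι-inc i z x = trans (ι-⊎ ((z ≟ w i) ×-dec center? i x) ((x ≟ w i) ×-dec center? i z) λ { (refl , h) (refl , _) → w-not-center i h })
      (cong₂ _+_ (trans (ι-× (z ≟ w i) (center? i x)) (cong (L i z *_) (ι-center i x))) (trans (ι-× (x ≟ w i) (center? i z)) (cong (L i x *_) (ι-center i z))))

    L≥0 : ∀ i z → + 0 ≤ L i z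
    L≥0 i z = ι-nonneg (z ≟ w i)

    C≥0 : ∀ i z → + 0 ≤ C i z
    C≥0 i z = ι-nonneg (z ≟ c i) ⊕ ι-nonneg (z ≟ c' i)

    CP≥0 : ∀ i z z' → + 0 ≤ CP i z z'
    CP≥0 i z z' = subst (+ 0 ≤_) (ι-centers i z z') (ι-nonneg (centers? i z z'))

    ∑L : ∀ i → ∑ (L i) ≡ + 1
    ∑L i = ∑-ι≟ (w i)

    ∑C : ∀ i → ∑ (C i) ≡ + 2
    ∑C i = trans (∑-+ _ _) (cong₂ _+_ (∑-ι≟ (c i)) (∑-ι≟ (c' i)))

    ∑CP : ∀ i z → ∑ (CP i z) ≡ C i z
    ∑CP i z = trans (∑-+ _ _) (cong₂ _+_ (trans (∑-* (ι (z ≟ c i)) _) (trans (cong (ι (z ≟ c i) *_) (∑-ι≟ (c' i))) (ℤP.*-identityʳ (ι (z ≟ c i))))) (trans (∑-* (ι (z ≟ c' i)) _) (trans (cong (ι (z ≟ c' i) *_) (∑-ι≟ (c i))) (ℤP.*-identityʳ (ι (z ≟ c' i))))))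

    a : Fin n → Fin n → ℤ
    a z x = ∑ (λ i → ι (inc? i z x))

    p T s : Fin n → ℤ
    p z = ∑ (λ i → L i z)
    T z = ∑ (λ i → C i z)
    s z = ∑ (a z)

    s≡ : ∀ z → s z ≡ + 2 * p z + T z
    s≡ z = trans (∑-swap _) (trans (∑-cong λ i → trans (∑-cong λ x → ι-inc i z x) (trans (∑-+ _ _) (cong₂ _+_ (trans (∑-* (L i z) (C i)) (cong (L i z *_) (∑C i))) (trans (∑-*ʳ (C i z) (L i)) (cong (_* C i z) (∑L i))))))
      (trans (∑-cong λ i → l (L i z) (C i z)) (trans (∑-+ _ _) (cong (_+ T z) (∑-* (+ 2) _)))))
      where
      l : ∀ a b → a * + 2 + + 1 * b ≡ + 2 * a + b
      l = solve-∀

    ∑p : ∑ p ≡ + m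
    ∑p = trans (∑-swap _) (trans (∑-cong ∑L) (trans (∑-const m (+ 1)) (ℤP.*-identityʳ (+ m))))

    ∑T : ∑ T ≡ + 2 * + m
    ∑T = trans (∑-swap _) (trans (∑-cong ∑C) (trans (∑-const m (+ 2)) (ℤP.*-comm (+ m) (+ 2))))

    ∑s : ∑ s ≡ + 4 * + m
    ∑s = trans (∑-cong s≡) (trans (∑-+ _ _) (trans (cong₂ _+_ (trans (∑-* (+ 2) p) (cong (+ 2 *_) ∑p)) ∑T) (l (+ m))))
      where
      l : ∀ m → + 2 * m + + 2 * m ≡ + 4 * m
      l = solve-∀

    -- A 2-path x - z - y whose two pairs come from different edges; `N` counts its midpoints.
    Cross : Fin n → Fin n → Fin n → Set
    Cross x y z = ∃[ i ] ∃[ j ] ((i ≢ j) × (Inc i z x × Inc j z y))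

    pair? : ∀ x y z i j → Dec ((i ≢ j) × (Inc i z x × Inc j z y))
    pair? x y z i j = ¬? (i ≟ j) ×-dec (inc? i z x ×-dec inc? j z y)

    cross? : ∀ x y z → Dec (Cross x y z)
    cross? x y z = any? λ i → any? λ j → pair? x y z i j

    ne : Fin n → Fin n → ℤ
    ne x y = ι (¬? (x ≟ y))

    K : Fin n → Fin n → Fin n → ℤ
    K x y z = ι (cross? x y z)

    K≥0 : ∀ x y z → + 0 ≤ K x y z
    K≥0 x y z = ι-nonneg (cross? x y z)

    N : Fin n → Fin n → ℤ
    N x y = ∑ (K x y)

    N≥0 : ∀ x y → + 0 ≤ N x y
    N≥0 x y = ∑-nonneg (K≥0 x y)

    -- The number of edges with leaf x and centers z, z'; summed over the leaf it becomes `W`.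
    U : Fin n → Fin n → Fin n → ℤ
    U x z z' = ∑ (λ i → L i x * CP i z z')

    U≥0 : ∀ x z z' → + 0 ≤ U x z z'
    U≥0 x z z' = ∑-nonneg λ i → L≥0 i x ⊗ CP≥0 i z z'

    W : Fin n → Fin n → ℤ
    W z z' = ∑ (λ i → CP i z z')

    W≥0 : ∀ z z' → + 0 ≤ W z z'
    W≥0 z z' = ∑-nonneg λ i → CP≥0 i z z'

    ∑U : ∀ z z' → ∑ (λ x → U x z z') ≡ W z z'
    ∑U z z' = trans (∑-swap _) (∑-cong λ i → trans (∑-*ʳ (CP i z z') (L i)) (trans (cong (_* CP i z z') (∑L i)) (ℤP.*-identityˡ _)))

    ∑W : ∀ z → ∑ (W z) ≡ T z
    ∑W z = trans (∑-swap _) (∑-cong λ i → ∑CP i z)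

    U-one : ∀ {i x z z'} → x ≡ w i → Centers i z z' → + 1 ≤ U x z z'
    U-one {i} {x} {z} {z'} e h = subst (_≤ U x z z') (cong₂ _*_ (ι-yes (x ≟ w i) e) (trans (sym (ι-centers i z z')) (ι-yes (centers? i z z') h))) (∑-term (λ i → L≥0 i x ⊗ CP≥0 i z z') i)

    W-diag : ∀ z → W z z ≡ + 0
    W-diag z = trans (∑-cong λ i → trans (sym (ι-centers i z z)) (ι-no (centers? i z z) λ { (inj₁ (refl , e)) → c≢c' i e ; (inj₂ (refl , e)) → c≢c' i (sym e) })) (∑-0 m)

    W≤T : ∀ z z' → W z z' ≤ T z
    W≤T z z' = ∑-mono λ i → subst₂ _≤_ (ι-centers i z z') (ι-center i z) (ι-mono (centers? i z z') (center? i z) λ { (inj₁ (e , _)) → inj₁ e ; (inj₂ (e , _)) → inj₂ e })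

    module Bound (simple : ∀ {i j z x} → Inc i z x → Inc j z x → i ≡ j)
      (four-cycle : ∀ {x y z z' i j k l} → x ≢ y → z ≢ z' → Inc i z x → Inc j z y → Inc k z' x → Inc l z' y → i ≢ j → k ≢ l → (i ≡ k) ⊎ (j ≡ l)) where

      a≤1 : ∀ z x → a z x ≤ + 1
      a≤1 z x = ∑-unique (λ i → inc? i z x) (yes refl) (λ _ _ → refl {x = z}) λ i j p q → simple p q

      a≥0 : ∀ z x → + 0 ≤ a z x
      a≥0 z x = ∑-nonneg λ i → ι-nonneg (inc? i z x)

      -- A 2-path with midpoint z is degenerate (x = y), or it consists of both pairs of one edge,
      -- whose leaf is then z, or its pairs belong to different edges.
      path-bound : ∀ z x y → a z x * a z y ≤ ι (x ≟ y) * a z x + (U z x y + ne x y * K x y z)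
      path-bound z x y with x ≟ y
      ... | yes refl = al (a z x) (U z x x) (K x x z) (a≤1 z x) (a≥0 z x) (U≥0 z x x)
        where
        al : ∀ a u k → a ≤ + 1 → + 0 ≤ a → + 0 ≤ u → a * a ≤ + 1 * a + (u + + 0 * k)
        al a u k p q r = by (q ⊗ nn p ⊕ r) (solve (a ∷ u ∷ k ∷ []))
      ... | no x≢y = ℤP.≤-trans (ℤP.≤-reflexive (∑-∑* _ _)) (ℤP.≤-trans (∑-mono λ i → ∑-mono λ j → pt i j) (ℤP.≤-trans (ℤP.≤-reflexive split) fin))
        where
        pt : ∀ i j → ι (inc? i z x) * ι (inc? j z y) ≤ ι (j ≟ i) * (L i z * CP i x y) + ι (pair? x y z i j)
        pt i j with j ≟ i
        ... | yes refl = ℤP.≤-trans (ℤP.≤-reflexive (sym (ι-× (inc? i z x) (inc? i z y)))) (ℤP.≤-trans (ι-mono (inc? i z x ×-dec inc? i z y) ((z ≟ w i) ×-dec centers? i x y) λ { (p , q) → fork x≢y (inc-sym p) (inc-sym q) })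
              (ℤP.≤-trans (ℤP.≤-reflexive (trans (ι-× (z ≟ w i) (centers? i x y)) (trans (cong (L i z *_) (ι-centers i x y)) (sym (ℤP.*-identityˡ _))))) (ℤP.≤-trans (ℤP.≤-reflexive (sym (ℤP.+-identityʳ _))) (ℤP.+-monoʳ-≤ (+ 1 * (L i z * CP i x y)) (ι-nonneg (pair? x y z i i))))))
        ... | no ¬e = ℤP.≤-trans (ℤP.≤-reflexive (sym (ι-× (inc? i z x) (inc? j z y)))) (ℤP.≤-trans (ι-mono (inc? i z x ×-dec inc? j z y) (pair? x y z i j) λ h → (λ e → ¬e (sym e)) , h) (ℤP.≤-reflexive (l (L i z * CP i x y) (ι (pair? x y z i j)))))
          where
          l : ∀ u v → v ≡ + 0 * u + v
          l = solve-∀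
        split : ∑ (λ i → ∑ (λ j → ι (j ≟ i) * (L i z * CP i x y) + ι (pair? x y z i j))) ≡ U z x y + ∑ (λ i → ∑ (λ j → ι (pair? x y z i j)))
        split = trans (∑-cong λ i → trans (∑-+ _ _) (cong (_+ ∑ (λ j → ι (pair? x y z i j))) (∑-δ i (λ _ → L i z * CP i x y)))) (∑-+ _ _)
        crossed : ∑ (λ i → ∑ (λ j → ι (pair? x y z i j))) ≤ K x y z
        crossed = ℤP.≤-trans (∑-mono λ i → ∑-unique (pair? x y z i) (any? (pair? x y z i)) (λ j h → j , h) λ j j' p q → simple (proj₂ (proj₂ p)) (proj₂ (proj₂ q)))
          (∑-unique (λ i → any? (pair? x y z i)) (cross? x y z) (λ i h → i , h) λ i i' p q → simple (proj₁ (proj₂ (proj₂ p))) (proj₁ (proj₂ (proj₂ q))))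
        fin : U z x y + ∑ (λ i → ∑ (λ j → ι (pair? x y z i j))) ≤ + 0 * a z x + (U z x y + + 1 * K x y z)
        fin = al (U z x y) (K x y z) (a z x) crossed
          where
          al : ∀ u k a {v} → v ≤ k → u + v ≤ + 0 * a + (u + + 1 * k)
          al u k a {v} h = by (nn h) (solve (u ∷ k ∷ a ∷ v ∷ []))

      N-square : ∀ x y → N x y * N x y - N x y ≡ ∑ (λ z → ∑ (λ z' → ne z z' * (K x y z * K x y z')))
      N-square x y = trans (cong (_- N x y) (trans (∑-∑* _ _) (trans (∑-cong λ z → trans (∑-cong λ z' → sp z z') (trans (∑-+ _ _) (cong (_+ ∑ (λ z' → ne z z' * (K x y z * K x y z'))) (trans (∑-δ z (λ z' → K x y z * K x y z')) (ι-idem (cross? x y z)))))) (∑-+ _ _)))) (l (N x y) _)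
        where
        l : ∀ a b → (a + b) - a ≡ b
        l = solve-∀
        l1 : ∀ a → a ≡ + 1 * a + + 0 * a
        l1 = solve-∀
        l0 : ∀ a → a ≡ + 0 * a + + 1 * a
        l0 = solve-∀
        sp : ∀ z z' → K x y z * K x y z' ≡ ι (z' ≟ z) * (K x y z * K x y z') + ne z z' * (K x y z * K x y z')
        sp z z' with z' ≟ z | z ≟ z'
        ... | yes _ | yes _ = l1 (K x y z * K x y z')
        ... | no _ | no _ = l0 (K x y z * K x y z')
        ... | yes e | no ¬e = ⊥-elim (¬e (sym e))
        ... | no ¬e | yes e = ⊥-elim (¬e (sym e))

      Coinc : Fin n → Fin n → Fin n → Set
      Coinc x z z' = ∃[ i ] ((z ≢ z') × (Inc i z x × Inc i z' x))

      coinc? : ∀ x z z' → Dec (Coinc x z z')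
      coinc? x z z' = any? λ i → ¬? (z ≟ z') ×-dec (inc? i z x ×-dec inc? i z' x)

      coinc-unique : ∀ x z z₁ z₂ → Coinc x z z₁ → Coinc x z z₂ → z₁ ≡ z₂
      coinc-unique x z z₁ z₂ (i , ne₁ , p , p₁) (j , ne₂ , q , q₂) with simple p q
      ... | refl with proj₂ (fork ne₁ p p₁) | proj₂ (fork ne₂ q q₂)
      ...   | inj₁ (refl , refl) | inj₁ (_ , refl) = refl
      ...   | inj₁ (refl , refl) | inj₂ (e , _) = ⊥-elim (c≢c' i e)
      ...   | inj₂ (refl , refl) | inj₁ (e , _) = ⊥-elim (c≢c' i (sym e))
      ...   | inj₂ (refl , refl) | inj₂ (_ , refl) = refl

      -- Of two midpoints z, z', the pairs at x or those at y come from one edge. For given z each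
      -- case leaves at most one z', because the pair determines the edge and z' is its other
      -- center. So N² - N ≤ 2 N.
      N≤3 : ∀ x y → x ≢ y → N x y ≤ + 3
      N≤3 x y x≢y = fin (N x y) (N≥0 x y) (subst₂ _≤_ (sym (N-square x y)) refl bound)
        where
        al₁ : ∀ a b → + 1 ≤ a → + 0 ≤ b → + 1 ≤ + 1 * (a + b)
        al₁ a b p q = by (nn p ⊕ q) (solve (a ∷ b ∷ []))
        pt′ : ∀ {z z'} (e : Dec (z ≡ z')) (d : Dec (Cross x y z)) (d' : Dec (Cross x y z')) (f : Dec (Coinc x z z')) (g : Dec (Coinc y z z')) →
          ι (¬? e) * (ι d * ι d') ≤ ι d * (ι f + ι g)
        pt′ (yes _) d d' f g = ℤP.≤-trans (ℤP.≤-reflexive (ℤP.*-zeroˡ (ι d * ι d'))) (ι-nonneg d ⊗ (ι-nonneg f ⊕ ι-nonneg g))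
        pt′ (no _) (no _) d' f g = ℤP.≤-reflexive (l (ι d') (ι f + ι g))
          where
          l : ∀ e f → + 1 * (+ 0 * e) ≡ + 0 * f
          l = solve-∀
        pt′ (no _) (yes _) (no _) f g = pos 1 ⊗ (ι-nonneg f ⊕ ι-nonneg g)
        pt′ (no z≢z') (yes (i , j , i≢j , p , q)) (yes (k , l , k≢l , r , t)) f g with four-cycle x≢y z≢z' p q r t i≢j k≢l
        ... | inj₁ refl = al₁ (ι f) (ι g) (ℤP.≤-reflexive (sym (ι-yes f (i , z≢z' , p , r)))) (ι-nonneg g)
        ... | inj₂ refl = subst (λ s → + 1 ≤ + 1 * s) (ℤP.+-comm (ι g) (ι f)) (al₁ (ι g) (ι f) (ℤP.≤-reflexive (sym (ι-yes g (j , z≢z' , q , t)))) (ι-nonneg f))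
        pt : ∀ z z' → ne z z' * (K x y z * K x y z') ≤ K x y z * (ι (coinc? x z z') + ι (coinc? y z z'))
        pt z z' = pt′ (z ≟ z') (cross? x y z) (cross? x y z') (coinc? x z z') (coinc? y z z')
        one : ∀ v z → ∑ (λ z' → ι (coinc? v z z')) ≤ + 1
        one v z = ∑-unique (coinc? v z) (yes refl) (λ _ _ → refl {x = z}) (coinc-unique v z)
        bound : ∑ (λ z → ∑ (λ z' → ne z z' * (K x y z * K x y z'))) ≤ N x y * + 2
        bound = ℤP.≤-trans (∑-mono λ z → ℤP.≤-trans (∑-mono (pt z)) (ℤP.≤-trans (ℤP.≤-reflexive (trans (∑-* (K x y z) _) (cong (K x y z *_) (∑-+ _ _)))) (ℤP.*-monoˡ-≤-nonNeg (K x y z) {{ℤ.nonNegative (K≥0 x y z)}} (ℤP.+-mono-≤ (one x z) (one y z))))) (ℤP.≤-reflexive (∑-*ʳ (+ 2) (K x y)))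
        fin : ∀ N → + 0 ≤ N → N * N - N ≤ N * + 2 → N ≤ + 3
        fin N h b with ≤-case N (+ 3)
        ... | inj₁ p = p
        ... | inj₂ p = ⊥-elim (<-irr (+<+ (s≤s {0} {0} z≤n)) (by (nn b ⊕ (nn q ⊕ pos 4) ⊗ (nn q) ⊕ nn q ⊕ pos 3) (lem N)))
          where
          q : + 4 ≤ N
          q = ℤP.i<j⇒suc[i]≤j p
          lem : ∀ N → + 0 - + 1 ≡ N * + 2 - (N * N - N) + (N - + 4 + + 4) * (N - + 4) + (N - + 4) + + 3
          lem = solve-∀

      -- Two midpoints z, z' give a 4-cycle, in which the pairs at x or those at y belong to one
      -- edge. If this holds at both, two edges have the centers z, z'; if only at x, then z - y -
      -- z' is a crossing path, and likewise with x and y exchanged.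
      cycle-bound : ∀ x y → x ≢ y → ∀ z z' → ne z z' * (K x y z * K x y z') ≤ U x z z' * U y z z' + (U x z z' * K z z' y + U y z z' * K z z' x)
      cycle-bound x y x≢y z z' with z ≟ z' | cross? x y z | cross? x y z'
      ... | yes _ | d | e = ℤP.≤-trans (ℤP.≤-reflexive (ℤP.*-zeroˡ (ι d * ι e))) (U≥0 x z z' ⊗ U≥0 y z z' ⊕ (U≥0 x z z' ⊗ K≥0 z z' y ⊕ U≥0 y z z' ⊗ K≥0 z z' x))
      ... | no _ | no _ | e = ℤP.≤-trans (ℤP.≤-reflexive (l (ι e))) (U≥0 x z z' ⊗ U≥0 y z z' ⊕ (U≥0 x z z' ⊗ K≥0 z z' y ⊕ U≥0 y z z' ⊗ K≥0 z z' x))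
        where
        l : ∀ e → + 1 * (+ 0 * e) ≡ + 0
        l = solve-∀
      ... | no _ | yes _ | no _ = U≥0 x z z' ⊗ U≥0 y z z' ⊕ (U≥0 x z z' ⊗ K≥0 z z' y ⊕ U≥0 y z z' ⊗ K≥0 z z' x)
      ... | no z≢z' | yes (i , j , i≢j , p , q) | yes (k , l , k≢l , r , t) = cases (i ≟ k) (j ≟ l)
        where
        Ux = U x z z'
        Uy = U y z z'
        Kx = K z z' x
        Ky = K z z' y
        lx : i ≡ k → + 1 ≤ Ux
        lx refl = U-one (proj₁ (fork z≢z' p r)) (proj₂ (fork z≢z' p r))
        ly : j ≡ l → + 1 ≤ Uy
        ly refl = U-one (proj₁ (fork z≢z' q t)) (proj₂ (fork z≢z' q t))
        al : ∀ a b c d → + 1 ≤ a → + 1 ≤ b → + 0 ≤ c → + 0 ≤ d → + 1 ≤ a * b + (a * c + b * d)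
        al a b c d e f g h = by (nn e ⊗ nn f ⊕ nn e ⊕ nn f ⊕ ℤP.≤-trans (pos 1) e ⊗ g ⊕ ℤP.≤-trans (pos 1) f ⊗ h) (solve (a ∷ b ∷ c ∷ d ∷ []))
        al₁ : ∀ a b c d → + 1 ≤ a → + 0 ≤ b → + 1 ≤ c → + 0 ≤ d → + 1 ≤ a * b + (a * c + b * d)
        al₁ a b c d e f g h = by (nn e ⊗ nn g ⊕ nn e ⊕ nn g ⊕ ℤP.≤-trans (pos 1) e ⊗ f ⊕ f ⊗ h) (solve (a ∷ b ∷ c ∷ d ∷ []))
        al₂ : ∀ a b c d → + 0 ≤ a → + 1 ≤ b → + 0 ≤ c → + 1 ≤ d → + 1 ≤ a * b + (a * c + b * d)
        al₂ a b c d e f g h = by (nn f ⊗ nn h ⊕ nn f ⊕ nn h ⊕ e ⊗ ℤP.≤-trans (pos 1) f ⊕ e ⊗ g) (solve (a ∷ b ∷ c ∷ d ∷ []))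
        cases : Dec (i ≡ k) → Dec (j ≡ l) → + 1 ≤ Ux * Uy + (Ux * Ky + Uy * Kx)
        cases (yes e) (yes f) = al Ux Uy Ky Kx (lx e) (ly f) (K≥0 z z' y) (K≥0 z z' x)
        cases (yes e) (no f) = al₁ Ux Uy Ky Kx (lx e) (U≥0 y z z') (ℤP.≤-reflexive (sym (ι-yes (cross? z z' y) (j , l , f , inc-sym q , inc-sym t)))) (K≥0 z z' x)
        cases (no e) (yes f) = al₂ Ux Uy Ky Kx (U≥0 x z z') (ly f) (K≥0 z z' y) (ℤP.≤-reflexive (sym (ι-yes (cross? z z' x) (i , k , e , inc-sym p , inc-sym r))))
        cases (no e) (no f) with four-cycle x≢y z≢z' p q r t i≢j k≢l
        ... | inj₁ e' = ⊥-elim (e e')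
        ... | inj₂ f' = ⊥-elim (f f')

      V : Fin n → Fin n → ℤ
      V x y = ∑ (λ z → ∑ (λ z' → U x z z' * U y z z' + (U x z z' * K z z' y + U y z z' * K z z' x)))

      V≥0 : ∀ x y → + 0 ≤ V x y
      V≥0 x y = ∑-nonneg λ z → ∑-nonneg λ z' → U≥0 x z z' ⊗ U≥0 y z z' ⊕ (U≥0 x z z' ⊗ K≥0 z z' y ⊕ U≥0 y z z' ⊗ K≥0 z z' x)

      -- (N - 1)(N - 2) ≥ 0 for integers, so 2 N ≤ 2 + (N² - N), and `cycle-bound` bounds N² - N by
      -- V. Thus a single midpoint is free, and a second one needs a 4-cycle.
      pair-bound : ∀ x y → + 2 * (ne x y * N x y) ≤ + 2 + V x y
      pair-bound x y with x ≟ y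
      ... | yes _ = al (N x y) (V x y) (V≥0 x y)
        where
        al : ∀ N V → + 0 ≤ V → + 2 * (+ 0 * N) ≤ + 2 + V
        al N V h = by (pos 2 ⊕ h) (solve (N ∷ V ∷ []))
      ... | no x≢y = al (N x y) (V x y) (subst (_≤ V x y) (sym (N-square x y)) (∑-mono λ z → ∑-mono λ z' → cycle-bound x y x≢y z z'))
        where
        al : ∀ N V → N * N - N ≤ V → + 2 * (+ 1 * N) ≤ + 2 + V
        al N V h with ≤-case N (+ 1)
        ... | inj₁ q = by (nn h ⊕ nn q ⊗ (nn q ⊕ pos 1)) (lem N V)
          where
          lem : ∀ N V → + 2 + V - + 2 * (+ 1 * N) ≡ V - (N * N - N) + (+ 1 - N) * (+ 1 - N + + 1)
          lem = solve-∀
        ... | inj₂ q = by (nn h ⊕ (nn (ℤP.i<j⇒suc[i]≤j q) ⊕ pos 1) ⊗ nn (ℤP.i<j⇒suc[i]≤j q)) (lem N V)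
          where
          lem : ∀ N V → + 2 + V - + 2 * (+ 1 * N) ≡ V - (N * N - N) + (N - + 2 + + 1) * (N - + 2)
          lem = solve-∀

      WN : ∀ z z' → W z z' * N z z' ≤ + 3 * W z z'
      WN z z' with z ≟ z'
      ... | yes refl = ℤP.≤-reflexive (trans (cong (_* N z z) (W-diag z)) (trans (ℤP.*-zeroˡ (N z z)) (sym (trans (cong (+ 3 *_) (W-diag z)) (ℤP.*-zeroʳ (+ 3))))))
      ... | no ne = subst (W z z' * N z z' ≤_) (ℤP.*-comm (W z z') (+ 3)) (ℤP.*-monoˡ-≤-nonNeg (W z z') {{ℤ.nonNegative (W≥0 z z')}} (N≤3 z z' ne))

      ∑V : ∑ (λ x → ∑ (λ y → V x y)) ≡ ∑ (λ z → ∑ (λ z' → W z z' * W z z' + + 2 * (W z z' * N z z')))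
      ∑V = begin
        ∑ (λ x → ∑ (λ y → V x y))
          ≡⟨ ∑-cong (λ x → trans (∑-swap _) (∑-cong λ z → ∑-swap _)) ⟩
        ∑ (λ x → ∑ (λ z → ∑ (λ z' → ∑ (λ y → U x z z' * U y z z' + (U x z z' * K z z' y + U y z z' * K z z' x)))))
          ≡⟨ trans (∑-swap _) (∑-cong λ z → ∑-swap _) ⟩
        ∑ (λ z → ∑ (λ z' → ∑ (λ x → ∑ (λ y → U x z z' * U y z z' + (U x z z' * K z z' y + U y z z' * K z z' x)))))
          ≡⟨ ∑-cong (λ z → ∑-cong λ z' → inner z z') ⟩
        ∑ (λ z → ∑ (λ z' → W z z' * W z z' + + 2 * (W z z' * N z z'))) ∎
        where
        open ≡-Reasoning
        l : ∀ a b → a * a + (a * b + b * a) ≡ a * a + + 2 * (a * b)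
        l = solve-∀
        inner : ∀ z z' → ∑ (λ x → ∑ (λ y → U x z z' * U y z z' + (U x z z' * K z z' y + U y z z' * K z z' x))) ≡ W z z' * W z z' + + 2 * (W z z' * N z z')
        inner z z' = trans (∑-cong λ x → trans (∑-+ _ _) (cong₂ _+_ (trans (∑-* (U x z z') _) (cong (U x z z' *_) (∑U z z'))) (trans (∑-+ _ _) (cong₂ _+_ (∑-* (U x z z') _) (trans (∑-*ʳ (K z z' x) _) (cong (_* K z z' x) (∑U z z')))))))
          (trans (∑-+ _ _) (trans (cong₂ _+_ (trans (∑-*ʳ (W z z') _) (cong (_* W z z') (∑U z z'))) (trans (∑-+ _ _) (cong₂ _+_ (trans (∑-*ʳ (N z z') _) (cong (_* N z z') (∑U z z'))) (trans (∑-* (W z z') _) refl)))) (trans (cong (λ q → W z z' * W z z' + (W z z' * N z z' + q)) (ℤP.*-comm (W z z') (N z z'))) (l (W z z') (N z z')))))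

      -- W ≤ T gives ∑ W² ≤ ∑ T². The mixed terms 2 W N are at most 6 W by `N≤3`, and W has total 2
      -- m.
      ∑V≤ : ∑ (λ x → ∑ (λ y → V x y)) ≤ ∑ (λ z → T z * T z) + + 12 * + m
      ∑V≤ = ℤP.≤-trans (ℤP.≤-reflexive ∑V) (ℤP.≤-trans (∑-mono λ z → ℤP.≤-trans (∑-mono λ z' → pt z z') (ℤP.≤-reflexive (row z))) (ℤP.≤-reflexive (trans (∑-+ _ _) (cong (_+_ (∑ (λ z → T z * T z))) (trans (∑-* (+ 6) T) (trans (cong (+ 6 *_) ∑T) (l (+ m))))))))
        where
        l : ∀ m → + 6 * (+ 2 * m) ≡ + 12 * m
        l = solve-∀
        pt : ∀ z z' → W z z' * W z z' + + 2 * (W z z' * N z z') ≤ T z * W z z' + + 6 * W z z'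
        pt z z' = al (W z z') (N z z') (T z) (W≤T z z') (W≥0 z z') (WN z z')
          where
          al : ∀ w k t → w ≤ t → + 0 ≤ w → w * k ≤ + 3 * w → w * w + + 2 * (w * k) ≤ t * w + + 6 * w
          al w k t a b c = by (nn a ⊗ b ⊕ pos 2 ⊗ nn c) (solve (w ∷ k ∷ t ∷ []))
        row : ∀ z → ∑ (λ z' → T z * W z z' + + 6 * W z z') ≡ T z * T z + + 6 * T z
        row z = trans (∑-+ _ _) (cong₂ _+_ (trans (∑-* (T z) (W z)) (cong (T z *_) (∑W z))) (trans (∑-* (+ 6) (W z)) (cong (+ 6 *_) (∑W z))))

      ∑s²≤ : + 2 * ∑ (λ z → s z * s z) ≤ + 2 * (+ n * + n) + ∑ (λ z → T z * T z) + + 24 * + m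
      ∑s²≤ = al (∑ (λ z → s z * s z)) (∑ (λ x → ∑ (λ y → ne x y * N x y))) (+ n * + n) (∑ (λ z → T z * T z)) (+ m) step₁ (ℤP.≤-trans step₂ (ℤP.+-monoʳ-≤ (+ 2 * (+ n * + n)) ∑V≤))
        where
        al : ∀ S C nn' TT m → S ≤ + 6 * m + C → + 2 * C ≤ + 2 * nn' + (TT + + 12 * m) → + 2 * S ≤ + 2 * nn' + TT + + 24 * m
        al S C q TT m a b = by (pos 2 ⊗ nn a ⊕ nn b) (solve (S ∷ C ∷ q ∷ TT ∷ m ∷ []))
        step₂ : + 2 * ∑ (λ x → ∑ (λ y → ne x y * N x y)) ≤ + 2 * (+ n * + n) + ∑ (λ x → ∑ (λ y → V x y))
        step₂ = subst₂ _≤_ (trans (∑-cong λ x → ∑-* (+ 2) _) (∑-* (+ 2) _)) (trans (∑-cong λ x → ∑-+ _ _) (trans (∑-+ _ _) (cong (_+ ∑ (λ x → ∑ (λ y → V x y))) (trans (∑-cong {n} λ _ → ∑-const n (+ 2)) (trans (∑-const n (+ n * + 2)) (l (+ n)))))))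
          (∑-mono λ x → ∑-mono λ y → pair-bound x y)
          where
          l : ∀ n → n * (n * + 2) ≡ + 2 * (n * n)
          l = solve-∀
        -- Degenerate paths account for 4 m, the sum of the degrees, and paths inside one edge for 2
        -- m.
        step₁ : ∑ (λ z → s z * s z) ≤ + 6 * + m + ∑ (λ x → ∑ (λ y → ne x y * N x y))
        step₁ = ℤP.≤-trans (∑-mono λ z → ℤP.≤-trans (ℤP.≤-reflexive (∑-∑* (a z) (a z))) (∑-mono λ x → ∑-mono λ y → path-bound z x y)) (ℤP.≤-reflexive (trans (∑-cong row) (trans (∑-+ _ _) (trans (cong₂ _+_ ∑s (trans (∑-+ _ _) (cong₂ _+_ inn crs))) (l (+ m) _)))))
          where
          l : ∀ m c → + 4 * m + (+ 2 * m + c) ≡ + 6 * m + c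
          l = solve-∀
          row : ∀ z → ∑ (λ x → ∑ (λ y → ι (x ≟ y) * a z x + (U z x y + ne x y * K x y z))) ≡ s z + (∑ (λ x → ∑ (λ y → U z x y)) + ∑ (λ x → ∑ (λ y → ne x y * K x y z)))
          row z = trans (∑-cong λ x → trans (∑-+ _ _) (cong₂ _+_ (trans (∑-cong λ y → cong (_* a z x) (ι-cong (x ≟ y) (y ≟ x) sym sym)) (∑-δ x (λ _ → a z x))) (∑-+ _ _))) (trans (∑-+ _ _) (cong (_+_ (s z)) (∑-+ _ _)))
          inn : ∑ (λ z → ∑ (λ x → ∑ (λ y → U z x y))) ≡ + 2 * + m
          inn = trans (∑-swap _) (trans (∑-cong λ x → trans (∑-swap _) (trans (∑-cong λ y → ∑U x y) (∑W x))) ∑T)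
          crs : ∑ (λ z → ∑ (λ x → ∑ (λ y → ne x y * K x y z))) ≡ ∑ (λ x → ∑ (λ y → ne x y * N x y))
          crs = trans (∑-swap _) (∑-cong λ x → trans (∑-swap _) (∑-cong λ y → ∑-* (ne x y) (K x y)))

      edge-bound : + 81 * (+ m * + m) ≤ + 8 * (+ n * (+ n * + n)) + + 96 * (+ n * + m)
      edge-bound = al (+ n) (+ m) (∑ v) (∑ (λ z → v z * v z)) (∑ (λ z → s z * s z)) (∑ (λ z → T z * T z)) ∑v (cauchy-schwarz v) v² ∑s²≤ (pos n)
        where
        -- For p, T ≥ 0, s² - T²/2 ≥ (2 p + T/√2)². The rational form 5 p + 2 T lies below √8 (2 p +
        -- T/√2) and still yields 81/8 > 10.
        v : Fin n → ℤ
        v z = + 5 * p z + + 2 * T z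
        ∑v : ∑ v ≡ + 9 * + m
        ∑v = trans (∑-+ _ _) (trans (cong₂ _+_ (trans (∑-* (+ 5) p) (cong (+ 5 *_) ∑p)) (trans (∑-* (+ 2) T) (cong (+ 2 *_) ∑T))) (l (+ m)))
          where
          l : ∀ m → + 5 * m + + 2 * (+ 2 * m) ≡ + 9 * m
          l = solve-∀
        p≥0 : ∀ z → + 0 ≤ p z
        p≥0 z = ∑-nonneg λ i → L≥0 i z
        T≥0 : ∀ z → + 0 ≤ T z
        T≥0 z = ∑-nonneg λ i → C≥0 i z
        v² : ∑ (λ z → v z * v z) ≤ + 8 * ∑ (λ z → s z * s z) + - + 4 * ∑ (λ z → T z * T z)
        v² = subst (∑ (λ z → v z * v z) ≤_) (trans (∑-+ _ _) (cong₂ _+_ (∑-* (+ 8) _) (∑-* (- + 4) _))) (∑-mono λ z → sq (p z) (T z) (s z) (s≡ z) (p≥0 z) (T≥0 z))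
          where
          sq : ∀ p T s → s ≡ + 2 * p + T → + 0 ≤ p → + 0 ≤ T → (+ 5 * p + + 2 * T) * (+ 5 * p + + 2 * T) ≤ + 8 * (s * s) + - + 4 * (T * T)
          sq p T _ refl a b = by (pos 7 ⊗ (a ⊗ a) ⊕ pos 12 ⊗ (a ⊗ b)) (solve (p ∷ T ∷ []))
        al : ∀ n m Sv Vv SS TT → Sv ≡ + 9 * m → Sv * Sv ≤ n * Vv → Vv ≤ + 8 * SS + - + 4 * TT → + 2 * SS ≤ + 2 * (n * n) + TT + + 24 * m → + 0 ≤ n → + 81 * (m * m) ≤ + 8 * (n * (n * n)) + + 96 * (n * m)
        al n m _ Vv SS TT refl a b c n≥0 = by (nn a ⊕ n≥0 ⊗ nn b ⊕ pos 4 ⊗ (n≥0 ⊗ nn c)) (solve (n ∷ m ∷ Vv ∷ SS ∷ TT ∷ []))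

  -- Choosing the designated vertices

  least : ∀ {m} (P : Fin m → Set) → (∀ i → Dec (P i)) → (∃[ k ] (P k × (∀ j → P j → toℕ k ℕ.≤ toℕ j))) ⊎ (∀ j → ¬ P j)
  least {zero} P P? = inj₂ λ ()
  least {suc m} P P? with P? zero
  ... | yes p = inj₁ (zero , p , λ _ _ → z≤n)
  ... | no ¬p with least (P ∘ suc) (P? ∘ suc)
  ...   | inj₁ (k , p , min) = inj₁ (suc k , p , λ { zero q → ⊥-elim (¬p q) ; (suc j) q → s≤s (min j q) })
  ...   | inj₂ none = inj₂ λ { zero → ¬p ; (suc j) → none j }

  ∈₃? : ∀ {n} (v : Fin n) (e : Triple n) → Dec (v ∈₃ e)
  ∈₃? v e = (v ≟ Triple.a e) ⊎-dec ((v ≟ Triple.b e) ⊎-dec (v ≟ Triple.c e))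

  third : ∀ {n} (e : Triple n) u v → u ≢ v → u ∈₃ e → v ∈₃ e → ∃[ w ] (w ∈₃ e × (w ≢ u × (w ≢ v × (∀ y → y ∈₃ e → (y ≡ w) ⊎ ((y ≡ u) ⊎ (y ≡ v))))))
  third e u v ne p q = go p q
    where
    a = Triple.a e
    b = Triple.b e
    c = Triple.c e
    a≢b : a ≢ b
    a≢b h = <-irrefl (cong toℕ h) (Triple.a<b e)
    b≢c : b ≢ c
    b≢c h = <-irrefl (cong toℕ h) (Triple.b<c e)
    a≢c : a ≢ c
    a≢c h = <-irrefl (cong toℕ h) (<-trans (Triple.a<b e) (Triple.b<c e))
    go : u ∈₃ e → v ∈₃ e → ∃[ w ] (w ∈₃ e × (w ≢ u × (w ≢ v × (∀ y → y ∈₃ e → (y ≡ w) ⊎ ((y ≡ u) ⊎ (y ≡ v))))))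
    go (inj₁ refl) (inj₁ refl) = ⊥-elim (ne refl)
    go (inj₂ (inj₁ refl)) (inj₂ (inj₁ refl)) = ⊥-elim (ne refl)
    go (inj₂ (inj₂ refl)) (inj₂ (inj₂ refl)) = ⊥-elim (ne refl)
    go (inj₁ refl) (inj₂ (inj₁ refl)) = c , inj₂ (inj₂ refl) , (λ h → a≢c (sym h)) , (λ h → b≢c (sym h)) , λ { y (inj₁ h) → inj₂ (inj₁ h) ; y (inj₂ (inj₁ h)) → inj₂ (inj₂ h) ; y (inj₂ (inj₂ h)) → inj₁ h }
    go (inj₂ (inj₁ refl)) (inj₁ refl) = c , inj₂ (inj₂ refl) , (λ h → b≢c (sym h)) , (λ h → a≢c (sym h)) , λ { y (inj₁ h) → inj₂ (inj₂ h) ; y (inj₂ (inj₁ h)) → inj₂ (inj₁ h) ; y (inj₂ (inj₂ h)) → inj₁ h }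
    go (inj₁ refl) (inj₂ (inj₂ refl)) = b , inj₂ (inj₁ refl) , (λ h → a≢b (sym h)) , b≢c , λ { y (inj₁ h) → inj₂ (inj₁ h) ; y (inj₂ (inj₁ h)) → inj₁ h ; y (inj₂ (inj₂ h)) → inj₂ (inj₂ h) }
    go (inj₂ (inj₂ refl)) (inj₁ refl) = b , inj₂ (inj₁ refl) , b≢c , (λ h → a≢b (sym h)) , λ { y (inj₁ h) → inj₂ (inj₂ h) ; y (inj₂ (inj₁ h)) → inj₁ h ; y (inj₂ (inj₂ h)) → inj₂ (inj₁ h) }
    go (inj₂ (inj₁ refl)) (inj₂ (inj₂ refl)) = a , inj₁ refl , a≢b , a≢c , λ { y (inj₁ h) → inj₁ h ; y (inj₂ (inj₁ h)) → inj₂ (inj₁ h) ; y (inj₂ (inj₂ h)) → inj₂ (inj₂ h) }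
    go (inj₂ (inj₂ refl)) (inj₂ (inj₁ refl)) = a , inj₁ refl , a≢c , a≢b , λ { y (inj₁ h) → inj₁ h ; y (inj₂ (inj₁ h)) → inj₂ (inj₂ h) ; y (inj₂ (inj₂ h)) → inj₂ (inj₁ h) }

  triple-ext : ∀ {n} (e f : Triple n) → (∀ y → y ∈₃ e → y ∈₃ f) → (∀ y → y ∈₃ f → y ∈₃ e) → e ≡ f
  triple-ext e f ef fe = build e f a≡ b≡ c≡
    where
    min : ∀ (e : Triple _) y → y ∈₃ e → toℕ (Triple.a e) ℕ.≤ toℕ y
    min e y (inj₁ refl) = ≤-refl
    min e y (inj₂ (inj₁ refl)) = <⇒≤ (Triple.a<b e)
    min e y (inj₂ (inj₂ refl)) = <⇒≤ (<-trans (Triple.a<b e) (Triple.b<c e))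
    max : ∀ (e : Triple _) y → y ∈₃ e → toℕ y ℕ.≤ toℕ (Triple.c e)
    max e y (inj₁ refl) = <⇒≤ (<-trans (Triple.a<b e) (Triple.b<c e))
    max e y (inj₂ (inj₁ refl)) = <⇒≤ (Triple.b<c e)
    max e y (inj₂ (inj₂ refl)) = ≤-refl
    a≡ : Triple.a e ≡ Triple.a f
    a≡ = toℕ-injective (≤-antisym (min e _ (fe _ (inj₁ refl))) (min f _ (ef _ (inj₁ refl))))
    c≡ : Triple.c e ≡ Triple.c f
    c≡ = toℕ-injective (≤-antisym (max f _ (ef _ (inj₂ (inj₂ refl)))) (max e _ (fe _ (inj₂ (inj₂ refl)))))
    b≡ : Triple.b e ≡ Triple.b f
    b≡ = go (ef _ (inj₂ (inj₁ refl)))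
      where
      go : Triple.b e ∈₃ f → Triple.b e ≡ Triple.b f
      go (inj₁ h) = ⊥-elim (<-irrefl (cong toℕ (trans a≡ (sym h))) (Triple.a<b e))
      go (inj₂ (inj₁ h)) = h
      go (inj₂ (inj₂ h)) = ⊥-elim (<-irrefl (cong toℕ (trans h (sym c≡))) (Triple.b<c e))
    build : ∀ (e f : Triple _) → Triple.a e ≡ Triple.a f → Triple.b e ≡ Triple.b f → Triple.c e ≡ Triple.c f → e ≡ f
    build (triple a b c p q) (triple _ _ _ p' q') refl refl refl = cong₂ (triple a b c) (<-irrelevant p p') (<-irrelevant q q')

  ∈₃-one-of : ∀ {n} (e : Triple n) {u v w y : Fin n} → u ≢ v → u ≢ w → v ≢ w → u ∈₃ e → v ∈₃ e → w ∈₃ e → y ∈₃ e → (y ≡ w) ⊎ ((y ≡ u) ⊎ (y ≡ v))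
  ∈₃-one-of e {u} {v} {w} {y} u≢v u≢w v≢w p q r s with third e u v u≢v p q
  ... | w' , _ , _ , _ , only with only w r | only y s
  ...   | inj₁ refl | h = h
  ...   | inj₂ (inj₁ h) | _ = ⊥-elim (u≢w (sym h))
  ...   | inj₂ (inj₂ h) | _ = ⊥-elim (v≢w (sym h))

  share-three : ∀ {n} (e f : Triple n) {u v w : Fin n} → u ≢ v → u ≢ w → v ≢ w → u ∈₃ e → v ∈₃ e → w ∈₃ e → u ∈₃ f → v ∈₃ f → w ∈₃ f → e ≡ f
  share-three e f {u} {v} {w} u≢v u≢w v≢w p q r p' q' r' = triple-ext e f (λ y h → to f p' q' r' (∈₃-one-of e u≢v u≢w v≢w p q r h)) (λ y h → to e p q r (∈₃-one-of f u≢v u≢w v≢w p' q' r' h))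
    where
    to : ∀ f {y} → u ∈₃ f → v ∈₃ f → w ∈₃ f → (y ≡ w) ⊎ ((y ≡ u) ⊎ (y ≡ v)) → y ∈₃ f
    to f p q r (inj₁ refl) = r
    to f p q r (inj₂ (inj₁ refl)) = p
    to f p q r (inj₂ (inj₂ refl)) = q

  no-four : ∀ {n} (e : Triple n) {u v w y : Fin n} → u ≢ v → u ≢ w → v ≢ w → y ≢ u → y ≢ v → y ≢ w → u ∈₃ e → v ∈₃ e → w ∈₃ e → y ∈₃ e → ⊥
  no-four e u≢v u≢w v≢w y≢u y≢v y≢w p q r s with ∈₃-one-of e u≢v u≢w v≢w p q r s
  ... | inj₁ h = y≢w h
  ... | inj₂ (inj₁ h) = y≢u h
  ... | inj₂ (inj₂ h) = y≢v h

  module Leaves (n m : ℕ) (E : Fin m → Triple n) (E-injective : ∀ {i j} → E i ≡ E j → i ≡ j)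
    (no-C4 : ∀ {v₁ v₂ v₃ v₄ : Fin n} {i j k l : Fin m} → v₁ ≢ v₂ → v₁ ≢ v₃ → v₁ ≢ v₄ → v₂ ≢ v₃ → v₂ ≢ v₄ → v₃ ≢ v₄ →
      i ≢ j → i ≢ k → i ≢ l → j ≢ k → j ≢ l → k ≢ l →
      v₁ ∈₃ E i → v₂ ∈₃ E i → v₂ ∈₃ E j → v₃ ∈₃ E j → v₃ ∈₃ E k → v₄ ∈₃ E k → v₄ ∈₃ E l → v₁ ∈₃ E l → ⊥) where

    Shares : Fin m → Fin m → Fin n → Fin n → Set
    Shares i j u v = (u ≢ v) × ((u ∈₃ E i × v ∈₃ E i) × (u ∈₃ E j × v ∈₃ E j))

    Adj : Fin m → Fin m → Set
    Adj i j = (i ≢ j) × ∃[ u ] ∃[ v ] Shares i j u v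

    adj? : ∀ i j → Dec (Adj i j)
    adj? i j = ¬? (i ≟ j) ×-dec any? λ u → any? λ v → ¬? (u ≟ v) ×-dec ((∈₃? u (E i) ×-dec ∈₃? v (E i)) ×-dec (∈₃? u (E j) ×-dec ∈₃? v (E j)))

    -- k follows i in the cyclic order of the edges meeting i in two vertices.
    Follows : Fin m → Fin m → Set
    Follows i k = (∀ j → Adj i j → toℕ i ℕ.< toℕ j → (toℕ i ℕ.< toℕ k) × (toℕ k ℕ.≤ toℕ j)) × (¬ (toℕ i ℕ.< toℕ k) → ∀ j → Adj i j → toℕ k ℕ.≤ toℕ j)

    next : ∀ i → (∃[ k ] (Adj i k × Follows i k)) ⊎ (∀ j → ¬ Adj i j)
    next i with least (λ j → (toℕ i ℕ.< toℕ j) × Adj i j) (λ j → (toℕ i ℕ.<? toℕ j) ×-dec adj? i j)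
    ... | inj₁ (k , (i<k , ad) , min) = inj₁ (k , ad , (λ j h i<j → i<k , min j (i<j , h)) , λ i≮k → ⊥-elim (i≮k i<k))
    ... | inj₂ none with least (Adj i) (adj? i)
    ...   | inj₁ (k , ad , min) = inj₁ (k , ad , (λ j h i<j → ⊥-elim (none j (i<j , h))) , λ _ → min)
    ...   | inj₂ none' = inj₂ none'

    -- The centers are two vertices shared with the edge that follows i, and the leaf is the
    -- remaining one. The successor k supplies the additional edge through both centers that closes
    -- a Berge cycle when two edges have a pair in common.
    record Leaf (i : Fin m) : Set where
      field
        w c c' : Fin n
        w≢c : w ≢ c
        w≢c' : w ≢ c'
        c≢c' : c ≢ c'
        w∈ : w ∈₃ E i
        c∈ : c ∈₃ E i
        c'∈ : c' ∈₃ E i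
        link : (∃[ k ] ((k ≢ i) × (Follows i k × (c ∈₃ E k × c' ∈₃ E k)))) ⊎ (∀ j → ¬ Adj i j)

    leaf : ∀ i → Leaf i
    leaf i with next i
    ... | inj₂ none = record { w = Triple.a (E i) ; c = Triple.b (E i) ; c' = Triple.c (E i)
        ; w≢c = λ h → <-irrefl (cong toℕ h) (Triple.a<b (E i))
        ; w≢c' = λ h → <-irrefl (cong toℕ h) (<-trans (Triple.a<b (E i)) (Triple.b<c (E i)))
        ; c≢c' = λ h → <-irrefl (cong toℕ h) (Triple.b<c (E i))
        ; w∈ = inj₁ refl ; c∈ = inj₂ (inj₁ refl) ; c'∈ = inj₂ (inj₂ refl) ; link = inj₂ none }
    ... | inj₁ (k , (i≢k , u , v , u≢v , (u∈ , v∈) , (u∈k , v∈k)) , fol) with third (E i) u v u≢v u∈ v∈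
    ...   | x , x∈ , x≢u , x≢v , _ = record { w = x ; c = u ; c' = v ; w≢c = x≢u ; w≢c' = x≢v ; c≢c' = u≢v
        ; w∈ = x∈ ; c∈ = u∈ ; c'∈ = v∈ ; link = inj₁ (k , (λ h → i≢k (sym h)) , fol , u∈k , v∈k) }

    open Count n m (λ i → Leaf.w (leaf i)) (λ i → Leaf.c (leaf i)) (λ i → Leaf.c' (leaf i)) (λ i → Leaf.w≢c (leaf i)) (λ i → Leaf.w≢c' (leaf i)) (λ i → Leaf.c≢c' (leaf i))

    center∈ : ∀ i {x} → Center i x → x ∈₃ E i
    center∈ i (inj₁ refl) = Leaf.c∈ (leaf i)
    center∈ i (inj₂ refl) = Leaf.c'∈ (leaf i)

    inc∈ : ∀ {i z x} → Inc i z x → (z ∈₃ E i) × (x ∈₃ E i)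
    inc∈ {i} (inj₁ (refl , h)) = Leaf.w∈ (leaf i) , center∈ i h
    inc∈ {i} (inj₂ (refl , h)) = center∈ i h , Leaf.w∈ (leaf i)

    -- The edge i = {z,x,o} with leaf z, and the edge k ∋ x,o that follows it.
    record View (i : Fin m) (z x : Fin n) : Set where
      field
        o : Fin n
        k : Fin m
        z≢x : z ≢ x
        o≢z : o ≢ z
        o≢x : o ≢ x
        z∈ : z ∈₃ E i
        x∈ : x ∈₃ E i
        o∈ : o ∈₃ E i
        k≢i : k ≢ i
        x∈k : x ∈₃ E k
        o∈k : o ∈₃ E k
        fol : Follows i k

    view : ∀ {i j z x} → Adj i j → z ≡ Leaf.w (leaf i) → Center i x → View i z x
    view {i} {j} ad refl h with Leaf.link (leaf i)
    ... | inj₂ none = ⊥-elim (none j ad)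
    ... | inj₁ (k , k≢i , fol , c∈k , c'∈k) with h
    ...   | inj₁ refl = record { o = Leaf.c' (leaf i) ; k = k ; z≢x = Leaf.w≢c (leaf i) ; o≢z = λ e → Leaf.w≢c' (leaf i) (sym e) ; o≢x = λ e → Leaf.c≢c' (leaf i) (sym e)
          ; z∈ = Leaf.w∈ (leaf i) ; x∈ = Leaf.c∈ (leaf i) ; o∈ = Leaf.c'∈ (leaf i) ; k≢i = k≢i ; x∈k = c∈k ; o∈k = c'∈k ; fol = fol }
    ...   | inj₂ refl = record { o = Leaf.c (leaf i) ; k = k ; z≢x = Leaf.w≢c' (leaf i) ; o≢z = λ e → Leaf.w≢c (leaf i) (sym e) ; o≢x = Leaf.c≢c' (leaf i)
          ; z∈ = Leaf.w∈ (leaf i) ; x∈ = Leaf.c'∈ (leaf i) ; o∈ = Leaf.c∈ (leaf i) ; k≢i = k≢i ; x∈k = c'∈k ; o∈k = c∈k ; fol = fol }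

    outside : ∀ {i j} {z x o o' : Fin n} → i ≢ j → z ≢ x → o ≢ z → o ≢ x → z ∈₃ E i → x ∈₃ E i → o ∈₃ E i → z ∈₃ E j → x ∈₃ E j → o' ∈₃ E j → o' ≢ z → o' ≢ x → ¬ (o' ∈₃ E i)
    outside {i} {j} i≢j z≢x o≢z o≢x z∈ x∈ o∈ z∈j x∈j o'∈j o'≢z o'≢x h with ∈₃-one-of (E i) z≢x (λ e → o≢z (sym e)) (λ e → o≢x (sym e)) z∈ x∈ o∈ h
    ... | inj₂ (inj₁ e) = o'≢z e
    ... | inj₂ (inj₂ e) = o'≢x e
    ... | inj₁ refl = i≢j (E-injective (share-three (E i) (E j) z≢x (λ e → o≢z (sym e)) (λ e → o≢x (sym e)) z∈ x∈ o∈ z∈j x∈j o'∈j))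

    -- Write i = {z, x, o} and j = {z, x, o'} with leaves z and x. The successor of i contains x, o
    -- and that of j contains z, o', so x, o, z, o' is a Berge cycle through the successor of i, i,
    -- the successor of j, and j.
    clash-opposite : ∀ {i j z x} → i ≢ j → View i z x → View j x z → ⊥
    clash-opposite {i} {j} {z} {x} i≢j A B = no-C4 {x} {Vi.o} {z} {Vj.o} {Vi.k} {i} {Vj.k} {j}
        (λ e → Vi.o≢x (sym e)) Vj.z≢x (λ e → Vj.o≢z (sym e)) Vi.o≢z (λ e → o∉j (subst (_∈₃ E j) (sym e) Vj.o∈)) (λ e → Vj.o≢x (sym e))
        Vi.k≢i (λ e → no-four (E Vi.k) (λ h → Vi.o≢x (sym h)) Vj.z≢x Vi.o≢z Vj.o≢z (λ e → o∉j (subst (_∈₃ E j) e Vj.o∈)) Vj.o≢x Vi.x∈k Vi.o∈k (subst (λ k → z ∈₃ E k) (sym e) Vj.x∈k) (subst (λ k → Vj.o ∈₃ E k) (sym e) Vj.o∈k))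
        (λ e → o∉j (subst (λ k → Vi.o ∈₃ E k) e Vi.o∈k)) (λ e → o'∉i (subst (λ k → Vj.o ∈₃ E k) (sym e) Vj.o∈k)) i≢j Vj.k≢i
        Vi.x∈k Vi.o∈k Vi.o∈ Vi.z∈ Vj.x∈k Vj.o∈k Vj.o∈ Vj.z∈
      where
      module Vi = View A
      module Vj = View B
      o∉j : ¬ (Vi.o ∈₃ E j)
      o∉j = outside (λ e → i≢j (sym e)) Vi.z≢x Vj.o≢x Vj.o≢z Vj.x∈ Vj.z∈ Vj.o∈ Vi.z∈ Vi.x∈ Vi.o∈ Vi.o≢z Vi.o≢x
      o'∉i : ¬ (Vj.o ∈₃ E i)
      o'∉i = outside i≢j Vi.z≢x Vi.o≢z Vi.o≢x Vi.z∈ Vi.x∈ Vi.o∈ Vj.x∈ Vj.z∈ Vj.o∈ Vj.o≢x Vj.o≢z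

    -- With i < j, k follows i gives i < k ≤ j, while k follows j gives k ≤ i.
    follows-ordered : ∀ {i j k} → Adj i j → Adj j i → Follows i k → Follows j k → toℕ i ℕ.< toℕ j → ⊥
    follows-ordered {i} {j} ij ji fi fj i<j = <⇒≱ (proj₁ (proj₁ fi j ij i<j)) (proj₂ fj (≤⇒≯ (proj₂ (proj₁ fi j ij i<j))) i ji)

    follows-once : ∀ {i j k} → Adj i j → Adj j i → Follows i k → Follows j k → ⊥
    follows-once {i} {j} ij ji fi fj with <-cmp (toℕ i) (toℕ j)
    ... | tri≈ _ e _ = proj₁ ij (toℕ-injective e)
    ... | tri< i<j _ _ = follows-ordered ij ji fi fj i<j
    ... | tri> _ _ j<i = follows-ordered ji ij fj fi j<i

    -- Now z is the leaf of both edges and their successors contain x, o and x, o'. Different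
    -- successors give the Berge cycle o, z, o', x through i, j and both successors; a common one is
    -- excluded by `follows-once`, the purpose of the cyclic order.
    clash-same : ∀ {i j z x} → i ≢ j → View i z x → View j z x → ⊥
    clash-same {i} {j} {z} {x} i≢j A B = go (Vj.k ≟ Vi.k)
      where
      module Vi = View A
      module Vj = View B
      o∉j : ¬ (Vi.o ∈₃ E j)
      o∉j = outside (λ e → i≢j (sym e)) Vj.z≢x Vj.o≢z Vj.o≢x Vj.z∈ Vj.x∈ Vj.o∈ Vi.z∈ Vi.x∈ Vi.o∈ Vi.o≢z Vi.o≢x
      o'∉i : ¬ (Vj.o ∈₃ E i)
      o'∉i = outside i≢j Vi.z≢x Vi.o≢z Vi.o≢x Vi.z∈ Vi.x∈ Vi.o∈ Vj.z∈ Vj.x∈ Vj.o∈ Vj.o≢z Vj.o≢x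
      go : Dec (Vj.k ≡ Vi.k) → ⊥
      go (yes e) = follows-once {i} {j} {Vi.k}
        (i≢j , z , x , Vi.z≢x , (Vi.z∈ , Vi.x∈) , (Vj.z∈ , Vj.x∈)) ((λ h → i≢j (sym h)) , z , x , Vi.z≢x , (Vj.z∈ , Vj.x∈) , (Vi.z∈ , Vi.x∈))
        Vi.fol (subst (Follows j) e Vj.fol)
      go (no ne) = no-C4 {Vi.o} {z} {Vj.o} {x} {i} {j} {Vj.k} {Vi.k}
        Vi.o≢z (λ e → o∉j (subst (_∈₃ E j) (sym e) Vj.o∈)) Vi.o≢x (λ e → Vj.o≢z (sym e)) Vi.z≢x Vj.o≢x
        i≢j (λ e → o'∉i (subst (λ k → Vj.o ∈₃ E k) (sym e) Vj.o∈k)) (λ e → Vi.k≢i (sym e)) (λ e → Vj.k≢i (sym e)) (λ e → o∉j (subst (λ k → Vi.o ∈₃ E k) (sym e) Vi.o∈k)) ne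
        Vi.o∈ Vi.z∈ Vj.z∈ Vj.o∈ Vj.o∈k Vj.x∈k Vi.x∈k Vi.o∈k

    simple : ∀ {i j z x} → Inc i z x → Inc j z x → i ≡ j
    simple {i} {j} {z} {x} p q = go (i ≟ j)
      where
      z≢x : z ≢ x
      z≢x = inc-≢ p
      cases : i ≢ j → Adj i j → Adj j i → Inc i z x → Inc j z x → ⊥
      cases ne ij ji (inj₁ (e , h)) (inj₁ (e' , h')) = clash-same ne (view ij e h) (view ji e' h')
      cases ne ij ji (inj₁ (e , h)) (inj₂ (e' , h')) = clash-opposite ne (view ij e h) (view ji e' h')
      cases ne ij ji (inj₂ (e , h)) (inj₁ (e' , h')) = clash-opposite ne (view ij e h) (view ji e' h')
      cases ne ij ji (inj₂ (e , h)) (inj₂ (e' , h')) = clash-same ne (view ij e h) (view ji e' h')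
      go : Dec (i ≡ j) → i ≡ j
      go (yes e) = e
      go (no ne) = ⊥-elim (cases ne (ne , z , x , z≢x , inc∈ p , inc∈ q) ((λ e → ne (sym e)) , z , x , z≢x , inc∈ q , inc∈ p) p q)

    -- Otherwise the four edges are distinct and x, z, y, z' is a Berge cycle; opposite edges of the
    -- cycle cannot coincide, since such an edge would contain four vertices.
    four-cycle : ∀ {x y z z' i j k l} → x ≢ y → z ≢ z' → Inc i z x → Inc j z y → Inc k z' x → Inc l z' y → i ≢ j → k ≢ l → (i ≡ k) ⊎ (j ≡ l)
    four-cycle {x} {y} {z} {z'} {i} {j} {k} {l} x≢y z≢z' p q r t i≢j k≢l = go (i ≟ k) (j ≟ l)
      where
      apart : ∀ {e} → z ∈₃ E e → x ∈₃ E e → z' ∈₃ E e → y ∈₃ E e → ⊥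
      apart {e} a b c d = no-four (E e) (inc-≢ p) z≢z' (λ h → inc-≢ r (sym h)) (λ h → inc-≢ q (sym h)) (λ h → x≢y (sym h)) (λ h → inc-≢ t (sym h)) a b c d
      go : Dec (i ≡ k) → Dec (j ≡ l) → (i ≡ k) ⊎ (j ≡ l)
      go (yes e) _ = inj₁ e
      go (no _) (yes e) = inj₂ e
      go (no i≢k) (no j≢l) = ⊥-elim (no-C4 {x} {z} {y} {z'} {i} {j} {l} {k}
        (λ h → inc-≢ p (sym h)) x≢y (λ h → inc-≢ r (sym h)) (inc-≢ q) z≢z' (λ h → inc-≢ t (sym h))
        i≢j (λ { refl → apart (proj₁ (inc∈ p)) (proj₂ (inc∈ p)) (proj₁ (inc∈ t)) (proj₂ (inc∈ t)) }) i≢k j≢l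
        (λ { refl → apart (proj₁ (inc∈ q)) (proj₂ (inc∈ r)) (proj₁ (inc∈ r)) (proj₂ (inc∈ q)) }) (λ e → k≢l (sym e))
        (proj₂ (inc∈ p)) (proj₁ (inc∈ p)) (proj₁ (inc∈ q)) (proj₂ (inc∈ q)) (proj₂ (inc∈ t)) (proj₁ (inc∈ t)) (proj₁ (inc∈ r)) (proj₂ (inc∈ r)))

    edge-inequality : + 81 * (+ m * + m) ≤ + 8 * (+ n * (+ n * + n)) + + 96 * (+ n * + m)
    edge-inequality = Bound.edge-bound simple four-cycle

  open import Defs
  open import Data.List using (length; map; allFin; cartesianProduct)
  open import Data.List.Properties using (length-map; length-++; length-tabulate)
  open import Data.List.Membership.Propositional using (_∈_)
  open import Data.List.Membership.Propositional.Properties using (∈-map⁻)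
  import Data.List.Relation.Unary.Unique.Propositional.Properties as Unique

  -- The affine plane with doubled lines

  length-cartesianProduct : ∀ {A B : Set} (xs : List A) (ys : List B) → length (cartesianProduct xs ys) ≡ length xs ℕ.* length ys
  length-cartesianProduct [] ys = refl
  length-cartesianProduct (x ∷ xs) ys = trans (length-++ (map (x ,_) ys)) (cong₂ ℕ._+_ (length-map (x ,_) ys) (length-cartesianProduct xs ys))

  module AffinePlane (q : ℕ) (pq : Prime q) (n : ℕ) (3qq≤n : 3 ℕ.* (q ℕ.* q) ℕ.≤ n) where

    Q : ℕ
    Q = q ℕ.* q

    instance
      q≢0 : NonZero q
      q≢0 = prime⇒nonZero pq

    -- The line y = a x + b has the number b + a q.
    slope icept : Fin Q → ℕ
    slope l = toℕ l ℕ./ q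
    icept l = toℕ l ℕ.% q

    line≡ : ∀ l l' → slope l ≡ slope l' → icept l ≡ icept l' → l ≡ l'
    line≡ l l' s i = toℕ-injective (trans (DM.m≡m%n+[m/n]*n (toℕ l) q) (trans (cong₂ (λ a b → a ℕ.+ b ℕ.* q) i s) (sym (DM.m≡m%n+[m/n]*n (toℕ l') q))))

    slope< : ∀ l → slope l ℕ.< q
    slope< l = DM.m<n*o⇒m/o<n (toℕ<n l)

    ordinate : Fin q → Fin Q → ℕ
    ordinate x l = (slope l ℕ.* toℕ x ℕ.+ icept l) ℕ.% q

    -- Vertices: points in [0,Q), the two copies of a line in [Q,2Q) and [2Q,3Q).
    pt : Fin q → Fin Q → ℕ
    pt x l = ordinate x l ℕ.+ toℕ x ℕ.* q

    pt<Q : ∀ x l → pt x l ℕ.< Q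
    pt<Q x l = <-≤-trans (+-monoˡ-< (toℕ x ℕ.* q) (DM.m%n<n (slope l ℕ.* toℕ x ℕ.+ icept l) q)) (*-monoˡ-≤ q (toℕ<n x))

    pt-x : ∀ {x l x' l'} → pt x l ≡ pt x' l' → x ≡ x'
    pt-x {x} {l} {x'} {l'} e = toℕ-injective (trans (sym (quo x l)) (trans (cong (ℕ._/ q) e) (quo x' l')))
      where
      quo : ∀ x l → pt x l ℕ./ q ≡ toℕ x
      quo x l = trans (DM.+-distrib-/-∣ʳ (ordinate x l) (divides (toℕ x) refl)) (cong₂ ℕ._+_ (DM.m<n⇒m/n≡0 (DM.m%n<n (slope l ℕ.* toℕ x ℕ.+ icept l) q)) (DM.m*n/n≡m (toℕ x) q))

    pt-y : ∀ {x l x' l'} → pt x l ≡ pt x' l' → ordinate x l ≡ ordinate x' l'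
    pt-y {x} {l} {x'} {l'} e = +-cancelʳ-≡ (toℕ x ℕ.* q) _ _ (trans e (cong (λ z → ordinate x' l' ℕ.+ toℕ z ℕ.* q) (sym (pt-x {x} {l} {x'} {l'} e))))

    3Q≤n : Q ℕ.+ (Q ℕ.+ Q) ℕ.≤ n
    3Q≤n = subst (ℕ._≤ n) (cong (λ z → Q ℕ.+ (Q ℕ.+ z)) (+-identityʳ Q)) 3qq≤n

    l₁ l₂ : Fin Q → ℕ
    l₁ l = Q ℕ.+ toℕ l
    l₂ l = Q ℕ.+ (Q ℕ.+ toℕ l)

    l₂<n : ∀ l → l₂ l ℕ.< n
    l₂<n l = <-≤-trans (+-monoʳ-< Q (+-monoʳ-< Q (toℕ<n l))) 3Q≤n

    l₁<l₂ : ∀ l → l₁ l ℕ.< l₂ l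
    l₁<l₂ l = +-monoʳ-< Q (<-≤-trans (toℕ<n l) (m≤m+n Q (toℕ l)))

    l₁<n : ∀ l → l₁ l ℕ.< n
    l₁<n l = <-trans (l₁<l₂ l) (l₂<n l)

    pt<l₁ : ∀ x l l' → pt x l ℕ.< l₁ l'
    pt<l₁ x l l' = <-≤-trans (pt<Q x l) (m≤m+n Q (toℕ l'))

    pt<n : ∀ x l → pt x l ℕ.< n
    pt<n x l = <-trans (pt<l₁ x l l) (l₁<n l)

    flag : Fin q × Fin Q → Triple n
    flag (x , l) = triple (fromℕ< (pt<n x l)) (fromℕ< (l₁<n l)) (fromℕ< (l₂<n l))
      (subst₂ ℕ._<_ (sym (toℕ-fromℕ< (pt<n x l))) (sym (toℕ-fromℕ< (l₁<n l))) (pt<l₁ x l l))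
      (subst₂ ℕ._<_ (sym (toℕ-fromℕ< (l₁<n l))) (sym (toℕ-fromℕ< (l₂<n l))) (l₁<l₂ l))

    flag-injective : ∀ {f f'} → flag f ≡ flag f' → f ≡ f'
    flag-injective {x , l} {x' , l'} e = cong₂ _,_
      (pt-x {x} {l} {x'} {l'} (trans (sym (toℕ-fromℕ< (pt<n x l))) (trans (cong (λ t → toℕ (Triple.a t)) e) (toℕ-fromℕ< (pt<n x' l')))))
      (toℕ-injective (+-cancelˡ-≡ Q _ _ (trans (sym (toℕ-fromℕ< (l₁<n l))) (trans (cong (λ t → toℕ (Triple.b t)) e) (toℕ-fromℕ< (l₁<n l'))))))

    plane : Hypergraph3 n
    plane = hypergraph (map flag (cartesianProduct (allFin q) (allFin Q)))
      (Unique.map⁺ flag-injective (Unique.cartesianProduct⁺ (Unique.allFin⁺ q) (Unique.allFin⁺ Q)))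

    plane-size : ∣E∣ plane ≡ q ℕ.* (q ℕ.* q)
    plane-size = trans (length-map flag (cartesianProduct (allFin q) (allFin Q)))
      (trans (length-cartesianProduct (allFin q) (allFin Q)) (cong₂ ℕ._*_ (length-tabulate {n = q} (λ i → i)) (length-tabulate {n = Q} (λ i → i))))

    On : Fin q × Fin Q → ℕ → Set
    On (x , l) v = (v ≡ pt x l) ⊎ ((v ≡ l₁ l) ⊎ (v ≡ l₂ l))

    on : ∀ f v → v ∈₃ flag f → On f (toℕ v)
    on (x , l) v (inj₁ e) = inj₁ (trans (cong toℕ e) (toℕ-fromℕ< (pt<n x l)))
    on (x , l) v (inj₂ (inj₁ e)) = inj₂ (inj₁ (trans (cong toℕ e) (toℕ-fromℕ< (l₁<n l))))
    on (x , l) v (inj₂ (inj₂ e)) = inj₂ (inj₂ (trans (cong toℕ e) (toℕ-fromℕ< (l₂<n l))))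

    Line : ℕ → Fin Q → Fin Q → Set
    Line v l l' = (l ≡ l') × ((v ≡ l₁ l) ⊎ (v ≡ l₂ l))

    Point : ℕ → Fin q × Fin Q → Fin q × Fin Q → Set
    Point v (x , l) (x' , l') = (v ≡ pt x l) × (v ≡ pt x' l')

    l₁≢l₂ : ∀ l l' → l₁ l ≡ l₂ l' → ⊥
    l₁≢l₂ l l' e = <⇒≱ (toℕ<n l) (≤-trans (m≤m+n Q (toℕ l')) (≤-reflexive (sym (+-cancelˡ-≡ Q _ _ e))))

    pt≢line : ∀ {x l l' v} → v ≡ pt x l → (v ≡ l₁ l') ⊎ (v ≡ l₂ l') → ⊥
    pt≢line {x} {l} {l'} refl (inj₁ e) = <-irrefl e (pt<l₁ x l l')
    pt≢line {x} {l} {l'} refl (inj₂ e) = <-irrefl e (<-trans (pt<l₁ x l l') (l₁<l₂ l'))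

    shared : ∀ f f' v → On f v → On f' v → Point v f f' ⊎ Line v (proj₂ f) (proj₂ f')
    shared (x , l) (x' , l') v (inj₁ e) (inj₁ e') = inj₁ (e , e')
    shared (x , l) (x' , l') v (inj₁ e) (inj₂ e') = ⊥-elim (pt≢line {x} {l} {l'} e e')
    shared (x , l) (x' , l') v (inj₂ e) (inj₁ e') = ⊥-elim (pt≢line {x'} {l'} {l} e' e)
    shared (x , l) (x' , l') v (inj₂ (inj₁ e)) (inj₂ (inj₁ e')) = inj₂ (toℕ-injective (+-cancelˡ-≡ Q _ _ (trans (sym e) e')) , inj₁ e)
    shared (x , l) (x' , l') v (inj₂ (inj₁ e)) (inj₂ (inj₂ e')) = ⊥-elim (l₁≢l₂ l l' (trans (sym e) e'))
    shared (x , l) (x' , l') v (inj₂ (inj₂ e)) (inj₂ (inj₁ e')) = ⊥-elim (l₁≢l₂ l' l (trans (sym e') e))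
    shared (x , l) (x' , l') v (inj₂ (inj₂ e)) (inj₂ (inj₂ e')) = inj₂ (toℕ-injective (+-cancelˡ-≡ Q _ _ (+-cancelˡ-≡ Q _ _ (trans (sym e) e'))) , inj₂ e)

    -- All of a, b, c, d are one line, and a line has only two copies.
    three-lines : ∀ {u v w : ℕ} {a b c d} → u ≢ v → u ≢ w → v ≢ w → Line u a b → Line v b c → Line w c d → ⊥
    three-lines u≢v u≢w v≢w (refl , inj₁ x) (refl , inj₁ y) _ = u≢v (trans x (sym y))
    three-lines u≢v u≢w v≢w (refl , inj₂ x) (refl , inj₂ y) _ = u≢v (trans x (sym y))
    three-lines u≢v u≢w v≢w (refl , inj₁ x) (refl , inj₂ y) (refl , inj₁ z) = u≢w (trans x (sym z))
    three-lines u≢v u≢w v≢w (refl , inj₁ x) (refl , inj₂ y) (refl , inj₂ z) = v≢w (trans y (sym z))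
    three-lines u≢v u≢w v≢w (refl , inj₂ x) (refl , inj₁ y) (refl , inj₁ z) = v≢w (trans y (sym z))
    three-lines u≢v u≢w v≢w (refl , inj₂ x) (refl , inj₁ y) (refl , inj₂ z) = u≢w (trans x (sym z))

    two-points : ∀ {u v f g h} → u ≢ v → Point u f g → Point v g h → ⊥
    two-points u≢v (_ , e) (e' , _) = u≢v (trans e (sym e'))

    cong-mod : ∀ m m' → m ℕ.% q ≡ m' ℕ.% q → ∃[ k ] (+ m - + m' ≡ k * + q)
    cong-mod m m' e = + (m ℕ./ q) - + (m' ℕ./ q) , trans (cong₂ _-_ (ex m) (trans (ex m') (cong (λ r → + r + + (m' ℕ./ q) * + q) (sym e)))) (lem (+ (m ℕ.% q)) (+ (m ℕ./ q)) (+ (m' ℕ./ q)) (+ q))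
      where
      ex : ∀ m → + m ≡ + (m ℕ.% q) + + (m ℕ./ q) * + q
      ex m = trans (cong +_ (DM.m≡m%n+[m/n]*n m q)) (trans (ℤP.pos-+ (m ℕ.% q) _) (cong (_+_ (+ (m ℕ.% q))) (ℤP.pos-* (m ℕ./ q) q)))
      lem : ∀ r k k' q → (r + k * q) - (r + k' * q) ≡ (k - k') * q
      lem = solve-∀

    close : ∀ a b → a ℕ.< q → b ℕ.< q → q ∣ ℤ.∣ + a - + b ∣ → a ≡ b
    close a b a< b< d = ℤP.+-injective (ℤP.i-j≡0⇒i≡j (+ a) (+ b) (ℤP.∣i∣≡0⇒i≡0 (zero-of ℤ.∣ + a - + b ∣ d (bound (≤-total a b)))))
      where
      zero-of : ∀ m → q ∣ m → m ℕ.< q → m ≡ 0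
      zero-of zero _ _ = refl
      zero-of (suc m) d m< = ⊥-elim (<⇒≱ m< (Dv.∣⇒≤ d))
      bound : (a ℕ.≤ b) ⊎ (b ℕ.≤ a) → ℤ.∣ + a - + b ∣ ℕ.< q
      bound (inj₂ b≤a) = subst (ℕ._< q) (cong ℤ.∣_∣ (sym (trans (ℤP.m-n≡m⊖n a b) (ℤP.⊖-≥ b≤a)))) (≤-<-trans (m∸n≤m a b) a<)
      bound (inj₁ a≤b) = subst (ℕ._< q) (trans (cong ℤ.∣_∣ (sym (trans (ℤP.m-n≡m⊖n b a) (ℤP.⊖-≥ a≤b)))) (ℤP.∣i-j∣≡∣j-i∣ (+ b) (+ a))) (≤-<-trans (m∸n≤m b a) b<)

    ∣-abs : ∀ i k → i ≡ k * + q → q ∣ ℤ.∣ i ∣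
    ∣-abs i k e = divides ℤ.∣ k ∣ (trans (cong ℤ.∣_∣ e) (ℤP.abs-* k (+ q)))

    -- Subtracting the congruences at x and x' gives q ∣ (α - α') (x - x'). As q is prime and
    -- residues are below q, the slopes agree, and then so do the intercepts.
    meet-once : ∀ {x x' l l'} → ordinate x l ≡ ordinate x l' → ordinate x' l ≡ ordinate x' l' → x ≢ x' → l ≡ l'
    meet-once {x} {x'} {l} {l'} e e' x≢x' = line≡ l l' a≡ b≡
      where
      α = slope l
      α' = slope l'
      β = icept l
      β' = icept l'
      k₁ = cong-mod (α ℕ.* toℕ x ℕ.+ β) (α' ℕ.* toℕ x ℕ.+ β') e
      k₂ = cong-mod (α ℕ.* toℕ x' ℕ.+ β) (α' ℕ.* toℕ x' ℕ.+ β') e'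
      toZ : ∀ α x β → + (α ℕ.* x ℕ.+ β) ≡ + α * + x + + β
      toZ α x β = trans (ℤP.pos-+ (α ℕ.* x) β) (cong (_+ + β) (ℤP.pos-* α x))
      key : (+ α - + α') * (+ toℕ x - + toℕ x') ≡ (proj₁ k₁ - proj₁ k₂) * + q
      key = trans (lem (+ α) (+ α') (+ toℕ x) (+ toℕ x') (+ β) (+ β'))
        (trans (cong₂ _-_ (trans (sym (cong₂ _-_ (toZ α (toℕ x) β) (toZ α' (toℕ x) β'))) (proj₂ k₁)) (trans (sym (cong₂ _-_ (toZ α (toℕ x') β) (toZ α' (toℕ x') β'))) (proj₂ k₂))) (lem2 (proj₁ k₁) (proj₁ k₂) (+ q)))
        where
        lem : ∀ α α' x x' β β' → (α - α') * (x - x') ≡ ((α * x + β) - (α' * x + β')) - ((α * x' + β) - (α' * x' + β'))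
        lem = solve-∀
        lem2 : ∀ k k' q → k * q - k' * q ≡ (k - k') * q
        lem2 = solve-∀
      a≡ : α ≡ α'
      a≡ = go (euclidsLemma ℤ.∣ + α - + α' ∣ ℤ.∣ + toℕ x - + toℕ x' ∣ pq (subst (q ∣_) (ℤP.abs-* (+ α - + α') (+ toℕ x - + toℕ x')) (∣-abs ((+ α - + α') * (+ toℕ x - + toℕ x')) (proj₁ k₁ - proj₁ k₂) key)))
        where
        go : (q ∣ ℤ.∣ + α - + α' ∣) ⊎ (q ∣ ℤ.∣ + toℕ x - + toℕ x' ∣) → α ≡ α'
        go (inj₁ d) = close α α' (slope< l) (slope< l') d
        go (inj₂ d) = ⊥-elim (x≢x' (toℕ-injective (close (toℕ x) (toℕ x') (toℕ<n x) (toℕ<n x') d)))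
      b≡ : β ≡ β'
      b≡ = close β β' (DM.m%n<n (toℕ l) q) (DM.m%n<n (toℕ l') q) (∣-abs (+ β - + β') (proj₁ k₁) (trans (lem (+ α) (+ toℕ x) (+ β) (+ β')) (trans (cong (λ z → (+ α * + toℕ x + + β) - (+ z * + toℕ x + + β')) a≡) (trans (sym (cong₂ _-_ (toZ α (toℕ x) β) (toZ α' (toℕ x) β'))) (proj₂ k₁)))))
        where
        lem : ∀ α x β β' → β - β' ≡ (α * x + β) - (α * x + β')
        lem = solve-∀

    two-lines : ∀ {u v} {f₁ f₂ f₃ f₄ : Fin q × Fin Q} → u ≢ v → flag f₄ ≢ flag f₁ → Point u f₄ f₁ → proj₂ f₁ ≡ proj₂ f₂ → Point v f₂ f₃ → proj₂ f₃ ≡ proj₂ f₄ → ⊥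
    two-lines {u} {v} {x₁ , l} {x₂ , _} {x₃ , m} {x₄ , _} u≢v ne (p , p') refl (r , r') refl with pt-x {x₄} {m} {x₁} {l} (trans (sym p) p') | pt-x {x₂} {l} {x₃} {m} (trans (sym r) r')
    ... | refl | refl = ne (cong (λ z → flag (x₁ , z)) (meet-once {x₁} {x₂} {m} {l} (pt-y {x₁} {m} {x₁} {l} (trans (sym p) p')) (sym (pt-y {x₂} {l} {x₂} {m} (trans (sym r) r'))) λ { refl → u≢v (trans p' (sym r)) }))

    -- Each vertex of the cycle is a point or a copy of a line, shared by two consecutive flags. Two
    -- consecutive points would lie in one flag, and three consecutive line copies belong to one
    -- line. What remains is alternation, where two lines meet in two points.
    plane-free : BC4-free plane
    plane-free C = finish (fl e₁∈) (fl e₂∈) (fl e₃∈) (fl e₄∈)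
      where
      open BergeC4 C
      fl : ∀ {e} → e ∈ edges plane → ∃[ f ] (e ≡ flag f)
      fl e∈ with ∈-map⁻ flag e∈
      ... | f , _ , eq = f , eq
      ne : ∀ {u v : Fin n} → u ≢ v → toℕ u ≢ toℕ v
      ne h e = h (toℕ-injective e)
      finish : ∃[ f ] (e₁ ≡ flag f) → ∃[ f ] (e₂ ≡ flag f) → ∃[ f ] (e₃ ≡ flag f) → ∃[ f ] (e₄ ≡ flag f) → ⊥
      finish (f₁ , refl) (f₂ , refl) (f₃ , refl) (f₄ , refl) = cases
          (shared f₄ f₁ (toℕ v₁) (on f₄ v₁ v₁∈e₄) (on f₁ v₁ v₁∈e₁)) (shared f₁ f₂ (toℕ v₂) (on f₁ v₂ v₂∈e₁) (on f₂ v₂ v₂∈e₂))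
          (shared f₂ f₃ (toℕ v₃) (on f₂ v₃ v₃∈e₂) (on f₃ v₃ v₃∈e₃)) (shared f₃ f₄ (toℕ v₄) (on f₃ v₄ v₄∈e₃) (on f₄ v₄ v₄∈e₄))
        where
        PL : ℕ → Fin q × Fin Q → Fin q × Fin Q → Set
        PL v f f' = Point v f f' ⊎ Line v (proj₂ f) (proj₂ f')
        cases : PL (toℕ v₁) f₄ f₁ → PL (toℕ v₂) f₁ f₂ → PL (toℕ v₃) f₂ f₃ → PL (toℕ v₄) f₃ f₄ → ⊥
        cases (inj₁ p) (inj₁ r) _ _ = two-points {toℕ v₁} {toℕ v₂} {f₄} {f₁} {f₂} (ne v₁≢v₂) p r
        cases (inj₁ p) (inj₂ r) (inj₁ s) (inj₁ t) = two-points {toℕ v₃} {toℕ v₄} {f₂} {f₃} {f₄} (ne v₃≢v₄) s t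
        cases (inj₁ p) (inj₂ r) (inj₁ s) (inj₂ t) = two-lines {toℕ v₁} {toℕ v₃} {f₁} {f₂} {f₃} {f₄} (ne v₁≢v₃) (λ e → e₁≢e₄ (sym e)) p (proj₁ r) s (proj₁ t)
        cases (inj₁ p) (inj₂ r) (inj₂ s) (inj₁ t) = two-points {toℕ v₄} {toℕ v₁} {f₃} {f₄} {f₁} (λ e → ne v₁≢v₄ (sym e)) t p
        cases (inj₁ p) (inj₂ r) (inj₂ s) (inj₂ t) = three-lines (ne v₂≢v₃) (ne v₂≢v₄) (ne v₃≢v₄) r s t
        cases (inj₂ p) (inj₁ r) (inj₁ s) _ = two-points {toℕ v₂} {toℕ v₃} {f₁} {f₂} {f₃} (ne v₂≢v₃) r s
        cases (inj₂ p) (inj₁ r) (inj₂ s) (inj₁ t) = two-lines {toℕ v₂} {toℕ v₄} {f₂} {f₃} {f₄} {f₁} (ne v₂≢v₄) e₁≢e₂ r (proj₁ s) t (proj₁ p)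
        cases (inj₂ p) (inj₁ r) (inj₂ s) (inj₂ t) = three-lines (ne v₃≢v₄) (λ e → ne v₁≢v₃ (sym e)) (λ e → ne v₁≢v₄ (sym e)) s t p
        cases (inj₂ p) (inj₂ r) (inj₂ s) _ = three-lines (ne v₁≢v₂) (ne v₁≢v₃) (ne v₂≢v₃) p r s
        cases (inj₂ p) (inj₂ r) (inj₁ s) (inj₁ t) = two-points {toℕ v₃} {toℕ v₄} {f₂} {f₃} {f₄} (ne v₃≢v₄) s t
        cases (inj₂ p) (inj₂ r) (inj₁ s) (inj₂ t) = three-lines (λ e → ne v₁≢v₄ (sym e)) (λ e → ne v₂≢v₄ (sym e)) (ne v₁≢v₂) t p r

-- From the two estimates to the theorem

open import Defs
open import Data.Nat using (ℕ; suc; _+_; _*_; _∸_; _^_; _≤_; _<_; z≤n; s≤s)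
import Data.Nat.Properties as ℕP
open import Data.Nat.Primality using (Prime)
open import Data.Nat.Tactic.RingSolver using (solve-∀)
open import Data.Integer as ℤ using (+_)
import Data.Integer.Properties as ℤP
import Data.Integer.Tactic.RingSolver as ℤSolver
open import Data.Fin using (Fin; zero; suc)
open import Data.List using (List; _∷_; lookup)
open import Data.List.Membership.Propositional.Properties using (∈-lookup)
open import Data.List.Relation.Unary.Unique.Propositional using (Unique)
import Data.List.Relation.Unary.All as All
import Data.List.Relation.Unary.AllPairs as AllPairs
open Preliminaries using (by; nn; pos; _⊕_; _⊗_; toℤ; fromℤ; *-ab; cancel-≤; _÷_; ÷→; ÷<; ÷≤; ÷-monoˡ; isqrt; prime-in-interval; module AffinePlane; module Leaves)

lookup-injective : ∀ {A : Set} {xs : List A} → Unique xs → ∀ {i j} → lookup xs i ≡ lookup xs j → i ≡ j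
lookup-injective (x AllPairs.∷ u) {zero} {zero} e = refl
lookup-injective (x AllPairs.∷ u) {suc i} {suc j} e = cong suc (lookup-injective u e)
lookup-injective {xs = _ ∷ xs} (x AllPairs.∷ u) {zero} {suc j} e = ⊥-elim (All.lookup x (∈-lookup j) e)
lookup-injective {xs = _ ∷ xs} (x AllPairs.∷ u) {suc i} {zero} e = ⊥-elim (All.lookup x (∈-lookup i) (sym e))

module _ {n : ℕ} (G : Hypergraph3 n) (free : BC4-free G) where

  private
    m : ℕ
    m = ∣E∣ G

    E : Fin m → Triple n
    E = lookup (edges G)

    E-injective : ∀ {i j} → E i ≡ E j → i ≡ j
    E-injective = lookup-injective (nodup G)

    edge-ineq : + 81 ℤ.* (+ m ℤ.* + m) ℤ.≤ + 8 ℤ.* (+ n ℤ.* (+ n ℤ.* + n)) ℤ.+ + 96 ℤ.* (+ n ℤ.* + m)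
    edge-ineq = Leaves.edge-inequality n m E E-injective
      λ {v₁} {v₂} {v₃} {v₄} {i} {j} {k} {l} a b c d e f g h o p q r s t u v w x y z → free record
        { v₁ = v₁ ; v₂ = v₂ ; v₃ = v₃ ; v₄ = v₄ ; e₁ = E i ; e₂ = E j ; e₃ = E k ; e₄ = E l
        ; e₁∈ = ∈-lookup i ; e₂∈ = ∈-lookup j ; e₃∈ = ∈-lookup k ; e₄∈ = ∈-lookup l
        ; v₁≢v₂ = a ; v₁≢v₃ = b ; v₁≢v₄ = c ; v₂≢v₃ = d ; v₂≢v₄ = e ; v₃≢v₄ = f
        ; e₁≢e₂ = λ η → g (E-injective η) ; e₁≢e₃ = λ η → h (E-injective η) ; e₁≢e₄ = λ η → o (E-injective η)
        ; e₂≢e₃ = λ η → p (E-injective η) ; e₂≢e₄ = λ η → q (E-injective η) ; e₃≢e₄ = λ η → r (E-injective η)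
        ; v₁∈e₁ = s ; v₂∈e₁ = t ; v₂∈e₂ = u ; v₃∈e₂ = v ; v₃∈e₃ = w ; v₄∈e₃ = x ; v₄∈e₄ = y ; v₁∈e₄ = z }

  -- If m ≤ 96 n, then 10 m² ≤ 92160 n² ≤ n³. Otherwise 96 n m ≤ m², and `edge-ineq` becomes 80 m² ≤
  -- 8 n³.
  size-bound : 92160 ≤ n → 10 * (m * m) ≤ n * (n * n)
  size-bound big = fromℤ (subst₂ ℤ._≤_ (sym (trans (*-ab 10 (m * m)) (cong (ℤ._*_ (+ 10)) (*-ab m m)))) (sym (trans (*-ab n (n * n)) (cong (ℤ._*_ (+ n)) (*-ab n n)))) (go (ℕP.≤-total m (96 * n))))
    where
    small : ∀ m n N → m ℤ.≤ + 96 ℤ.* n → N ℤ.≤ n → + 92160 ℤ.≤ N → + 0 ℤ.≤ m → + 0 ℤ.≤ n → + 10 ℤ.* (m ℤ.* m) ℤ.≤ n ℤ.* (n ℤ.* n)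
    small m n N a b c m≥0 n≥0 = by (pos 10 ⊗ (m≥0 ⊗ nn a) ⊕ pos 960 ⊗ (n≥0 ⊗ nn a) ⊕ n≥0 ⊗ n≥0 ⊗ (nn b ⊕ nn c)) (lem m n N)
      where
      lem : ∀ m n N → n ℤ.* (n ℤ.* n) ℤ.- + 10 ℤ.* (m ℤ.* m) ≡ + 10 ℤ.* (m ℤ.* (+ 96 ℤ.* n ℤ.- m)) ℤ.+ + 960 ℤ.* (n ℤ.* (+ 96 ℤ.* n ℤ.- m)) ℤ.+ n ℤ.* n ℤ.* ((n ℤ.- N) ℤ.+ (N ℤ.- + 92160))
      lem = ℤSolver.solve-∀
    large : ∀ m n → + 96 ℤ.* n ℤ.≤ m → + 81 ℤ.* (m ℤ.* m) ℤ.≤ + 8 ℤ.* (n ℤ.* (n ℤ.* n)) ℤ.+ + 96 ℤ.* (n ℤ.* m) → + 0 ℤ.≤ m → + 10 ℤ.* (m ℤ.* m) ℤ.≤ n ℤ.* (n ℤ.* n)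
    large m n a b m≥0 = cancel-≤ (+ 8) (ℤ.+<+ (s≤s z≤n)) (by (nn b ⊕ m≥0 ⊗ nn a) (lem m n))
      where
      lem : ∀ m n → + 8 ℤ.* (n ℤ.* (n ℤ.* n)) ℤ.- + 8 ℤ.* (+ 10 ℤ.* (m ℤ.* m)) ≡ (+ 8 ℤ.* (n ℤ.* (n ℤ.* n)) ℤ.+ + 96 ℤ.* (n ℤ.* m) ℤ.- + 81 ℤ.* (m ℤ.* m)) ℤ.+ m ℤ.* (m ℤ.- + 96 ℤ.* n)
      lem = ℤSolver.solve-∀
    go : (m ≤ 96 * n) ⊎ (96 * n ≤ m) → + 10 ℤ.* (+ m ℤ.* + m) ℤ.≤ + n ℤ.* (+ n ℤ.* + n)
    go (inj₁ h) = small (+ m) (+ n) (+ n) (subst (ℤ._≤_ (+ m)) (*-ab 96 n) (toℤ h)) ℤP.≤-refl (toℤ big) (pos m) (pos n)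
    go (inj₂ h) = large (+ m) (+ n) (subst (λ z → z ℤ.≤ + m) (*-ab 96 n) (toℤ h)) edge-ineq (pos m)

third-sqrt : ∀ n → ∃[ s ] (3 * (s * s) ≤ n × n < 3 * (suc s * suc s))
third-sqrt n with isqrt (n ÷ 3)
... | s , lo , hi = s , ÷→ {n} {3} (s≤s z≤n) lo , ℕP.<-≤-trans (÷< {n} {3} (s≤s z≤n)) (ℕP.*-monoʳ-≤ 3 hi)

-- The loss (1 + 1/r)³ from replacing √(n/3) by a prime is at most 1 + 1/k. Since r + 1 = 16 (k +
-- 1), the bound 16 ≤ r + 1 asked for by `prime-in-interval` holds for every k. The long polynomial
-- is the exact difference of the two sides.
scale-ratio : ∀ k r → r ≡ 16 * k + 15 → k * (suc r * (suc r * suc r)) ≤ suc k * (r * (r * r))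
scale-ratio k _ refl = ℕP.≤-trans (ℕP.m≤m+n _ (3 * k * (16 * k + 15) * (16 * k + 14) + 10 * k * (16 * k + 15) * (16 * k + 15) + (3840 * k * k + 7199 * k + 3375))) (ℕP.≤-reflexive (lem k))
  where
  lem : ∀ k → k * (suc (16 * k + 15) * (suc (16 * k + 15) * suc (16 * k + 15))) + (3 * k * (16 * k + 15) * (16 * k + 14) + 10 * k * (16 * k + 15) * (16 * k + 15) + (3840 * k * k + 7199 * k + 3375))
    ≡ suc k * ((16 * k + 15) * ((16 * k + 15) * (16 * k + 15)))
  lem = solve-∀

sq-mono : ∀ {a b} → a ≤ b → a * a ≤ b * b
sq-mono h = ℕP.*-mono-≤ h h

cube-mono : ∀ {a b} → a ≤ b → a * (a * a) ≤ b * (b * b)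
cube-mono h = ℕP.*-mono-≤ h (sq-mono h)

-- The hypotheses give n r² ≤ 3 ((r + 1) p)². Its cube meets the square of `scale-ratio` after
-- multiplication by (r + 1)⁶, which avoids division.
lower-arith : ∀ k r n s p → r ≡ 16 * k + 15 → n ≤ 3 * (suc s * suc s) → r * suc s ≤ suc r * p →
  k * k * (n * (n * n)) ≤ 27 * (suc k * suc k) * ((p * (p * p)) * (p * (p * p)))
lower-arith k r n s p r≡ n≤ rs≤ = ℕP.*-cancelˡ-≤ Q (begin
  Q * (k * k * (n * (n * n)))
    ≡⟨ e₁ k r n ⟩
  (k * (suc r * (suc r * suc r))) * (k * (suc r * (suc r * suc r))) * (n * (n * n))
    ≤⟨ ℕP.*-monoˡ-≤ (n * (n * n)) (sq-mono (scale-ratio k r r≡)) ⟩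
  (suc k * (r * (r * r))) * (suc k * (r * (r * r))) * (n * (n * n))
    ≡⟨ e₂ k r n ⟩
  suc k * suc k * ((n * (r * r)) * ((n * (r * r)) * (n * (r * r))))
    ≤⟨ ℕP.*-monoʳ-≤ (suc k * suc k) (cube-mono nr²) ⟩
  suc k * suc k * (B * (B * B))
    ≡⟨ e₃ k r p ⟩
  Q * (27 * (suc k * suc k) * ((p * (p * p)) * (p * (p * p)))) ∎)
  where
  open ℕP.≤-Reasoning
  Q = (suc r * (suc r * suc r)) * (suc r * (suc r * suc r))
  B = 3 * ((suc r * p) * (suc r * p))
  nr² : n * (r * r) ≤ B
  nr² = ℕP.≤-trans (ℕP.*-monoˡ-≤ (r * r) n≤) (ℕP.≤-trans (ℕP.≤-reflexive (e₀ r s)) (ℕP.*-monoʳ-≤ 3 (sq-mono rs≤)))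
    where
    e₀ : ∀ r s → 3 * (suc s * suc s) * (r * r) ≡ 3 * ((r * suc s) * (r * suc s))
    e₀ = solve-∀
  e₁ : ∀ k r n → (suc r * (suc r * suc r)) * (suc r * (suc r * suc r)) * (k * k * (n * (n * n))) ≡ (k * (suc r * (suc r * suc r))) * (k * (suc r * (suc r * suc r))) * (n * (n * n))
  e₁ = solve-∀
  e₂ : ∀ k r n → (suc k * (r * (r * r))) * (suc k * (r * (r * r))) * (n * (n * n)) ≡ suc k * suc k * ((n * (r * r)) * ((n * (r * r)) * (n * (r * r))))
  e₂ = solve-∀
  e₃ : ∀ k r p → suc k * suc k * (3 * ((suc r * p) * (suc r * p)) * (3 * ((suc r * p) * (suc r * p)) * (3 * ((suc r * p) * (suc r * p))))) ≡ (suc r * (suc r * suc r)) * (suc r * (suc r * suc r)) * (27 * (suc k * suc k) * ((p * (p * p)) * (p * (p * p))))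
  e₃ = solve-∀

-- The gap theorem is applied at x = s - s ÷ (r + 1), so that its interval ends at or below s; x ≥
-- s/2 because r + 1 ≥ 2.
prime-below : ∀ r N s → (∀ x → N ≤ x → ∃[ p ] (Prime p × x < p × p ≤ x + x ÷ suc r)) → 1 ≤ r → 2 * N ≤ s →
  ∃[ p ] (Prime p × p ≤ s × r * suc s ≤ suc r * p)
prime-below r N s gap 1≤r N≤ = conclude (gap x N≤x)
  where
  y = s ÷ suc r
  x = s ∸ y
  y≤s : y ≤ s
  y≤s = ÷≤ s (suc r)
  qy≤s : suc r * y ≤ s
  qy≤s = ÷→ {s} {suc r} (s≤s z≤n) ℕP.≤-refl
  x+y : x + y ≡ s
  x+y = ℕP.m∸n+n≡m y≤s
  N≤x : N ≤ x
  N≤x = ℕP.*-cancelˡ-≤ 2 (ℕP.≤-trans N≤ (ℕP.≤-trans (ℕP.≤-reflexive (sym x+y)) (ℕP.≤-trans (ℕP.+-monoʳ-≤ x y≤x) (ℕP.≤-reflexive (cong (_+_ x) (sym (ℕP.+-identityʳ x)))))))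
    where
    y≤x : y ≤ x
    y≤x = ℕP.+-cancelʳ-≤ y y x (ℕP.≤-trans (ℕP.≤-trans (ℕP.≤-reflexive (cong (_+_ y) (sym (ℕP.+-identityʳ y)))) (ℕP.*-monoˡ-≤ y (s≤s 1≤r))) (ℕP.≤-trans qy≤s (ℕP.≤-reflexive (sym x+y))))
  conclude : ∃[ p ] (Prime p × x < p × p ≤ x + x ÷ suc r) → ∃[ p ] (Prime p × p ≤ s × r * suc s ≤ suc r * p)
  conclude (p , pp , x<p , p≤) = p , pp , ℕP.≤-trans p≤ (ℕP.≤-trans (ℕP.+-monoʳ-≤ x (÷-monoˡ (suc r) (ℕP.m∸n≤m s y))) (ℕP.≤-reflexive x+y)) ,
    ℕP.≤-trans (ℕP.+-cancelʳ-≤ s (r * suc s) (suc r * suc x) (begin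
      r * suc s + s              ≤⟨ ℕP.n≤1+n _ ⟩
      suc (r * suc s + s)        ≡⟨ f₁ r s ⟩
      suc r * suc s              ≡⟨ cong (λ z → suc r * suc z) (sym x+y) ⟩
      suc r * suc (x + y)        ≡⟨ f₂ r x y ⟩
      suc r * suc x + suc r * y  ≤⟨ ℕP.+-monoʳ-≤ (suc r * suc x) qy≤s ⟩
      suc r * suc x + s          ∎)) (ℕP.*-monoʳ-≤ (suc r) x<p)
    where
    open ℕP.≤-Reasoning
    f₁ : ∀ r s → suc (r * suc s + s) ≡ suc r * suc s
    f₁ = solve-∀
    f₂ : ∀ r x y → suc r * suc (x + y) ≡ suc r * suc x + suc r * y
    f₂ = solve-∀

theorem1 : (k : ℕ) → Σ[ N ∈ ℕ ] ((n : ℕ) → N ≤ n → (m : ℕ) → IsEx3BC4 n m →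
    (k ^ 2 * n ^ 3 ≤ 27 * (suc k) ^ 2 * m ^ 2)
    × (10 * (suc k) ^ 2 * m ^ 2 ≤ (suc (suc k)) ^ 2 * n ^ 3))
-- n ≥ 3 (2 N)² forces s ≥ 2 N, as `prime-below` asks; 92160 serves `size-bound`.
theorem1 k = 3 * (2 * N * (2 * N)) + 92160 , λ n N≤n m ex → lower n N≤n m (proj₂ ex) , upper n N≤n m (proj₁ ex)
  where
  r : ℕ
  r = 16 * k + 15
  1≤r : 1 ≤ r
  1≤r = ℕP.≤-trans (s≤s z≤n) (ℕP.m≤n+m 15 (16 * k))
  gap = prime-in-interval (suc r) (s≤s (ℕP.m≤n+m 15 (16 * k)))
  N : ℕ
  N = proj₁ gap
  square : ∀ a → a ^ 2 ≡ a * a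
  square a = cong (a *_) (ℕP.*-identityʳ a)
  cube : ∀ a → a ^ 3 ≡ a * (a * a)
  cube a = cong (a *_) (square a)
  lower : ∀ n → 3 * (2 * N * (2 * N)) + 92160 ≤ n → ∀ m → (∀ (H : Hypergraph3 n) → BC4-free H → ∣E∣ H ≤ m) → k ^ 2 * n ^ 3 ≤ 27 * (suc k) ^ 2 * m ^ 2
  lower n N≤n m max = at (third-sqrt n)
    where
    at : ∃[ s ] (3 * (s * s) ≤ n × n < 3 * (suc s * suc s)) → k ^ 2 * n ^ 3 ≤ 27 * (suc k) ^ 2 * m ^ 2
    at (s , lo , hi) = use (prime-below r N s (proj₂ gap) 1≤r 2N≤s)
      where
      2N≤s : 2 * N ≤ s
      2N≤s = ℕP.≮⇒≥ λ s< → ℕP.<⇒≱ hi (ℕP.≤-trans (ℕP.*-monoʳ-≤ 3 (sq-mono s<)) (ℕP.≤-trans (ℕP.m≤m+n _ 92160) N≤n))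
      use : ∃[ p ] (Prime p × p ≤ s × r * suc s ≤ suc r * p) → k ^ 2 * n ^ 3 ≤ 27 * (suc k) ^ 2 * m ^ 2
      use (p , pp , p≤s , rs≤) = subst₂ _≤_ (sym (cong₂ _*_ (square k) (cube n))) (sym (cong₂ (λ a b → 27 * a * b) (square (suc k)) (square m)))
        (ℕP.≤-trans (lower-arith k r n s p refl (ℕP.<⇒≤ hi) rs≤) (ℕP.*-monoʳ-≤ (27 * (suc k * suc k)) (sq-mono p³≤m)))
        where
        module Pl = AffinePlane p pp n (ℕP.≤-trans (ℕP.*-monoʳ-≤ 3 (sq-mono p≤s)) lo)
        p³≤m : p * (p * p) ≤ m
        p³≤m = subst (_≤ m) Pl.plane-size (max Pl.plane Pl.plane-free)
  upper : ∀ n → 3 * (2 * N * (2 * N)) + 92160 ≤ n → ∀ m → Σ[ H ∈ Hypergraph3 n ] (BC4-free H × ∣E∣ H ≡ m) → 10 * (suc k) ^ 2 * m ^ 2 ≤ (suc (suc k)) ^ 2 * n ^ 3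
  upper n N≤n _ (G , free , refl) = subst₂ _≤_ (trans (ac (suc k * suc k) (∣E∣ G * ∣E∣ G)) (sym (cong₂ (λ a b → 10 * a * b) (square (suc k)) (square (∣E∣ G))))) (sym (cong₂ _*_ (square (suc (suc k))) (cube n)))
    (ℕP.*-mono-≤ (sq-mono (ℕP.n≤1+n (suc k))) (size-bound G free (ℕP.≤-trans (ℕP.m≤n+m 92160 (3 * (2 * N * (2 * N)))) N≤n)))
    where
    ac : ∀ a b → a * (10 * b) ≡ 10 * a * b
    ac = solve-∀
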